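{- Let $k\geq 2$ be an integer and let $G$ be a $\Delta$-critical graph of order $n$. If $\Delta\geq \frac{2}{3}n+\frac{3k}{2}$ and $\delta(G_{\Delta})\leq k$, then $G$ is overfull.
   Context: All graphs are finite and simple. $\Delta=\Delta(G)$ is the maximum degree and $\chi'(G)$ the chromatic index. $G$ is class 2 if $\chi'(G)=\Delta(G)+1$. A graph $G$ is critical if $\chi'(H)<\chi'(G)$ for every proper subgraph $H$ of $G$; a $\Delta$-critical graph is a critical class 2 graph with maximum degree $\Delta$. $G$ is overfull if $|E(G)|/\lfloor n/2\rfloor>\Delta(G)$, where $n=|V(G)|$. The core $G_\Delta$ of $G$ is the subgraph induced by all vertices of degree $\Delta(G)$, and $\delta(G_\Delta)$ is its minimum degree. -}

module Defs where

open import Data.Bool using (Bool; true; false)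
open import Data.Nat using (ℕ; zero; suc; _+_; _*_; _∸_; _≤_; _<_; _⊔_; _⊓_; _/_)
open import Data.Fin using (Fin; _<?_)
open import Data.Nat.Properties using (_≟_)
open import Data.List using (List; length; filter; foldr; map)
open import Data.Nat.ListAction using (sum)
open import Data.Bool using (_∧_)
open import Data.Sum using (_⊎_)
open import Data.List.Base using (allFin)
open import Data.Product using (Σ; _×_; ∃)
open import Relation.Binary.PropositionalEquality using (_≡_; _≢_)
open import Relation.Nullary using (¬_)
open import Relation.Nullary.Decidable using (⌊_⌋)
import Data.Bool.Properties as BP

record Graph (n : ℕ) : Set where
  field
    adj   : Fin n → Fin n → Bool
    sym   : ∀ i j → adj i j ≡ adj j i
    irref : ∀ i → adj i i ≡ false
open Graph public

countFin : (n : ℕ) → (Fin n → Bool) → ℕ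
countFin n p = length (filter (λ i → p i BP.≟ true) (allFin n))

deg : ∀ {n} → Graph n → Fin n → ℕ
deg {n} G v = countFin n (adj G v)

maxDeg : ∀ {n} → Graph n → ℕ
maxDeg {n} G = foldr _⊔_ 0 (map (deg G) (allFin n))

numEdges : ∀ {n} → Graph n → ℕ
numEdges {n} G = sum (map (λ i → countFin n (λ j → ⌊ i <? j ⌋ ∧ adj G i j)) (allFin n))

-- G is overfull:  |E(G)| / ⌊n/2⌋ > Δ(G), i.e. |E(G)| > Δ(G) · ⌊n/2⌋
Overfull : ∀ {n} → Graph n → Set
Overfull {n} G = maxDeg G * (n / 2) < numEdges G

-- An edge set on Fin n (symmetric boolean relation); used for G and its subgraphs.
EdgeRel : ℕ → Set
EdgeRel n = Fin n → Fin n → Bool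

Colourable : ∀ {n} → EdgeRel n → ℕ → Set
Colourable {n} E k =
  Σ (Fin n → Fin n → Fin k) λ c →
    (∀ i j → E i j ≡ true → c i j ≡ c j i) ×
    (∀ i j l → E i j ≡ true → E i l ≡ true → j ≢ l → c i j ≢ c i l)

IsChromaticIndex : ∀ {n} → EdgeRel n → ℕ → Set
IsChromaticIndex E k = Colourable E k × (∀ m → m < k → ¬ Colourable E m)

Class2 : ∀ {n} → Graph n → Set
Class2 G = IsChromaticIndex (adj G) (suc (maxDeg G))

record Subgraph {n : ℕ} (G : Graph n) : Set where
  field
    vs    : Fin n → Bool
    es    : EdgeRel n
    esSym : ∀ i j → es i j ≡ es j i
    esSub : ∀ i j → es i j ≡ true → adj G i j ≡ true
    esEnd : ∀ i j → es i j ≡ true → vs i ≡ true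
open Subgraph public

Proper : ∀ {n} {G : Graph n} → Subgraph G → Set
Proper {n} {G} H =
  (Σ (Fin n) λ v → vs H v ≡ false) ⊎
  (Σ (Fin n) λ i → Σ (Fin n) λ j → adj G i j ≡ true × es H i j ≡ false)

Critical : ∀ {n} → Graph n → Set
Critical G = ∀ (H : Subgraph G) → Proper H →
  ∀ a b → IsChromaticIndex (es H) a → IsChromaticIndex (adj G) b → a < b

DeltaCritical : ∀ {n} → Graph n → Set
DeltaCritical G = Critical G × Class2 G

inCore : ∀ {n} → Graph n → Fin n → Bool
inCore G v = ⌊ deg G v ≟ maxDeg G ⌋

coreDeg : ∀ {n} → Graph n → Fin n → ℕ
coreDeg {n} G v = countFin n (λ u → adj G v u ∧ inCore G u)

-- δ(G_Δ): minimum of coreDeg over core vertices (the core is non-empty when n ≥ 1;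
-- for n = 0 the value n = 0 is returned)
minCoreDeg : ∀ {n} → Graph n → ℕ
minCoreDeg {n} G =
  foldr _⊓_ n (map (coreDeg G) (filter (λ v → inCore G v BP.≟ true) (allFin n)))

{-# OPTIONS --safe #-}
-- Let r be a core vertex with κ ≤ k core neighbours, and take a Δ-colouring of G − rs for a non-core neighbour s of r.
-- An arc q → z means that z is joined to r by a colour missing at q; the fan at s is what can be reached from s along
-- arcs. Kempe changes show that the vertices of the fan and r have pairwise disjoint sets of missing colours, so the
-- fan contains at least Δ − d(s) core vertices. If G is not overfull, some colouring has a vertex x other than r that
-- also misses the colour θ missing at r. Among such colourings, with a non-core neighbour t of r of smallest degree in
-- the fan, choose one with the largest fan, and move the uncoloured edge so that s has an arc, of colour α, to a core
-- vertex. A vertex is wild if it lies outside the fan and misses θ or a colour missing in the fan.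
--
-- By maximality, further neighbours y of r can serve as starting points besides s: all non-core ones if none of these
-- can become wild; otherwise those for which the colour of sy leads from r to a non-core vertex, with x one of the wild
-- neighbours. For every edge yx between x and the resulting set, the colour of yx can be freed at y, so that the branch
-- starting with it has missing colours disjoint from all others. Comparing missing colours with arcs gives
-- |A| + Δ − d(t) ≤ κ for the set A of such y. A vertex adjacent to r, s and x is a core vertex, is joined to s by one
-- of at most κ bad colours, or is in one of two such sets A; this gives 3Δ ≤ 2n + 4κ. When no non-core neighbour of r
-- can be wild, x is not adjacent to r, and the same bound follows from the neighbours of x together with the fan at x
-- for a centre adjacent to x. Either way 6Δ ≥ 4n + 9k is violated.
module Submission where

open import Defs
open import Data.Bool using (Bool; true; false; _∧_; _∨_; not; if_then_else_) renaming (T to IsTrue)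
open import Data.Nat using (ℕ; zero; suc; _+_; _*_; _∸_; _≤_; _<_; z≤n; s≤s; _/_; _⊔_; _⊓_)
import Data.Nat.Properties as ℕ
import Data.Nat.DivMod as DivMod
open import Data.Nat.ListAction using (sum)
import Algebra.Properties.CommutativeSemigroup as CommSemigroup
open import Data.Nat.Solver using (module +-*-Solver)
open import Data.Fin using (Fin; zero; suc; _≟_)
import Data.Fin as F
import Data.Fin.Properties as F
import Data.Bool.Properties as B
open import Data.Maybe using (Maybe; just; nothing)
open import Data.Maybe.Properties using (just-injective)
open import Data.List using (length; filter; foldr; map; tabulate)
open import Data.Product using (∃; _×_; _,_; proj₁; proj₂)
open import Data.Sum using (_⊎_; inj₁; inj₂; [_,_]′)
open import Data.Empty using (⊥; ⊥-elim)
open import Data.Unit using (⊤; tt)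
open import Function using (_∘_; id; case_of_)
open import Relation.Nullary using (¬_; Dec; yes; no; does)
open import Relation.Nullary.Decidable using (⌊_⌋)
open import Relation.Binary.PropositionalEquality using (_≡_; _≢_; refl; cong; cong₂; subst; trans; module ≡-Reasoning) renaming (sym to ≡sym)
open import Relation.Binary.Definitions using (tri<; tri≈; tri>)

-- The counting rests on one comparison. In a set closed under arcs whose sets of missing colours
-- are pairwise disjoint, every missing colour is also the colour of an arc into the set, and
-- different colours have different targets. A non-core vertex pays for its own place with a missing
-- colour, so any surplus has to be paid for by core vertices, which are neighbours of `r` and hence
-- at most κ in number. The largest deficiency Δ - d(t) is one surplus. Each edge from the set to
-- `x` brings one more colour, provided the branch that this colour opens is counted along; this is
-- how |A| enters.
--
-- The obstacle is that neighbours of `x` may lie outside the fan. Adding them as start vertices is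
-- sound only if they remain start vertices under all changes of the colouring that the proof makes.
-- This is where maximality and the choice of α come in: a core vertex misses no colour, so no arc
-- leaves it, and giving up α at `s` costs the fan that one vertex only, whereas a new arc from `s`
-- to a non-core vertex gains that vertex and its successor.
--
-- The final estimate has a small margin: doubled, it reads 6Δ ≤ 4n + 8κ, against 4n + 9k.

-- Classical case distinctions are available inside proofs of ⊥, in continuation-passing style.
by-cases : (P : Set) → (P → ⊥) → (¬ P → ⊥) → ⊥
by-cases P f g = g f

-- With finitely many indices, the single case distinctions can be nested, so one continuation
-- receives all the decisions at once.
decide-all : ∀ {n} (P : Fin n → Set) → ((∀ i → Dec (P i)) → ⊥) → ⊥
decide-all {zero} P k = k (λ ())
decide-all {suc n} P k = decide-all (P ∘ suc) λ d →
  by-cases (P zero)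
    (λ p → k λ { zero → yes p ; (suc i) → d i })
    (λ ¬p → k λ { zero → no ¬p ; (suc i) → d i })

-- Makes an undecided predicate on vertices available as a characteristic function, which can be
-- summed over or used as the region of a Kempe change.
as-bool : ∀ {n} (P : Fin n → Set) →
  ((S : Fin n → Bool) → (∀ {i} → S i ≡ true → P i) → (∀ {i} → P i → S i ≡ true) → ⊥) → ⊥
as-bool {n} P k = decide-all P λ d → k (S d) (λ {i} → to d i) (λ {i} → from d i)
  where
  S : (∀ i → Dec (P i)) → Fin n → Bool
  S d i = does (d i)
  to : ∀ d i → S d i ≡ true → P i
  to d i e with d i
  ... | yes p = p
  ... | no _ = case e of λ ()
  from : ∀ d i → P i → S d i ≡ true
  from d i p with d i
  ... | yes _ = refl
  ... | no ¬p = ⊥-elim (¬p p)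

-- Booleans and optional values

true≢false : ∀ {b} → b ≡ true → b ≡ false → ⊥
true≢false refl ()

true-or-false : ∀ b → b ≡ true ⊎ b ≡ false
true-or-false true = inj₁ refl
true-or-false false = inj₂ refl

-- Equality tests whose with-abstraction does not touch a goal that mentions _≟_.
same? : ∀ {n} (i j : Fin n) → i ≡ j ⊎ i ≢ j
same? i j with i ≟ j
... | yes p = inj₁ p
... | no p = inj₂ p

among? : ∀ {n} (i j k : Fin n) → i ≡ j ⊎ (i ≡ k ⊎ (i ≢ j × i ≢ k))
among? i j k with i ≟ j
... | yes p = inj₁ p
... | no p with i ≟ k
...   | yes q = inj₂ (inj₁ q)
...   | no q = inj₂ (inj₂ (p , q))

not-true : ∀ {b} → (b ≡ true → ⊥) → b ≡ false
not-true {true} h = ⊥-elim (h refl)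
not-true {false} h = refl

just≢nothing : ∀ {A : Set} {x : Maybe A} {a} → x ≡ just a → x ≡ nothing → ⊥
just≢nothing refl ()

just-or-nothing : ∀ {A : Set} (x : Maybe A) → (∃ λ a → x ≡ just a) ⊎ x ≡ nothing
just-or-nothing (just a) = inj₁ (a , refl)
just-or-nothing nothing = inj₂ refl

⟦_⟧ : Bool → ℕ
⟦ true ⟧ = 1
⟦ false ⟧ = 0

⟦⟧≤1 : ∀ b → ⟦ b ⟧ ≤ 1
⟦⟧≤1 true = s≤s z≤n
⟦⟧≤1 false = z≤n

⟦⟧-true : ∀ {b} → b ≡ true → ⟦ b ⟧ ≡ 1
⟦⟧-true refl = refl

⟦⟧-false : ∀ {b} → (b ≡ true → ⊥) → ⟦ b ⟧ ≡ 0
⟦⟧-false h = cong ⟦_⟧ (not-true h)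

⟦⟧-mono : ∀ {b} {k} → (b ≡ true → 1 ≤ k) → ⟦ b ⟧ ≤ k
⟦⟧-mono {true} h = h refl
⟦⟧-mono {false} h = z≤n

infix 7 _==_
_==_ : ∀ {n} → Fin n → Fin n → Bool
i == j = does (i ≟ j)

==-true : ∀ {n} {i j : Fin n} → (i == j) ≡ true → i ≡ j
==-true {i = i} {j} e with i ≟ j
... | yes p = p
... | no _ = case e of λ ()

==-refl : ∀ {n} {i j : Fin n} → i ≡ j → (i == j) ≡ true
==-refl {i = i} {j} p with i ≟ j
... | yes _ = refl
... | no ¬p = ⊥-elim (¬p p)

is-nothing : ∀ {A : Set} → Maybe A → Bool
is-nothing (just _) = false
is-nothing nothing = true

is-nothing-true : ∀ {A : Set} {x : Maybe A} → is-nothing x ≡ true → x ≡ nothing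
is-nothing-true {x = nothing} _ = refl

is-nothing-intro : ∀ {A : Set} {x : Maybe A} → x ≡ nothing → is-nothing x ≡ true
is-nothing-intro refl = refl

is-just : ∀ {n} → Maybe (Fin n) → Fin n → Bool
is-just (just a) b = a == b
is-just nothing b = false

is-just-true : ∀ {n} {x : Maybe (Fin n)} {b} → is-just x b ≡ true → x ≡ just b
is-just-true {x = just a} e = cong just (==-true e)

is-just-intro : ∀ {n} {x : Maybe (Fin n)} {b} → x ≡ just b → is-just x b ≡ true
is-just-intro {b = b} refl = ==-refl {i = b} refl

∧-true₁ : ∀ {a b} → a ∧ b ≡ true → a ≡ true
∧-true₁ {true} e = refl

∧-true₂ : ∀ {a b} → a ∧ b ≡ true → b ≡ true
∧-true₂ {true} e = e

∧-intro : ∀ {a b} → a ≡ true → b ≡ true → a ∧ b ≡ true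
∧-intro refl refl = refl

∨-elim : ∀ {a b} → a ∨ b ≡ true → a ≡ true ⊎ b ≡ true
∨-elim {true} e = inj₁ refl
∨-elim {false} e = inj₂ e

∨-intro₁ : ∀ {a b} → a ≡ true → a ∨ b ≡ true
∨-intro₁ refl = refl

∨-intro₂ : ∀ {a b} → b ≡ true → a ∨ b ≡ true
∨-intro₂ {true} e = refl
∨-intro₂ {false} e = e

-- Finite sums and counting

∑ : ∀ {n} → (Fin n → ℕ) → ℕ
∑ {zero} f = 0
∑ {suc n} f = f zero + ∑ (f ∘ suc)

∑-mono : ∀ {n} {f g : Fin n → ℕ} → (∀ i → f i ≤ g i) → ∑ f ≤ ∑ g
∑-mono {zero} h = z≤n
∑-mono {suc n} h = ℕ.+-mono-≤ (h zero) (∑-mono (h ∘ suc))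

∑-⊂ : ∀ {n} (p q : Fin n → Bool) → (∀ {i} → p i ≡ true → q i ≡ true) → ∑ (λ i → ⟦ p i ⟧) ≤ ∑ (λ i → ⟦ q i ⟧)
∑-⊂ p q h = ∑-mono λ i → ⟦⟧-mono λ e → ℕ.≤-reflexive (≡sym (⟦⟧-true (h {i} e)))

∑-cong : ∀ {n} {f g : Fin n → ℕ} → (∀ i → f i ≡ g i) → ∑ f ≡ ∑ g
∑-cong {zero} h = refl
∑-cong {suc n} h = cong₂ _+_ (h zero) (∑-cong (h ∘ suc))

+-interchange : ∀ a b c d → (a + b) + (c + d) ≡ (a + c) + (b + d)
+-interchange = CommSemigroup.interchange ℕ.+-commutativeSemigroup

∑-+ : ∀ {n} (f g : Fin n → ℕ) → ∑ (λ i → f i + g i) ≡ ∑ f + ∑ g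
∑-+ {zero} f g = refl
∑-+ {suc n} f g = trans (cong (f zero + g zero +_) (∑-+ (f ∘ suc) (g ∘ suc)))
  (+-interchange (f zero) (g zero) (∑ (f ∘ suc)) (∑ (g ∘ suc)))

∑-const : ∀ n k → ∑ {n} (λ _ → k) ≡ n * k
∑-const zero k = refl
∑-const (suc n) k = cong (k +_) (∑-const n k)

∑-zero : ∀ {n} {f : Fin n → ℕ} → (∀ i → f i ≡ 0) → ∑ f ≡ 0
∑-zero {n} h = trans (∑-cong h) (trans (∑-const n 0) (ℕ.*-zeroʳ n))

∑-swap : ∀ {n k} (f : Fin n → Fin k → ℕ) → ∑ (λ i → ∑ (f i)) ≡ ∑ (λ j → ∑ (λ i → f i j))
∑-swap {zero} {k} f = ≡sym (∑-zero {k} (λ _ → refl))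
∑-swap {suc n} f = trans (cong (∑ (f zero) +_) (∑-swap (f ∘ suc)))
  (≡sym (∑-+ (f zero) (λ j → ∑ (λ i → f (suc i) j))))

∑-member : ∀ {n} (f : Fin n → ℕ) i → f i ≤ ∑ f
∑-member {suc n} f zero = ℕ.m≤m+n (f zero) _
∑-member {suc n} f (suc i) = ℕ.≤-trans (∑-member (f ∘ suc) i) (ℕ.m≤n+m _ (f zero))

∑-single : ∀ {n} (f : Fin n → ℕ) j → (∀ i → i ≢ j → f i ≡ 0) → ∑ f ≡ f j
∑-single {suc n} f zero h = trans (cong (f zero +_) (∑-zero (λ i → h (suc i) (λ ())))) (ℕ.+-identityʳ _)
∑-single {suc n} f (suc j) h = trans (cong (_+ ∑ (f ∘ suc)) (h zero (λ ())))
  (∑-single (f ∘ suc) j (λ i ne → h (suc i) (λ e → ne (F.suc-injective e))))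

∑-δ : ∀ {n} (j : Fin n) → ∑ (λ i → ⟦ i == j ⟧) ≡ 1
∑-δ j = trans (∑-single _ j (λ i ne → ⟦⟧-false (ne ∘ ==-true))) (⟦⟧-true (==-refl {i = j} refl))

∑-unique : ∀ {n} (p : Fin n → Bool) → (∀ i j → p i ≡ true → p j ≡ true → i ≡ j) → ∑ (λ i → ⟦ p i ⟧) ≤ 1
∑-unique {zero} p h = z≤n
∑-unique {suc n} p h with p zero in e
... | false = ∑-unique (p ∘ suc) (λ i j a b → F.suc-injective (h (suc i) (suc j) a b))
... | true = s≤s (ℕ.≤-reflexive (∑-zero (λ i → ⟦⟧-false (λ a → case h zero (suc i) e a of λ ()))))

∑-none : ∀ {n} (p : Fin n → Bool) → (∀ i → p i ≡ true → ⊥) → ∑ (λ i → ⟦ p i ⟧) ≡ 0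
∑-none p h = ∑-zero (λ i → ⟦⟧-false (h i))

∑-≤n : ∀ {n} (p : Fin n → Bool) → ∑ (λ i → ⟦ p i ⟧) ≤ n
∑-≤n {n} p = ℕ.≤-trans (∑-mono (λ i → ⟦⟧≤1 (p i))) (ℕ.≤-reflexive (trans (∑-const n 1) (ℕ.*-identityʳ n)))

∑-find : ∀ {n} (p : Fin n → Bool) → 1 ≤ ∑ (λ i → ⟦ p i ⟧) → ∃ λ i → p i ≡ true
∑-find {suc n} p h with p zero in e
... | true = zero , e
... | false = let (i , q) = ∑-find (p ∘ suc) h in suc i , q

∑-pos : ∀ {n} (p : Fin n → Bool) i → p i ≡ true → 1 ≤ ∑ (λ i → ⟦ p i ⟧)
∑-pos p i e = ℕ.≤-trans (ℕ.≤-reflexive (≡sym (⟦⟧-true e))) (∑-member (λ i → ⟦ p i ⟧) i)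

replace : ∀ {n} → (Fin n → Bool) → Fin n → Fin n → Fin n → Fin n → Bool
replace p l x y i = (p i ∧ not (i == l)) ∨ ((i == x) ∨ (i == y))

-- One element goes out and two come in. The case `y ≡ l` has to be allowed, because the second
-- vertex gained by a fan may be the very leaf that was given up.
∑-replace : ∀ {n} (p : Fin n → Bool) l x y → (p x ≡ true → ⊥) → x ≢ l → x ≢ y → (y ≢ l → p y ≡ true → ⊥) →
  ∑ (λ i → ⟦ p i ⟧) < ∑ (λ i → ⟦ replace p l x y i ⟧)
∑-replace p l x y px x≢l x≢y py = ℕ.+-cancelʳ-≤ 1 _ _
  (ℕ.≤-trans (ℕ.≤-reflexive (trans (cong (_+ 1) (ℕ.+-comm 1 _)) (ℕ.+-assoc _ 1 1))) sums)
  where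
  pointwise : ∀ i → ⟦ p i ⟧ + (⟦ i == x ⟧ + ⟦ i == y ⟧) ≤ ⟦ replace p l x y i ⟧ + ⟦ i == l ⟧
  pointwise i with i ≟ x | i ≟ y | i ≟ l
  ... | yes refl | yes e | _ = ⊥-elim (x≢y e)
  ... | yes refl | _ | yes e = ⊥-elim (x≢l e)
  ... | yes refl | no _ | no _ rewrite not-true px = s≤s z≤n
  ... | no _ | yes refl | yes refl rewrite B.∧-zeroʳ (p i) =
    ℕ.≤-trans (ℕ.+-monoˡ-≤ 1 (⟦⟧≤1 (p i))) ℕ.≤-refl
  ... | no _ | yes refl | no y≢l rewrite not-true (py y≢l) = s≤s z≤n
  ... | no _ | no _ | yes refl rewrite B.∧-zeroʳ (p i) = ℕ.≤-trans (ℕ.≤-reflexive (ℕ.+-identityʳ _)) (⟦⟧≤1 (p i))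
  ... | no _ | no _ | no _ rewrite B.∧-identityʳ (p i) | B.∨-identityʳ (p i) = ℕ.≤-refl
  sums : ∑ (λ i → ⟦ p i ⟧) + 2 ≤ ∑ (λ i → ⟦ replace p l x y i ⟧) + 1
  sums = ℕ.≤-trans (ℕ.≤-reflexive (trans
      (cong (∑ (λ i → ⟦ p i ⟧) +_) (≡sym (trans (∑-+ (λ i → ⟦ i == x ⟧) (λ i → ⟦ i == y ⟧)) (cong₂ _+_ (∑-δ x) (∑-δ y)))))
      (≡sym (∑-+ (λ i → ⟦ p i ⟧) (λ i → ⟦ i == x ⟧ + ⟦ i == y ⟧)))))
    (ℕ.≤-trans (∑-mono pointwise) (ℕ.≤-reflexive (trans (∑-+ (λ i → ⟦ replace p l x y i ⟧) (λ i → ⟦ i == l ⟧))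
      (cong (∑ (λ i → ⟦ replace p l x y i ⟧) +_) (∑-δ l)))))

filter-length : ∀ {A : Set} (p : A → Bool) {k} (f : Fin k → A) →
  length (filter (λ x → p x B.≟ true) (tabulate f)) ≡ ∑ (λ i → ⟦ p (f i) ⟧)
filter-length p {zero} f = refl
filter-length p {suc k} f with p (f zero)
... | true = cong suc (filter-length p (f ∘ suc))
... | false = filter-length p (f ∘ suc)

countFin-∑ : ∀ n (p : Fin n → Bool) → countFin n p ≡ ∑ (λ i → ⟦ p i ⟧)
countFin-∑ n p = filter-length p id

sum-∑ : ∀ {k} {A : Set} (g : A → ℕ) (f : Fin k → A) → sum (map g (tabulate f)) ≡ ∑ (g ∘ f)
sum-∑ {zero} g f = refl
sum-∑ {suc k} g f = cong (g (f zero) +_) (sum-∑ g (f ∘ suc))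

⊔-upper : ∀ {k} {A : Set} (g : A → ℕ) (f : Fin k → A) i → g (f i) ≤ foldr _⊔_ 0 (map g (tabulate f))
⊔-upper {suc k} g f zero = ℕ.m≤m⊔n _ _
⊔-upper {suc k} g f (suc i) = ℕ.≤-trans (⊔-upper g (f ∘ suc) i) (ℕ.m≤n⊔m (g (f zero)) _)

-- The alternative `b ≤ t` stems from the seed of the fold; for the core degree the seed is `n`, and
-- the density hypothesis excludes it in the end.
⊓-attained : ∀ {A : Set} (g : A → ℕ) (p : A → Bool) {k} (f : Fin k → A) b t →
  foldr _⊓_ b (map g (filter (λ x → p x B.≟ true) (tabulate f))) ≤ t →
  b ≤ t ⊎ ∃ λ i → p (f i) ≡ true × g (f i) ≤ t
⊓-attained g p {zero} f b t h = inj₁ h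
⊓-attained g p {suc k} f b t h with p (f zero) in e
... | false = [ inj₁ , (λ { (i , x) → inj₂ (suc i , x) }) ]′ (⊓-attained g p (f ∘ suc) b t h)
... | true with ℕ.⊓-sel (g (f zero)) (foldr _⊓_ b (map g (filter (λ x → p x B.≟ true) (tabulate (f ∘ suc)))))
...   | inj₁ q = inj₂ (zero , e , ℕ.≤-trans (ℕ.≤-reflexive (≡sym q)) h)
...   | inj₂ q = [ inj₁ , (λ { (i , x) → inj₂ (suc i , x) }) ]′
                 (⊓-attained g p (f ∘ suc) b t (ℕ.≤-trans (ℕ.≤-reflexive (≡sym q)) h))

-- Partial edge colourings and the elementary changes of them

-- A partial edge colouring is recorded by its matchings: m c v is the neighbour of v along colour c, if any.
module Matchings {n : ℕ} (G : Graph n) (D : ℕ) where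

  V : Set
  V = Fin n

  C : Set
  C = Fin D

  record Col : Set where
    field
      m : C → V → Maybe V
      inv : ∀ {c v w} → m c v ≡ just w → m c w ≡ just v
      edge : ∀ {c v w} → m c v ≡ just w → adj G v w ≡ true
      uniq : ∀ {c d v w} → m c v ≡ just w → m d v ≡ just w → c ≡ d
  open Col public

  adj-irrefl : ∀ {v w} → adj G v w ≡ true → v ≢ w
  adj-irrefl {v} e refl = true≢false e (irref G v)

  adj-sym : ∀ {v w} → adj G v w ≡ true → adj G w v ≡ true
  adj-sym {v} {w} e = trans (sym G w v) e

  other-end : ∀ φ {c v w u} → m φ c v ≡ just u → m φ c w ≡ just u → v ≡ w
  other-end φ p q = just-injective (trans (≡sym (inv φ p)) (inv φ q))

  -- Such sets are the unions of components of the subgraph of colours `a` and `b`. A Kempe change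
  -- needs no more than this, and being on the same chain can be expressed by quantifying over these
  -- sets, without any walks.
  Closed : Col → C → C → (V → Bool) → Set
  Closed φ a b T = ∀ {c v w} → (c ≡ a ⊎ c ≡ b) → m φ c v ≡ just w → T v ≡ true → T w ≡ true

  closed-≡ : ∀ {φ a b T} → Closed φ a b T → ∀ {c v w} → (c ≡ a ⊎ c ≡ b) → m φ c v ≡ just w → T v ≡ T w
  closed-≡ {φ} {a} {b} {T} cl {c} {v} {w} h e with T v in p | T w in q
  ... | true | true = refl
  ... | false | false = refl
  ... | true | false = ⊥-elim (true≢false (cl h e p) q)
  ... | false | true = ⊥-elim (true≢false (cl h (inv φ e) q) p)

  transp : C → C → C → C
  transp a b c with c ≟ a
  ... | yes _ = b
  ... | no _ with c ≟ b
  ...   | yes _ = a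
  ...   | no _ = c

  transp-a : ∀ a b → transp a b a ≡ b
  transp-a a b with a ≟ a
  ... | yes _ = refl
  ... | no h = ⊥-elim (h refl)

  transp-b : ∀ a b → transp a b b ≡ a
  transp-b a b with b ≟ a
  ... | yes p = p
  ... | no _ with b ≟ b
  ...   | yes _ = refl
  ...   | no h = ⊥-elim (h refl)

  transp-other : ∀ {a b c} → c ≢ a → c ≢ b → transp a b c ≡ c
  transp-other {a} {b} {c} h k with c ≟ a
  ... | yes p = ⊥-elim (h p)
  ... | no _ with c ≟ b
  ...   | yes p = ⊥-elim (k p)
  ...   | no _ = refl

  transp-inv : ∀ a b c → transp a b (transp a b c) ≡ c
  transp-inv a b c with c ≟ a
  ... | yes p = trans (transp-b a b) (≡sym p)
  ... | no h with c ≟ b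
  ...   | yes p = trans (transp-a a b) (≡sym p)
  ...   | no k = transp-other h k

  transp-inj : ∀ a b {c d} → transp a b c ≡ transp a b d → c ≡ d
  transp-inj a b {c} {d} e = trans (≡sym (transp-inv a b c)) (trans (cong (transp a b) e) (transp-inv a b d))

  transp-cases : ∀ a b c → ((transp a b c ≡ a ⊎ transp a b c ≡ b) × (c ≡ a ⊎ c ≡ b)) ⊎ transp a b c ≡ c
  transp-cases a b c with c ≟ a
  ... | yes p = inj₁ (inj₂ refl , inj₁ p)
  ... | no _ with c ≟ b
  ...   | yes p = inj₁ (inj₁ refl , inj₂ p)
  ...   | no _ = inj₂ refl

  swapm : Col → C → C → (V → Bool) → C → V → Maybe V
  swapm φ a b T c v = if T v then m φ (transp a b c) v else m φ c v

  module _ (φ : Col) (a b : C) (T : V → Bool) where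

    swap-in : ∀ {v} c → T v ≡ true → swapm φ a b T c v ≡ m φ (transp a b c) v
    swap-in c e rewrite e = refl

    swap-out : ∀ {v} c → T v ≡ false → swapm φ a b T c v ≡ m φ c v
    swap-out c e rewrite e = refl

    swap-other : ∀ {c} v → c ≢ a → c ≢ b → swapm φ a b T c v ≡ m φ c v
    swap-other {c} v h k with T v
    ... | true = cong (λ d → m φ d v) (transp-other h k)
    ... | false = refl

  swap : ∀ φ a b T → Closed φ a b T → Col
  swap φ a b T cl = record
    { m = swapm φ a b T
    ; inv = λ {c} {v} {w} → inv′ {c} {v} {w}
    ; edge = λ {c} {v} {w} → edge′ {c} {v} {w}
    ; uniq = λ {c} {d} {v} {w} → uniq′ {c} {d} {v} {w} }
    where
    edge′ : ∀ {c v w} → swapm φ a b T c v ≡ just w → adj G v w ≡ true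
    edge′ {c} {v} e with T v
    ... | true = edge φ e
    ... | false = edge φ e
    uniq′ : ∀ {c d v w} → swapm φ a b T c v ≡ just w → swapm φ a b T d v ≡ just w → c ≡ d
    uniq′ {c} {d} {v} e f with T v
    ... | true = transp-inj a b (uniq φ e f)
    ... | false = uniq φ e f
    inv′ : ∀ {c v w} → swapm φ a b T c v ≡ just w → swapm φ a b T c w ≡ just v
    inv′ {c} {v} {w} e with T v in p
    inv′ {c} {v} {w} e | true with transp-cases a b c
    ... | inj₁ (h , _) = trans (swap-in φ a b T c (cl h e p)) (inv φ e)
    ... | inj₂ h with T w
    ...   | true = inv φ e
    ...   | false = subst (λ d → m φ d w ≡ just v) h (inv φ e)
    inv′ {c} {v} {w} e | false with transp-cases a b c
    ... | inj₁ (_ , h) = trans (swap-out φ a b T c (trans (≡sym (closed-≡ {φ} cl h e)) p)) (inv φ e)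
    ... | inj₂ h with T w
    ...   | true = subst (λ d → m φ d w ≡ just v) (≡sym h) (inv φ e)
    ...   | false = inv φ e

  remm : Col → C → V → V → C → V → Maybe V
  remm φ d x y c v with c ≟ d
  ... | no _ = m φ c v
  ... | yes _ with v ≟ x
  ...   | yes _ = nothing
  ...   | no _ with v ≟ y
  ...     | yes _ = nothing
  ...     | no _ = m φ c v

  module _ (φ : Col) (d : C) (x y : V) where

    rem-colour : ∀ {c} v → c ≢ d → remm φ d x y c v ≡ m φ c v
    rem-colour {c} v h with c ≟ d
    ... | no _ = refl
    ... | yes p = ⊥-elim (h p)

    rem-far : ∀ c {v} → v ≢ x → v ≢ y → remm φ d x y c v ≡ m φ c v
    rem-far c {v} h k with c ≟ d
    ... | no _ = refl
    ... | yes _ with v ≟ x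
    ...   | yes p = ⊥-elim (h p)
    ...   | no _ with v ≟ y
    ...     | yes p = ⊥-elim (k p)
    ...     | no _ = refl

    rem-x : remm φ d x y d x ≡ nothing
    rem-x with d ≟ d
    ... | no h = ⊥-elim (h refl)
    ... | yes _ with x ≟ x
    ...   | yes _ = refl
    ...   | no h = ⊥-elim (h refl)

    rem-y : remm φ d x y d y ≡ nothing
    rem-y with d ≟ d
    ... | no h = ⊥-elim (h refl)
    ... | yes _ with y ≟ x
    ...   | yes _ = refl
    ...   | no _ with y ≟ y
    ...     | yes _ = refl
    ...     | no h = ⊥-elim (h refl)

    rem-sub : ∀ {c v w} → remm φ d x y c v ≡ just w → m φ c v ≡ just w
    rem-sub {c} {v} e with c ≟ d
    ... | no _ = e
    ... | yes _ with v ≟ x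
    ...   | yes _ = case e of λ ()
    ...   | no _ with v ≟ y
    ...     | yes _ = case e of λ ()
    ...     | no _ = e

    rem-keep : ∀ {c v} → m φ c v ≡ nothing → remm φ d x y c v ≡ nothing
    rem-keep {c} {v} e with c ≟ d
    ... | no _ = e
    ... | yes _ with v ≟ x
    ...   | yes _ = refl
    ...   | no _ with v ≟ y
    ...     | yes _ = refl
    ...     | no _ = e

  uncolour : ∀ φ d x y → m φ d x ≡ just y → Col
  uncolour φ d x y exy = record
    { m = remm φ d x y
    ; inv = λ {c} {v} {w} → inv′ {c} {v} {w}
    ; edge = λ {c} e → edge φ (rem-sub φ d x y {c} e)
    ; uniq = λ {c} {c′} e f → uniq φ (rem-sub φ d x y {c} e) (rem-sub φ d x y {c′} f) }
    where
    inv′ : ∀ {c v w} → remm φ d x y c v ≡ just w → remm φ d x y c w ≡ just v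
    inv′ {c} {v} {w} e with c ≟ d
    ... | no _ = inv φ e
    ... | yes refl with v ≟ x
    ...   | yes _ = case e of λ ()
    ...   | no v≢x with v ≟ y
    ...     | yes _ = case e of λ ()
    ...     | no v≢y with w ≟ x
    ...       | yes refl = ⊥-elim (v≢y (just-injective (trans (≡sym (inv φ e)) exy)))
    ...       | no _ with w ≟ y
    ...         | yes refl = ⊥-elim (v≢x (other-end φ e exy))
    ...         | no _ = inv φ e

  addm : Col → C → V → V → C → V → Maybe V
  addm φ d x y c v with c ≟ d
  ... | no _ = m φ c v
  ... | yes _ with v ≟ x
  ...   | yes _ = just y
  ...   | no _ with v ≟ y
  ...     | yes _ = just x
  ...     | no _ = m φ c v

  module _ (φ : Col) (d : C) (x y : V) where

    add-colour : ∀ {c} v → c ≢ d → addm φ d x y c v ≡ m φ c v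
    add-colour {c} v h with c ≟ d
    ... | no _ = refl
    ... | yes p = ⊥-elim (h p)

    add-far : ∀ c {v} → v ≢ x → v ≢ y → addm φ d x y c v ≡ m φ c v
    add-far c {v} h k with c ≟ d
    ... | no _ = refl
    ... | yes _ with v ≟ x
    ...   | yes p = ⊥-elim (h p)
    ...   | no _ with v ≟ y
    ...     | yes p = ⊥-elim (k p)
    ...     | no _ = refl

    add-x : addm φ d x y d x ≡ just y
    add-x with d ≟ d
    ... | no h = ⊥-elim (h refl)
    ... | yes _ with x ≟ x
    ...   | yes _ = refl
    ...   | no h = ⊥-elim (h refl)

    add-y : x ≢ y → addm φ d x y d y ≡ just x
    add-y h with d ≟ d
    ... | no k = ⊥-elim (k refl)
    ... | yes _ with y ≟ x
    ...   | yes p = ⊥-elim (h (≡sym p))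
    ...   | no _ with y ≟ y
    ...     | yes _ = refl
    ...     | no k = ⊥-elim (k refl)

    add-inv : ∀ {c v w} → addm φ d x y c v ≡ just w →
      m φ c v ≡ just w ⊎ (c ≡ d × ((v ≡ x × w ≡ y) ⊎ (v ≡ y × w ≡ x)))
    add-inv {c} {v} e with c ≟ d
    ... | no _ = inj₁ e
    ... | yes p with v ≟ x
    ...   | yes q = inj₂ (p , inj₁ (q , ≡sym (just-injective e)))
    ...   | no _ with v ≟ y
    ...     | yes q = inj₂ (p , inj₂ (q , ≡sym (just-injective e)))
    ...     | no _ = inj₁ e

  colour-edge : ∀ φ d x y → adj G x y ≡ true → m φ d x ≡ nothing → m φ d y ≡ nothing →
    (∀ c → m φ c x ≢ just y) → Col
  colour-edge φ d x y axy nx ny un = record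
    { m = addm φ d x y
    ; inv = λ {c} {v} {w} → inv′ {c} {v} {w}
    ; edge = λ {c} {v} {w} → edge′ {c} {v} {w}
    ; uniq = λ {c} {c′} {v} {w} → uniq′ {c} {c′} {v} {w} }
    where
    x≢y = adj-irrefl axy
    keep : ∀ {c v w} → m φ c v ≡ just w → addm φ d x y c v ≡ just w
    keep {c} {v} e with c ≟ d
    ... | no _ = e
    ... | yes refl with v ≟ x
    ...   | yes refl = ⊥-elim (just≢nothing e nx)
    ...   | no _ with v ≟ y
    ...     | yes refl = ⊥-elim (just≢nothing e ny)
    ...     | no _ = e
    inv′ : ∀ {c v w} → addm φ d x y c v ≡ just w → addm φ d x y c w ≡ just v
    inv′ {c} {v} {w} e with add-inv φ d x y {c} {v} {w} e
    ... | inj₁ f = keep {c} (inv φ f)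
    ... | inj₂ (refl , inj₁ (refl , refl)) = add-y φ d x y x≢y
    ... | inj₂ (refl , inj₂ (refl , refl)) = add-x φ d x y
    edge′ : ∀ {c v w} → addm φ d x y c v ≡ just w → adj G v w ≡ true
    edge′ {c} {v} {w} e with add-inv φ d x y {c} {v} {w} e
    ... | inj₁ f = edge φ f
    ... | inj₂ (refl , inj₁ (refl , refl)) = axy
    ... | inj₂ (refl , inj₂ (refl , refl)) = adj-sym axy
    uniq′ : ∀ {c c′ v w} → addm φ d x y c v ≡ just w → addm φ d x y c′ v ≡ just w → c ≡ c′
    uniq′ {c} {c′} {v} {w} e f with add-inv φ d x y {c} {v} {w} e | add-inv φ d x y {c′} {v} {w} f
    ... | inj₁ e′ | inj₁ f′ = uniq φ e′ f′
    ... | inj₂ (refl , _) | inj₂ (refl , _) = refl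
    ... | inj₁ e′ | inj₂ (_ , inj₁ (refl , refl)) = ⊥-elim (un _ e′)
    ... | inj₁ e′ | inj₂ (_ , inj₂ (refl , refl)) = ⊥-elim (un _ (inv φ e′))
    ... | inj₂ (_ , inj₁ (refl , refl)) | inj₁ f′ = ⊥-elim (un _ f′)
    ... | inj₂ (_ , inj₂ (refl , refl)) | inj₁ f′ = ⊥-elim (un _ (inv φ f′))

  -- ψ is φ with the edge xy, of colour c in φ, recoloured by d.
  record Recoloured (φ ψ : Col) (x y : V) (c d : C) : Set where
    field
      was : m φ c x ≡ just y
      free-x : m φ d x ≡ nothing
      free-y : m φ d y ≡ nothing
      far : ∀ e {v} → v ≢ x → v ≢ y → m ψ e v ≡ m φ e v
      other : ∀ {e} v → e ≢ c → e ≢ d → m ψ e v ≡ m φ e v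
      old-x : m ψ c x ≡ nothing
      old-y : m ψ c y ≡ nothing
      new-x : m ψ d x ≡ just y
      new-y : m ψ d y ≡ just x

    keeps : ∀ {e v} → e ≢ d → m φ e v ≡ nothing → m ψ e v ≡ nothing
    keeps {e} {v} e≢d h with e ≟ c
    ... | no e≢c = trans (other v e≢c e≢d) h
    ... | yes refl with v ≟ x
    ...   | yes refl = old-x
    ...   | no a with v ≟ y
    ...     | yes refl = old-y
    ...     | no b = trans (far e a b) h

    keeps-edge : ∀ {e v w} → e ≢ c → m φ e v ≡ just w → m ψ e v ≡ just w
    keeps-edge {e} {v} e≢c h with e ≟ d
    ... | no e≢d = trans (other v e≢c e≢d) h
    ... | yes refl with v ≟ x
    ...   | yes refl = ⊥-elim (just≢nothing h free-x)
    ...   | no a with v ≟ y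
    ...     | yes refl = ⊥-elim (just≢nothing h free-y)
    ...     | no b = trans (far e a b) h

    edge-to : ∀ {e v w} → m φ e v ≡ just w → ∃ λ e′ → m ψ e′ v ≡ just w
    edge-to {e} {v} h with e ≟ c
    ... | no e≢c = e , keeps-edge e≢c h
    ... | yes refl with v ≟ x
    ...   | yes refl = d , trans new-x (trans (≡sym was) h)
    ...   | no a with v ≟ y
    ...     | yes refl = d , trans new-y (trans (≡sym (inv φ was)) h)
    ...     | no b = e , trans (far e a b) h

    edge-from : ∀ {e v w} → m ψ e v ≡ just w → ∃ λ e′ → m φ e′ v ≡ just w
    edge-from {e} {v} h with v ≟ x
    ... | no a with v ≟ y
    ...   | no b = e , trans (≡sym (far e a b)) h
    ...   | yes refl with e ≟ d
    ...     | yes refl = c , trans (inv φ was) (trans (≡sym new-y) h)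
    ...     | no e≢d with e ≟ c
    ...       | yes refl = ⊥-elim (just≢nothing h old-y)
    ...       | no e≢c = e , trans (≡sym (other v e≢c e≢d)) h
    edge-from {e} {v} h | yes refl with e ≟ d
    ... | yes refl = c , trans was (trans (≡sym new-x) h)
    ... | no e≢d with e ≟ c
    ...   | yes refl = ⊥-elim (just≢nothing h old-x)
    ...   | no e≢c = e , trans (≡sym (other v e≢c e≢d)) h

  abstract
    -- First the colour `c` is removed from the edge, then `d` is given to it. Being abstract, the
    -- result is known later only through the equations of `Recoloured`, not through the nested
    -- tests of `remm` and `addm`.
    recolour : ∀ φ {x y c d} → m φ c x ≡ just y → m φ d x ≡ nothing → m φ d y ≡ nothing →
      ∃ λ ψ → Recoloured φ ψ x y c d
    recolour φ {x} {y} {c} {d} e nx ny = ψ , record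
      { was = e ; free-x = nx ; free-y = ny
      ; far = λ f a b → trans (add-far φ₁ d x y f a b) (rem-far φ c x y f a b)
      ; other = λ {f} v a b → trans (add-colour φ₁ d x y v b) (rem-colour φ c x y v a)
      ; old-x = trans (add-colour φ₁ d x y x c≢d) (rem-x φ c x y)
      ; old-y = trans (add-colour φ₁ d x y y c≢d) (rem-y φ c x y)
      ; new-x = add-x φ₁ d x y
      ; new-y = add-y φ₁ d x y (adj-irrefl (edge φ e)) }
      where
      φ₁ : Col
      φ₁ = uncolour φ c x y e
      c≢d : c ≢ d
      c≢d refl = just≢nothing e nx
      un : ∀ f → m φ₁ f x ≢ just y
      un f h with uniq φ {c} {f} e (rem-sub φ c x y {f} h)
      ... | refl = just≢nothing h (rem-x φ c x y)
      ψ : Col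
      ψ = colour-edge φ₁ d x y (edge φ e) (rem-keep φ c x y nx) (rem-keep φ c x y ny) un

  -- Kempe chains

  -- The Kempe chain of u for the colours a and b, walked from an end u that misses a;
  -- the boolean tells which of the two colours is to be followed next.
  module Walk (φ : Col) (a b : C) (u : V) (ua : m φ a u ≡ nothing) where

    next : Bool → C
    next false = b
    next true = a

    data Step : ℕ → Bool → V → Set where
      start : Step 0 false u
      step : ∀ {i f v w} → Step i f v → m φ (next f) v ≡ just w → Step (suc i) (not f) w

    step-unique : ∀ {i f v g w} → Step i f v → Step i g w → f ≡ g × v ≡ w
    step-unique start start = refl , refl
    step-unique (step s e) (step t h) with step-unique s t
    ... | refl , refl = refl , just-injective (trans (≡sym e) h)

    prefix : ∀ {i j g w} → Step j g w → i < j → ∃ λ f → ∃ λ v → ∃ λ x → Step i f v × m φ (next f) v ≡ just x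
    prefix {i} {suc j} (step s e) (s≤s i≤j) with ℕ.m≤n⇒m<n∨m≡n i≤j
    ... | inj₁ i<j = prefix s i<j
    ... | inj₂ refl = _ , _ , _ , s , e

    back : ∀ {i f v} → Step i f v → v ≢ u → ∃ λ w → m φ (next (not f)) v ≡ just w
    back start h = ⊥-elim (h refl)
    back (step {f = false} s e) h = _ , inv φ e
    back (step {f = true} s e) h = _ , inv φ e

    -- At a vertex other than `u` there is an edge of the colour by which the walk arrived and, if
    -- the walk goes on, one of the other colour as well. So a vertex missing one of the colours is
    -- where the walk stops.
    last : ∀ {i f v j g w} → Step i f v → Step j g w → i < j → v ≢ u →
      (m φ a v ≡ nothing ⊎ m φ b v ≡ nothing) → ⊥
    last {f = f} s t i<j v≢u hv with prefix t i<j | back s v≢u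
    ... | f′ , v′ , x , s′ , e | y , e′ with step-unique s s′
    last {f = false} s t i<j v≢u (inj₁ h) | _ , _ , _ , s′ , e | _ , e′ | refl , refl = just≢nothing e′ h
    last {f = false} s t i<j v≢u (inj₂ h) | _ , _ , _ , s′ , e | _ , e′ | refl , refl = just≢nothing e h
    last {f = true} s t i<j v≢u (inj₁ h) | _ , _ , _ , s′ , e | _ , e′ | refl , refl = just≢nothing e h
    last {f = true} s t i<j v≢u (inj₂ h) | _ , _ , _ , s′ , e | _ , e′ | refl , refl = just≢nothing e′ h

    ends : ∀ {i f v j g w} → Step i f v → Step j g w → v ≢ u → w ≢ u →
      (m φ a v ≡ nothing ⊎ m φ b v ≡ nothing) → (m φ a w ≡ nothing ⊎ m φ b w ≡ nothing) → v ≡ w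
    ends {i} {j = j} s t v≢u w≢u hv hw with ℕ.<-cmp i j
    ... | tri≈ _ refl _ = proj₂ (step-unique s t)
    ... | tri< i<j _ _ = ⊥-elim (last s t i<j v≢u hv)
    ... | tri> _ _ j<i = ⊥-elim (last t s j<i w≢u hw)

    On : V → Set
    On v = ∃ λ i → ∃ λ f → Step i f v

    -- The edge of the colour of arrival leads back to the preceding vertex, and `u` has no such
    -- edge because it misses `a`. Hence a walk in one direction exhausts the component.
    came : ∀ {i f v w} → Step i f v → m φ (next (not f)) v ≡ just w → On w
    came start e = ⊥-elim (just≢nothing e ua)
    came (step {f = false} s h) e with other-end φ (inv φ e) h
    ... | refl = _ , _ , s
    came (step {f = true} s h) e with other-end φ (inv φ e) h
    ... | refl = _ , _ , s

    on-closed : ∀ {c v w} → (c ≡ a ⊎ c ≡ b) → m φ c v ≡ just w → On v → On w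
    on-closed (inj₁ refl) e (i , true , s) = _ , _ , step s e
    on-closed (inj₂ refl) e (i , false , s) = _ , _ , step s e
    on-closed (inj₁ refl) e (i , false , s) = came s e
    on-closed (inj₂ refl) e (i , true , s) = came s e

    to-start : ∀ {T} → Closed φ a b T → ∀ {i f v} → Step i f v → T v ≡ true → T u ≡ true
    to-start cl start h = h
    to-start cl (step {f = false} s e) h = to-start cl s (cl (inj₂ refl) (inv φ e) h)
    to-start cl (step {f = true} s e) h = to-start cl s (cl (inj₁ refl) (inv φ e) h)

  Misses : Col → C → C → V → Set
  Misses φ a b v = m φ a v ≡ nothing ⊎ m φ b v ≡ nothing

  -- `ends` says that the chain is a path with at most one end besides `u`. `least` stands for
  -- connectedness: a closed set that meets the chain contains `u`.
  record Chain (φ : Col) (a b : C) (u : V) : Set where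
    field
      T : V → Bool
      closed : Closed φ a b T
      origin : T u ≡ true
      ends : ∀ {v w} → T v ≡ true → T w ≡ true → v ≢ u → w ≢ u → Misses φ a b v → Misses φ a b w → v ≡ w
      least : ∀ {T′} → Closed φ a b T′ → ∀ {v} → T v ≡ true → T′ v ≡ true → T′ u ≡ true

  closed-sym : ∀ {φ a b T} → Closed φ a b T → Closed φ b a T
  closed-sym cl h = cl ([ inj₂ , inj₁ ]′ h)

  chain : ∀ φ a b u → Misses φ a b u → (Chain φ a b u → ⊥) → ⊥
  chain φ a b u (inj₁ ua) k = as-bool On λ S to from → k record
    { T = S
    ; closed = λ h e s → from (on-closed h e (to s))
    ; origin = from (0 , false , start)
    ; ends = λ s t p q hv hw → ends (proj₂ (proj₂ (to s))) (proj₂ (proj₂ (to t))) p q hv hw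
    ; least = λ cl s t → to-start cl (proj₂ (proj₂ (to s))) t }
    where open Walk φ a b u ua
  chain φ a b u (inj₂ ub) k = as-bool On λ S to from → k record
    { T = S
    ; closed = λ {c} → closed-sym {φ} {b} {a} (λ h e s → from (on-closed h e (to s))) {c}
    ; origin = from (0 , false , start)
    ; ends = λ s t p q hv hw → ends (proj₂ (proj₂ (to s))) (proj₂ (proj₂ (to t))) p q
               ([ inj₂ , inj₁ ]′ hv) ([ inj₂ , inj₁ ]′ hw)
    ; least = λ {T′} cl s t → to-start {T′} (closed-sym {φ} {a} {b} cl) (proj₂ (proj₂ (to s))) t }
    where open Walk φ b a u ub

  Linked : Col → C → C → V → V → Set
  Linked φ a b u w = ∀ T → Closed φ a b T → T u ≡ true → T w ≡ false → ⊥

  separate : ∀ φ {a b u w x} → Linked φ a b u w → Misses φ a b u → Misses φ a b w → Misses φ a b x →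
    w ≢ u → x ≢ u → x ≢ w →
    ((T : V → Bool) → Closed φ a b T → T x ≡ true → T u ≡ false → T w ≡ false →
      (∀ {v} → T v ≡ true → v ≢ x → Misses φ a b v → (∀ {w} → T w ≡ true → w ≢ x → Misses φ a b w → v ≡ w)) → ⊥) → ⊥
  separate φ {a} {b} {u} {w} {x} linked mu mw mx w≢u x≢u x≢w k =
    chain φ a b u mu λ Ku → chain φ a b x mx λ Kx →
      let open Chain
          w∈u : T Ku w ≡ true
          w∈u = in-or-out Ku w λ e → linked (T Ku) (closed Ku) (origin Ku) e
          x∉u : T Ku x ≡ true → ⊥
          x∉u h = x≢w (ends Ku h w∈u x≢u w≢u mx mw)
      in k (T Kx) (closed Kx) (origin Kx)
           (not-true λ h → x∉u (least Kx (closed Ku) h (origin Ku)))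
           (not-true λ h → x∉u (least Kx (closed Ku) h w∈u))
           (λ s p hv t q hw → ends Kx s t p q hv hw)
    where
    in-or-out : ∀ (K : Chain φ a b u) v → (Chain.T K v ≡ false → ⊥) → Chain.T K v ≡ true
    in-or-out K v h with Chain.T K v
    ... | true = refl
    ... | false = ⊥-elim (h refl)

-- Arcs around a centre, and disjointness of missing colours

module Centre {n : ℕ} (G : Graph n) (D : ℕ) (r : Fin n) where

  open Matchings G D

  -- φ colours all edges of G but rs.
  record State (s : V) (φ : Col) : Set where
    field
      rs : adj G r s ≡ true
      cover : ∀ {v w} → adj G v w ≡ true → (∃ λ c → m φ c v ≡ just w) ⊎ ((v ≡ r × w ≡ s) ⊎ (v ≡ s × w ≡ r))
      uncoloured : ∀ c → m φ c r ≢ just s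
  open State public

  Total : Col → Set
  Total φ = ∀ {v w} → adj G v w ≡ true → ∃ λ c → m φ c v ≡ just w

  state-recolour : ∀ {s φ ψ x y c d} → State s φ → Recoloured φ ψ x y c d → State s ψ
  state-recolour st R = record
    { rs = rs st
    ; cover = λ a → [ (λ { (c , h) → inj₁ (Recoloured.edge-to R h) }) , inj₂ ]′ (cover st a)
    ; uncoloured = λ c h → uncoloured st _ (proj₂ (Recoloured.edge-from R h)) }

  state-swap : ∀ {s φ a b T} (cl : Closed φ a b T) → State s φ → State s (swap φ a b T cl)
  state-swap {s} {φ} {a} {b} {T} cl st = record
    { rs = rs st
    ; cover = λ e → [ (λ { (c , h) → inj₁ (to h) }) , inj₂ ]′ (cover st e)
    ; uncoloured = from }
    where
    to : ∀ {c v w} → m φ c v ≡ just w → ∃ λ d → swapm φ a b T d v ≡ just w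
    to {c} {v} h with true-or-false (T v)
    ... | inj₂ e = c , trans (swap-out φ a b T c e) h
    ... | inj₁ e = transp a b c , trans (swap-in φ a b T (transp a b c) e)
                  (trans (cong (λ d → m φ d v) (transp-inv a b c)) h)
    from : ∀ c → swapm φ a b T c r ≢ just s
    from c h with T r
    ... | true = uncoloured st _ h
    ... | false = uncoloured st c h

  -- The condition `Ok` on arcs lets one data type serve for paths that avoid a vertex, stay outside
  -- the fan, or do not use a given arc at the root.
  data Path (φ : Col) (P : V → Set) (Ok : V → C → V → Set) : ℕ → V → Set where
    here : ∀ {v} → P v → Path φ P Ok 0 v
    arc : ∀ {k q c z} → Path φ P Ok k q → m φ c q ≡ nothing → m φ c r ≡ just z → Ok q c z → Path φ P Ok (suc k) z

  Any : V → C → V → Set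
  Any _ _ _ = ⊤

  Reach : Col → (V → Set) → V → Set
  Reach φ P v = ∃ λ k → Path φ P Any k v

  reach-here : ∀ {φ} {P : V → Set} {v} → P v → Reach φ P v
  reach-here p = 0 , here p

  reach-arc : ∀ {φ P q c z} → Reach φ P q → m φ c q ≡ nothing → m φ c r ≡ just z → Reach φ P z
  reach-arc (k , p) a b = suc k , arc p a b tt

  path-map : ∀ {φ ψ} {P P′ : V → Set} {Ok Ok′ : V → C → V → Set} →
    (∀ {v} → P v → P′ v) →
    (∀ {k q c z} → Path φ P Ok k q → Path ψ P′ Ok′ k q → m φ c q ≡ nothing → m φ c r ≡ just z → Ok q c z →
      m ψ c q ≡ nothing × m ψ c r ≡ just z × Ok′ q c z) →
    ∀ {k v} → Path φ P Ok k v → Path ψ P′ Ok′ k v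
  path-map f g (here p) = here (f p)
  path-map f g (arc t a b o) =
    let t′ = path-map f g t ; (a′ , b′ , o′) = g t t′ a b o in arc t′ a′ b′ o′

  path-invariant : ∀ {φ} {P : V → Set} {Ok : V → C → V → Set} (I : V → Set) → (∀ {v} → P v → I v) →
    (∀ {q c z} → I q → m φ c q ≡ nothing → m φ c r ≡ just z → Ok q c z → I z) → ∀ {k v} → Path φ P Ok k v → I v
  path-invariant I f g (here p) = f p
  path-invariant I f g (arc t a b o) = g (path-invariant I f g t) a b o

  source≢r : ∀ {φ c q z} → m φ c q ≡ nothing → m φ c r ≡ just z → q ≢ r
  source≢r a b refl = just≢nothing b a

  Avoiding : Col → (V → Set) → (V → C → V → Set) → V → ℕ → V → Set
  Avoiding φ P Ok q = Path φ (λ v → P v × v ≢ q) (λ t c z → Ok t c z × z ≢ q)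

  avoiding-≢ : ∀ {φ P Ok q k v} → Avoiding φ P Ok q k v → v ≢ q
  avoiding-≢ (here (_ , h)) = h
  avoiding-≢ (arc _ _ _ (_ , h)) = h

  Hit : Col → (V → Set) → (V → C → V → Set) → V → ℕ → Set
  Hit φ P Ok q k = P q ⊎ ∃ λ j → ∃ λ p → ∃ λ c →
    j < k × Avoiding φ P Ok q j p × m φ c p ≡ nothing × m φ c r ≡ just q × Ok p c q

  -- A path is cut at its first visit to `q`; what comes before does not contain `q` and therefore
  -- survives a recolouring of the edge `rq`.
  first-hit′ : ∀ {φ P Ok} q {k v} → Path φ P Ok k v → Avoiding φ P Ok q k v ⊎ Hit φ P Ok q k
  first-hit′ q (here {v} p) with v ≟ q
  ... | yes refl = inj₂ (inj₁ p)
  ... | no h = inj₁ (here (p , h))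
  first-hit′ q (arc {k} {z = z} t a b o) with first-hit′ q t
  ... | inj₂ (inj₁ p) = inj₂ (inj₁ p)
  ... | inj₂ (inj₂ (j , p , c , j<k , rest)) = inj₂ (inj₂ (j , p , c , ℕ.m<n⇒m<1+n j<k , rest))
  ... | inj₁ t′ with z ≟ q
  ...   | yes refl = inj₂ (inj₂ (k , _ , _ , ℕ.≤-refl , t′ , a , b , o))
  ...   | no h = inj₁ (arc t′ a b (o , h))

  first-hit : ∀ {φ P Ok q k} → Path φ P Ok k q → Hit φ P Ok q k
  first-hit {q = q} t with first-hit′ q t
  ... | inj₂ h = h
  ... | inj₁ t′ = ⊥-elim (avoiding-≢ t′ refl)

  -- A class of colourings with distinguished start vertices, such that no start vertex shares a missing
  -- colour with r and such that the class is stable under recolouring an edge at r and Kempe changes away from r.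
  module Elementary (Cls : Col → Set) (P P° : Col → V → Set)
    (P°⊂P : ∀ {φ v} → P° φ v → P φ v)
    (no-start : ∀ {φ θ v} → Cls φ → m φ θ r ≡ nothing → P φ v → m φ θ v ≡ nothing → ⊥)
    (shift : ∀ {φ θ q c} → Cls φ → m φ θ r ≡ nothing → m φ θ q ≡ nothing → m φ c r ≡ just q →
      (∀ ψ → Recoloured φ ψ r q c θ → Cls ψ → (∀ {v} → P φ v → P ψ v) → ⊥) → ⊥)
    (kempe : ∀ {φ θ γ T} → Cls φ → m φ θ r ≡ nothing → (cl : Closed φ θ γ T) → T r ≡ false →
      (Cls (swap φ θ γ T cl) → (∀ {v} → P° φ v → P (swap φ θ γ T cl) v) → ⊥) → ⊥)
    where

    -- Vizing's fan argument: recolouring `rq` from `c` to θ makes `r` miss `c`, a colour that the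
    -- predecessor of `q` misses too, and that vertex is nearer to the start. `N` bounds the length
    -- of the path.
    disjoint-r′ : ∀ N {φ θ k q} → k < N → Cls φ → m φ θ r ≡ nothing → Path φ (P φ) Any k q → m φ θ q ≡ nothing → ⊥
    disjoint-r′ (suc N) {φ} {θ} {k} {q} (s≤s k≤N) cls θr t θq with first-hit t
    ... | inj₁ p = no-start cls θr p θq
    ... | inj₂ (j , p , c , j<k , t′ , cp , cq , _) = shift cls θr θq cq λ ψ R cls′ P⊂ →
      let open Recoloured R in
      disjoint-r′ N (ℕ.<-≤-trans j<k k≤N) cls′ old-x
        (path-map (λ { (x , _) → P⊂ x })
          (λ { s _ a b (_ , z≢q) →
             trans (far _ (source≢r {φ} a b) (avoiding-≢ s)) a
             , trans (other r (λ { refl → z≢q (just-injective (trans (≡sym b) cq)) })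
                              (λ { refl → just≢nothing b θr })) b
             , tt }) t′)
        (trans (far c (source≢r {φ} cp cq) (avoiding-≢ t′)) cp)

    disjoint-r : ∀ {φ θ q} → Cls φ → m φ θ r ≡ nothing → Reach φ (P φ) q → m φ θ q ≡ nothing → ⊥
    disjoint-r cls θr (k , t) = disjoint-r′ (suc k) ℕ.≤-refl cls θr t

    weaken : ∀ {φ v} → Reach φ (P° φ) v → Reach φ (P φ) v
    weaken (k , t) = k , path-map P°⊂P (λ _ _ a b o → a , b , o) t

    -- Swapping on `T` would make `p` miss θ, which is impossible if the path to `p` survives. An
    -- arc can be lost only if its colour is γ and its source lies in `T`; that source misses γ and
    -- is nearer to the start, so it takes the place of `p`.
    linked′ : ∀ N {φ θ γ T k p} → k < N → Cls φ → m φ θ r ≡ nothing → Closed φ θ γ T → T r ≡ false →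
      Path φ (P° φ) Any k p → T p ≡ true → m φ γ p ≡ nothing → ⊥
    linked′ (suc N) {φ} {θ} {γ} {T} {k} {p} (s≤s k≤N) cls θr cl Tr t Tp γp =
      kempe cls θr cl Tr λ cls′ P⊂ →
        [ (λ t′ → disjoint-r cls′ (trans (swap-out φ θ γ T θ Tr) θr) (k , t′)
             (trans (swap-in φ θ γ T θ Tp) (trans (cong (λ d → m φ d p) (transp-a θ γ)) γp)))
        , (λ { (j , q , j<k , s , Tq , γq) → linked′ N (ℕ.<-≤-trans j<k k≤N) cls θr cl Tr s Tq γq }) ]′
        (convert P⊂ t)
      where
      ψ = swap φ θ γ T cl
      convert : (∀ {v} → P° φ v → P ψ v) → ∀ {k p} → Path φ (P° φ) Any k p → Path ψ (P ψ) Any k p ⊎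
        ∃ λ j → ∃ λ q → j < k × Path φ (P° φ) Any j q × T q ≡ true × m φ γ q ≡ nothing
      convert P⊂ (here p) = inj₁ (here (P⊂ p))
      convert P⊂ (arc {k} {q} {c} s a b o) with convert P⊂ s
      ... | inj₂ (j , q′ , j<k , rest) = inj₂ (j , q′ , ℕ.m<n⇒m<1+n j<k , rest)
      ... | inj₁ s′ with true-or-false (T q) | c ≟ γ
      ...   | inj₁ Tq | yes refl = inj₂ (k , q , ℕ.≤-refl , s , Tq , a)
      ...   | inj₂ Tq | _ = inj₁ (arc s′ (trans (swap-out φ θ γ T c Tq) a) (trans (swap-out φ θ γ T c Tr) b) tt)
      ...   | inj₁ Tq | no h = inj₁ (arc s′ (trans (swap-other φ θ γ T q (λ { refl → just≢nothing b θr }) h) a)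
                                        (trans (swap-out φ θ γ T c Tr) b) tt)

    linked : ∀ {φ θ γ p} → Cls φ → m φ θ r ≡ nothing → Reach φ (P° φ) p → m φ γ p ≡ nothing → Linked φ θ γ p r
    linked cls θr (k , t) γp T cl Tp Tr = linked′ (suc k) ℕ.≤-refl cls θr cl Tr t Tp γp

    -- The chains of `p` and of `q` both pass through `r`, so they coincide, and `p`, `q` and `r`
    -- would be three ends of one path.
    elementary : ∀ {φ θ γ p q} → Cls φ → m φ θ r ≡ nothing → Reach φ (P° φ) p → Reach φ (P° φ) q →
      m φ γ p ≡ nothing → m φ γ q ≡ nothing → p ≢ q → ⊥
    elementary {φ} {θ} {γ} {p} {q} cls θr Rp Rq γp γq p≢q with just-or-nothing (m φ γ r)
    ... | inj₂ γr = disjoint-r cls γr (weaken Rp) γp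
    ... | inj₁ (_ , e) = chain φ θ γ p (inj₂ γp) λ Kp → chain φ θ γ q (inj₂ γq) λ Kq →
      let open Chain in
      by-cases (T Kp r ≡ true)
        (λ rp → by-cases (T Kq r ≡ true)
          (λ rq → q≢r (ends Kp (least Kq (closed Kp) rq rp) rp (λ h → p≢q (≡sym h)) r≢p (inj₂ γq) (inj₁ θr)))
          (λ h → linked cls θr Rq γq (T Kq) (closed Kq) (origin Kq) (not-true h)))
        (λ h → linked cls θr Rp γp (T Kp) (closed Kp) (origin Kp) (not-true h))
      where
      q≢r : q ≢ r
      q≢r refl = just≢nothing e γq
      r≢p : r ≢ p
      r≢p refl = just≢nothing e γp

    own-chain : ∀ {φ θ γ p x} → Cls φ → m φ θ r ≡ nothing → Reach φ (P° φ) p → m φ γ p ≡ nothing →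
      Misses φ θ γ x → x ≢ p → x ≢ r →
      ((T : V → Bool) → Closed φ θ γ T → T x ≡ true → T p ≡ false → T r ≡ false →
        (∀ {v} → T v ≡ true → v ≢ x → Misses φ θ γ v → (∀ {w} → T w ≡ true → w ≢ x → Misses φ θ γ w → v ≡ w)) → ⊥) → ⊥
    own-chain {φ} {θ} {γ} {p} cls θr Rp γp mx x≢p x≢r k =
      separate φ (linked cls θr Rp γp) (inj₂ γp) (inj₁ θr) mx r≢p x≢p x≢r k
      where
      r≢p : r ≢ p
      r≢p refl = disjoint-r cls θr (weaken Rp) θr

-- The fan at the uncoloured edge, and vertices outside it

module Fan {n : ℕ} (G : Graph n) (D : ℕ) (r : Fin n) (no-total : ∀ φ → Centre.Total G D r φ → ⊥) where

  open Matchings G D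
  open Centre G D r

  -- Otherwise θ could be given to `rs`, and all edges of `G` would be coloured.
  root-disjoint : ∀ {s φ θ v} → State s φ → m φ θ r ≡ nothing → v ≡ s → m φ θ v ≡ nothing → ⊥
  root-disjoint {s} {φ} {θ} st θr refl θs = no-total ψ total
    where
    ψ = colour-edge φ θ r s (rs st) θr θs (uncoloured st)
    keep : ∀ {c v w} → m φ c v ≡ just w → addm φ θ r s c v ≡ just w
    keep {c} {v} e with c ≟ θ
    ... | no _ = e
    ... | yes refl with v ≟ r
    ...   | yes refl = ⊥-elim (just≢nothing e θr)
    ...   | no _ with v ≟ s
    ...     | yes refl = ⊥-elim (just≢nothing e θs)
    ...     | no _ = e
    total : Total ψ
    total a with cover st a
    ... | inj₁ (c , h) = c , keep h
    ... | inj₂ (inj₁ (refl , refl)) = θ , add-x φ θ r s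
    ... | inj₂ (inj₂ (refl , refl)) = θ , add-y φ θ r s (adj-irrefl (rs st))

  module _ (s : V) where
    private
      shift : ∀ {φ θ q c} → State s φ → m φ θ r ≡ nothing → m φ θ q ≡ nothing → m φ c r ≡ just q →
        (∀ ψ → Recoloured φ ψ r q c θ → State s ψ → (∀ {v} → v ≡ s → v ≡ s) → ⊥) → ⊥
      shift {φ} st θr θq e k = let (ψ , R) = recolour φ e θr θq in k ψ R (state-recolour st R) id
    open Elementary (State s) (λ _ v → v ≡ s) (λ _ v → v ≡ s) id root-disjoint
      shift (λ st θr cl Tr k → k (state-swap cl st) id)
      using () renaming (disjoint-r to fan-disjoint-r; linked to fan-linked; elementary to fan-elementary;
        own-chain to fan-own-chain)
      public

  InF : V → Col → V → Set
  InF s φ v = Reach φ (λ w → w ≡ s) v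

  Held : V → Col → C → Set
  Held s φ c = ∃ λ p → InF s φ p × m φ c p ≡ nothing

  Wild : V → Col → C → C → Set
  Wild s φ θ c = c ≡ θ ⊎ Held s φ c

  Two : Col → V → Set
  Two φ v = ∃ λ a → ∃ λ b → a ≢ b × m φ a v ≡ nothing × m φ b v ≡ nothing

  Missing : Col → V → Set
  Missing φ v = ∃ λ c → m φ c v ≡ nothing

  root∈ : ∀ {s φ} → InF s φ s
  root∈ {s} {φ} = reach-here {φ} {λ w → w ≡ s} refl

  fan≢r : ∀ {s φ v} → State s φ → InF s φ v → v ≢ r
  fan≢r st (_ , here refl) refl = adj-irrefl (rs st) refl
  fan≢r {φ = φ} st (_ , arc _ _ e _) refl = adj-irrefl (edge φ e) refl

  held≢θ : ∀ {s φ θ c} → State s φ → m φ θ r ≡ nothing → Held s φ c → c ≢ θ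
  held≢θ {s} st θr (p , Fp , h) refl = fan-disjoint-r s st θr Fp h

  -- Fan vertices on which both colours are present may lie in `T`: the swap does not change what
  -- they miss. Excluding only those that miss θ or γ therefore suffices to preserve the fan and its
  -- arcs exactly.
  record Away (s : V) (φ : Col) (θ γ : C) (T : V → Bool) : Set where
    field
      state : State s φ
      closed : Closed φ θ γ T
      r∉ : T r ≡ false
      fan∉ : ∀ {v} → InF s φ v → Misses φ θ γ v → T v ≡ false

    ψ : Col
    ψ = swap φ θ γ T closed

    state′ : State s ψ
    state′ = state-swap closed state

    r-same : ∀ {c w} → m φ c r ≡ w → m ψ c r ≡ w
    r-same {c} h = trans (swap-out φ θ γ T c r∉) h

    r-same⁻ : ∀ {c w} → m ψ c r ≡ w → m φ c r ≡ w
    r-same⁻ {c} h = trans (≡sym (swap-out φ θ γ T c r∉)) h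

    other : ∀ {c v w} → c ≢ θ → c ≢ γ → m φ c v ≡ w → m ψ c v ≡ w
    other {c} {v} a b h = trans (swap-other φ θ γ T v a b) h

    out : ∀ {c v w} → T v ≡ false → m φ c v ≡ w → m ψ c v ≡ w
    out {c} Tv h = trans (swap-out φ θ γ T c Tv) h

    in-γ : ∀ {v w} → T v ≡ true → m φ θ v ≡ w → m ψ γ v ≡ w
    in-γ {v} Tv h = trans (swap-in φ θ γ T γ Tv) (trans (cong (λ d → m φ d v) (transp-b θ γ)) h)

    in-θ : ∀ {v w} → T v ≡ true → m φ γ v ≡ w → m ψ θ v ≡ w
    in-θ {v} Tv h = trans (swap-in φ θ γ T θ Tv) (trans (cong (λ d → m φ d v) (transp-a θ γ)) h)

    keep : ∀ {v c} → (Misses φ θ γ v → T v ≡ false) → m φ c v ≡ nothing → m ψ c v ≡ nothing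
    keep {v} {c} f h with among? c θ γ
    ... | inj₁ refl = out (f (inj₁ h)) h
    ... | inj₂ (inj₁ refl) = out (f (inj₂ h)) h
    ... | inj₂ (inj₂ (a , b)) = other a b h

    keep⁻ : ∀ {v c} → (Misses φ θ γ v → T v ≡ false) → m ψ c v ≡ nothing → m φ c v ≡ nothing
    keep⁻ {v} {c} f h with true-or-false (T v)
    ... | inj₂ Tv = trans (≡sym (swap-out φ θ γ T c Tv)) h
    ... | inj₁ Tv with among? c θ γ
    ...   | inj₁ refl = ⊥-elim (true≢false Tv (f (inj₂ (trans (≡sym (in-θ Tv refl)) h))))
    ...   | inj₂ (inj₁ refl) = ⊥-elim (true≢false Tv (f (inj₁ (trans (≡sym (in-γ Tv refl)) h))))
    ...   | inj₂ (inj₂ (a , b)) = trans (≡sym (swap-other φ θ γ T v a b)) h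

    fan-keep : ∀ {v c} → InF s φ v → m φ c v ≡ nothing → m ψ c v ≡ nothing
    fan-keep Fv = keep (fan∉ Fv)

    fan-keep⁻ : ∀ {v c} → InF s φ v → m ψ c v ≡ nothing → m φ c v ≡ nothing
    fan-keep⁻ Fv = keep⁻ (fan∉ Fv)

    fan⊂ : ∀ {v} → InF s φ v → InF s ψ v
    fan⊂ (k , t) = k , path-map id (λ {k} t _ a b o → fan-keep (k , t) a , r-same b , o) t

    fan⊃ : ∀ {v} → InF s ψ v → InF s φ v
    fan⊃ (_ , t) = path-invariant (InF s φ) reach-here (λ Fq a b _ → reach-arc Fq (fan-keep⁻ Fq a) (r-same⁻ b)) t

    held⊂ : ∀ {c} → Held s φ c → Held s ψ c
    held⊂ (p , Fp , h) = p , fan⊂ Fp , fan-keep Fp h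

    two⊂ : Two φ s → Two ψ s
    two⊂ (a , b , ne , ha , hb) = a , b , ne , fan-keep root∈ ha , fan-keep root∈ hb

  -- The θ,γ-chain of the fan vertex that misses γ ends at `r`, so the chain of `x` is a different
  -- one. Changing it trades θ for γ at `x` and leaves the fan as it is.
  wild-chain : ∀ {s φ θ γ x} → State s φ → m φ θ r ≡ nothing → Held s φ γ → Misses φ θ γ x →
    (InF s φ x → ⊥) → x ≢ r → (∀ T → Away s φ θ γ T → T x ≡ true →
      (∀ {v} → T v ≡ true → v ≢ x → Misses φ θ γ v → (∀ {w} → T w ≡ true → w ≢ x → Misses φ θ γ w → v ≡ w)) → ⊥) → ⊥
  wild-chain {s} {φ} {θ} {γ} {x} st θr (p , Fp , γp) mx x∉F x≢r k =
    fan-own-chain s st θr Fp γp mx (λ { refl → x∉F Fp }) x≢r λ T cl Tx _ Tr ends → k T record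
      { state = st ; closed = cl ; r∉ = Tr
      ; fan∉ = λ { Fv (inj₁ h) → ⊥-elim (fan-disjoint-r s st θr Fv h)
                 ; Fv (inj₂ h) → not-true λ Tv → fan-linked s st θr Fv h T cl Tv Tr } } Tx ends

  Without : V → C → Col → V → Set
  Without s a φ v = ∃ λ k → Path φ (λ w → w ≡ s) (λ q c _ → ¬ (q ≡ s × c ≡ a)) k v

  -- Only the part of a path after its last visit to `s` matters, and this part uses at most one arc
  -- at `s`, whose colour differs from `a` or from `b`.
  without-one : ∀ {s φ a b} → a ≢ b → ∀ {v} → InF s φ v → Without s a φ v ⊎ Without s b φ v
  without-one {s} {φ} {a} {b} a≢b (_ , t₀) = go t₀
    where
    go : ∀ {k v} → Path φ (λ w → w ≡ s) Any k v → Without s a φ v ⊎ Without s b φ v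
    go (here p) = inj₁ (_ , here p)
    go (arc {k} {q} {c} t x y _) with q ≟ s
    ... | no q≢s = [ (λ { (j , t′) → inj₁ (_ , arc t′ x y (q≢s ∘ proj₁)) })
                   , (λ { (j , t′) → inj₂ (_ , arc t′ x y (q≢s ∘ proj₁)) }) ]′ (go t)
    ... | yes refl with c ≟ a
    ...   | no c≢a = inj₁ (_ , arc (here refl) x y (c≢a ∘ proj₂))
    ...   | yes refl = inj₂ (_ , arc (here refl) x y (a≢b ∘ proj₂))

  without⊂ : ∀ {s a φ v} → Without s a φ v → InF s φ v
  without⊂ (k , t) = k , path-map id (λ _ _ a b _ → a , b , tt) t

  -- Recolouring an edge sx with a colour missing at both ends drops one arc at s and creates another.
  record Exchange (s : V) (φ χ : Col) (x : V) (θ ρ γ : C) : Set where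
    field
      state : State s χ
      r-same : ∀ {c w} → m φ c r ≡ w → m χ c r ≡ w
      new-s : m χ ρ s ≡ nothing
      new-x : m χ ρ x ≡ nothing
      other : ∀ {c v w} → (Wild s φ θ c → ⊥) → c ≢ ρ → m φ c v ≡ w → m χ c v ≡ w
      keep : ∀ {c v} → (Wild s φ θ c → ⊥) → m φ c v ≡ nothing → m χ c v ≡ nothing
      fan-keep : ∀ {c v} → InF s φ v → c ≢ γ → m φ c v ≡ nothing → m χ c v ≡ nothing
      fan⊂ : ∀ {v} → Without s γ φ v → InF s χ v

    fan-new : ∀ {k v} → m φ θ r ≡ nothing → Path φ (λ z → m φ ρ r ≡ just z) (λ _ _ z → ¬ InF s φ z) k v → InF s χ v
    fan-new θr (here e) = reach-arc root∈ new-s (r-same e)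
    fan-new θr (arc {q = q} {c} t a b o) = reach-arc (fan-new θr t) (keep not-wild a) (r-same b)
      where
      not-wild : Wild s φ θ c → ⊥
      not-wild (inj₂ (p , Fp , h)) = o (reach-arc Fp h b)
      not-wild (inj₁ refl) = just≢nothing b θr

  -- If `x` misses θ, a θ,γ-change on its chain makes it miss γ, so that `sx` can pass from ρ to γ.
  -- If `x` misses a held colour δ, a θ,δ-change reduces this to the first case.
  exchange : ∀ {s φ θ γ x ρ δ} → State s φ → m φ θ r ≡ nothing → m φ γ s ≡ nothing → (InF s φ x → ⊥) → x ≢ r →
    m φ δ x ≡ nothing → Wild s φ θ δ → m φ ρ s ≡ just x → ρ ≢ θ → (∀ χ → Exchange s φ χ x θ ρ γ → ⊥) → ⊥
  exchange {s} {φ} {θ} {γ} {x} {ρ} st θr γs x∉F x≢r δx (inj₁ refl) ρs ρ≢θ k =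
    wild-chain st θr (s , root∈ , γs) (inj₁ δx) x∉F x≢r λ T W Tx _ →
      let open Away W renaming (state′ to stψ; r-same to rψ)
          ρ≢γ : ρ ≢ γ
          ρ≢γ = λ { refl → just≢nothing ρs γs }
          (χ , R) = recolour ψ (other ρ≢θ ρ≢γ ρs) (fan-keep root∈ γs) (in-γ Tx δx)
          open Recoloured R renaming (other to otherχ; keeps to keepχ)
          r≢s = adj-irrefl (rs st)
          fk : ∀ {c v} → InF s φ v → c ≢ γ → m φ c v ≡ nothing → m χ c v ≡ nothing
          fk Fv c≢γ h = keepχ c≢γ (Away.fan-keep W Fv h)
          rsame : ∀ {c w} → m φ c r ≡ w → m χ c r ≡ w
          rsame {c} h = trans (far c r≢s (λ e → x≢r (≡sym e))) (rψ h)
      in k χ record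
        { state = state-recolour stψ R
        ; r-same = rsame
        ; new-s = old-x
        ; new-x = old-y
        ; other = λ {c} {v} nw c≢ρ h → trans (otherχ v c≢ρ (λ { refl → nw (inj₂ (s , root∈ , γs)) }))
            (Away.other W (nw ∘ inj₁) (λ { refl → nw (inj₂ (s , root∈ , γs)) }) h)
        ; keep = λ nw h → keepχ (λ { refl → nw (inj₂ (s , root∈ , γs)) })
            (Away.other W (nw ∘ inj₁) (λ { refl → nw (inj₂ (s , root∈ , γs)) }) h)
        ; fan-keep = fk
        ; fan⊂ = λ { (j , t) → j , path-map id (λ t _ a b o →
            fk (without⊂ (_ , t)) (γ-arc (without⊂ (_ , t)) a o) a , rsame b , tt) t } }
    where
    γ-arc : ∀ {q c} → InF s φ q → m φ c q ≡ nothing → ¬ (q ≡ s × c ≡ γ) → c ≢ γ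
    γ-arc {q} Fq a o refl with q ≟ s
    ... | yes e = o (e , refl)
    ... | no ne = fan-elementary s st θr Fq root∈ a γs ne
  exchange {s} {φ} {θ} {γ} {x} {ρ} {δ} st θr γs x∉F x≢r δx (inj₂ Hδ) ρs ρ≢θ k =
    wild-chain st θr Hδ (inj₂ δx) x∉F x≢r λ T W Tx _ →
      let open Away W using (ψ; fan⊂; fan⊃; fan-keep; fan-keep⁻)
          ρ≢δ : ρ ≢ δ
          ρ≢δ = λ { refl → just≢nothing (inv φ ρs) δx }
          back : ∀ {c} → Wild s ψ θ c → Wild s φ θ c
          back = λ { (inj₁ e) → inj₁ e ; (inj₂ (p , Fp , h)) → inj₂ (p , fan⊃ Fp , fan-keep⁻ (fan⊃ Fp) h) }
          ≢θ : ∀ {c} → (Wild s φ θ c → ⊥) → c ≢ θ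
          ≢θ = λ nw e → nw (inj₁ e)
          ≢δ : ∀ {c} → (Wild s φ θ c → ⊥) → c ≢ δ
          ≢δ = λ { nw refl → nw (inj₂ Hδ) }
      in exchange {s} {ψ} (Away.state′ W) (Away.r-same W θr) (fan-keep root∈ γs) (x∉F ∘ fan⊃) x≢r (Away.in-θ W Tx δx)
           (inj₁ refl) (Away.other W ρ≢θ ρ≢δ ρs) ρ≢θ λ χ E → k χ record
             { state = Exchange.state E
             ; r-same = λ h → Exchange.r-same E (Away.r-same W h)
             ; new-s = Exchange.new-s E
             ; new-x = Exchange.new-x E
             ; other = λ nw c≢ρ h → Exchange.other E (nw ∘ back) c≢ρ (Away.other W (≢θ nw) (≢δ nw) h)
             ; keep = λ nw h → Exchange.keep E (nw ∘ back) (Away.other W (≢θ nw) (≢δ nw) h)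
             ; fan-keep = λ Fv c≢γ h → Exchange.fan-keep E (fan⊂ Fv) c≢γ (fan-keep Fv h)
             ; fan⊂ = λ { (j , t) → Exchange.fan⊂ E (j , path-map id (λ t _ a b o →
                 fan-keep (without⊂ (_ , t)) a , Away.r-same W b , o) t) } }

  -- An exchange makes `s` miss τ, which the fan vertex `q` misses as well. Since `s` has two
  -- missing colours, the one to be given up can be chosen so that `q` stays in the fan.
  held-root-edge : ∀ {s φ θ x δ τ} → State s φ → Two φ s → m φ θ r ≡ nothing → (InF s φ x → ⊥) → x ≢ r →
    m φ δ x ≡ nothing → Wild s φ θ δ → m φ τ s ≡ just x → Held s φ τ → ⊥
  held-root-edge {s} {φ} {θ} {x} {δ} {τ} st (a , b , a≢b , as , bs) θr x∉F x≢r δx wδ τs (q , Fq , τq) =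
    [ go as , go bs ]′ (without-one a≢b Fq)
    where
    q≢s : q ≢ s
    q≢s refl = just≢nothing τs τq
    go : ∀ {γ} → m φ γ s ≡ nothing → Without s γ φ q → ⊥
    go {γ} γs w = exchange st θr γs x∉F x≢r δx wδ τs (held≢θ st θr (q , Fq , τq)) λ χ E →
      let open Exchange E in
      fan-elementary s state (r-same θr) (fan⊂ w) root∈
        (fan-keep Fq (λ { refl → just≢nothing τs γs }) τq) new-s q≢s

  wild-root-edge : ∀ {s φ θ x δ τ} → State s φ → Two φ s → m φ θ r ≡ nothing → (InF s φ x → ⊥) → x ≢ r →
    m φ δ x ≡ nothing → Wild s φ θ δ → m φ τ s ≡ just x → Wild s φ θ τ → ⊥
  wild-root-edge st two θr x∉F x≢r δx wδ τs (inj₂ h) = held-root-edge st two θr x∉F x≢r δx wδ τs h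
  wild-root-edge {φ = φ} st two θr x∉F x≢r δx (inj₁ refl) τs (inj₁ refl) = just≢nothing (inv φ τs) δx
  -- The chain of `x` contains the edge `sx` of colour θ, so `s` is moved along with `x`; afterwards
  -- `sx` has the held colour δ.
  wild-root-edge {s} {φ} {θ} {x} {δ} st two θr x∉F x≢r δx (inj₂ Hδ) τs (inj₁ refl) =
    wild-chain st θr Hδ (inj₂ δx) x∉F x≢r λ T W Tx _ →
      let open Away W in
      held-root-edge state′ (two⊂ two) (r-same θr) (x∉F ∘ fan⊃) x≢r (in-θ Tx δx) (inj₁ refl)
        (in-γ (closed (inj₁ refl) (inv φ τs) Tx) τs) (held⊂ Hδ)

  -- The uncoloured edge is moved from rs to another edge at r, along a path of arcs.
  record Rerooted (s v : V) (φ ψ : Col) : Set where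
    field
      state : State v ψ
      two : Two ψ v
      r-keep : ∀ {c} → m φ c r ≡ nothing → m ψ c r ≡ nothing
      edges : ∀ {c u w} → u ≢ r → w ≢ r → m φ c u ≡ just w → m ψ c u ≡ just w
      out : ∀ {c u} → (InF s φ u → ⊥) → u ≢ r → m ψ c u ≡ m φ c u
      fan⊂ : ∀ {u} → InF s φ u → InF v ψ u
      fan⊃ : ∀ {u} → InF v ψ u → InF s φ u
      held : ∀ {c} → Held s φ c → Held v ψ c
      held⁻ : ∀ {c} → Held v ψ c → Held s φ c
      keep : ∀ {c} → m φ c v ≡ nothing → m ψ c v ≡ nothing

    r-out : ∀ {c u} → (InF s φ u → ⊥) → m φ c r ≡ just u → m ψ c r ≡ just u
    r-out u∉F h = inv ψ (trans (out u∉F (λ { refl → adj-irrefl (edge φ h) refl })) (inv φ h))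

    wild : ∀ {θ c} → Wild s φ θ c → Wild v ψ θ c
    wild (inj₁ e) = inj₁ e
    wild (inj₂ h) = inj₂ (held h)

  abstract
    -- The edge `rs` takes the colour α of `rq`, and `rq` becomes the uncoloured edge. Now `q`
    -- misses α and has an arc to `s`: the single arc between them is reversed, while the vertices
    -- of the fan and the colours held there stay the same.
    reroot-step : ∀ {s φ q α c₀} → State s φ → m φ α s ≡ nothing → m φ α r ≡ just q → m φ c₀ q ≡ nothing →
      ∃ λ ψ → Rerooted s q φ ψ × (∀ {c u} → u ≢ r → u ≢ s → u ≢ q → m ψ c u ≡ m φ c u)
    reroot-step {s} {φ} {q} {α} {c₀} st αs αq c₀q = χ , record
      { state = record { rs = edge φ αq ; cover = cover′ ; uncoloured = uncol }
      ; two = c₀ , α , c₀≢α , other {c₀} c₀≢α c₀q , α-q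
      ; r-keep = λ h → other (λ { refl → just≢nothing αq h }) h
      ; edges = edges
      ; out = λ u∉F u≢r → far u≢r (λ { refl → u∉F root∈ }) (λ { refl → u∉F q∈ })
      ; fan⊂ = λ { (k , t) → path-invariant (InF q χ) (λ { refl → s∈ }) to t }
      ; fan⊃ = λ { (k , t) → path-invariant (InF s φ) (λ { refl → q∈ }) (λ {p} {c} → from {p} {c}) t }
      ; held = λ { (p , Fp , h) → held′ p Fp h }
      ; held⁻ = λ { {c} (p , (_ , t) , h) →
          held″ {c} p (path-invariant (InF s φ) (λ { refl → q∈ }) (λ {p} {c} → from {p} {c}) t) h }
      ; keep = λ h → other (λ { refl → just≢nothing (inv φ αq) h }) h } , far
      where
      φ₁ : Col
      φ₁ = uncolour φ α r q αq
      r≢s : r ≢ s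
      r≢s = adj-irrefl (rs st)
      r≢q : r ≢ q
      r≢q = adj-irrefl (edge φ αq)
      s≢q : s ≢ q
      s≢q refl = just≢nothing (inv φ αq) αs
      q∈ : InF s φ q
      q∈ = reach-arc root∈ αs αq
      c₀≢α : c₀ ≢ α
      c₀≢α refl = just≢nothing (inv φ αq) c₀q
      χ : Col
      χ = colour-edge φ₁ α r s (rs st) (rem-x φ α r q) (rem-keep φ α r q αs)
            (λ c h → uncoloured st c (rem-sub φ α r q {c} h))
      other : ∀ {c v w} → c ≢ α → m φ c v ≡ w → m χ c v ≡ w
      other {c} {v} h e = trans (add-colour φ₁ α r s v h) (trans (rem-colour φ α r q v h) e)
      other⁻ : ∀ {c v w} → c ≢ α → m χ c v ≡ w → m φ c v ≡ w
      other⁻ {c} {v} h e = trans (≡sym (rem-colour φ α r q v h)) (trans (≡sym (add-colour φ₁ α r s v h)) e)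
      far : ∀ {c u} → u ≢ r → u ≢ s → u ≢ q → m χ c u ≡ m φ c u
      far {c} a b d = trans (add-far φ₁ α r s c a b) (rem-far φ α r q c a d)
      α-r : m χ α r ≡ just s
      α-r = add-x φ₁ α r s
      α-s : m χ α s ≡ just r
      α-s = add-y φ₁ α r s r≢s
      α-q : m χ α q ≡ nothing
      α-q = trans (add-far φ₁ α r s α (λ e → r≢q (≡sym e)) (λ e → s≢q (≡sym e))) (rem-y φ α r q)
      s∈ : InF q χ s
      s∈ = reach-arc {χ} {c = α} root∈ α-q α-r
      cover′ : ∀ {v w} → adj G v w ≡ true → (∃ λ c → m χ c v ≡ just w) ⊎ ((v ≡ r × w ≡ q) ⊎ (v ≡ q × w ≡ r))
      cover′ {v} {w} e with cover st e
      ... | inj₂ (inj₁ (refl , refl)) = inj₁ (α , α-r)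
      ... | inj₂ (inj₂ (refl , refl)) = inj₁ (α , α-s)
      ... | inj₁ (c , h) with same? c α
      ...   | inj₂ c≢α = inj₁ (c , other c≢α h)
      ...   | inj₁ refl with same? v r | same? v q
      ...     | inj₁ refl | _ = inj₂ (inj₁ (refl , just-injective (trans (≡sym h) αq)))
      ...     | inj₂ _ | inj₁ refl = inj₂ (inj₂ (refl , just-injective (trans (≡sym h) (inv φ αq))))
      ...     | inj₂ v≢r | inj₂ v≢q = inj₁ (α , trans (far v≢r (λ { refl → just≢nothing h αs }) v≢q) h)
      uncol : ∀ c → m χ c r ≢ just q
      uncol c h with same? c α
      ... | inj₁ refl = s≢q (just-injective (trans (≡sym α-r) h))
      ... | inj₂ c≢α = c≢α (uniq φ (other⁻ c≢α h) αq)
      edges : ∀ {c u w} → u ≢ r → w ≢ r → m φ c u ≡ just w → m χ c u ≡ just w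
      edges {c} {u} u≢r w≢r h with same? c α
      ... | inj₂ c≢α = other c≢α h
      ... | inj₁ refl = trans (far u≢r (λ { refl → just≢nothing h αs })
                                (λ { refl → w≢r (just-injective (trans (≡sym h) (inv φ αq))) })) h
      to : ∀ {p c z} → InF q χ p → m φ c p ≡ nothing → m φ c r ≡ just z → ⊤ → InF q χ z
      to {p} {c} Fp a b _ with same? c α
      ... | inj₁ refl = subst (InF q χ) (just-injective (trans (≡sym αq) b)) root∈
      ... | inj₂ c≢α = reach-arc {χ} {c = c} Fp (other {c} c≢α a) (other {c} c≢α b)
      from : ∀ {p c z} → InF s φ p → m χ c p ≡ nothing → m χ c r ≡ just z → ⊤ → InF s φ z
      from {p} {c} Fp a b _ with same? c α
      ... | inj₁ refl = subst (InF s φ) (just-injective (trans (≡sym α-r) b)) root∈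
      ... | inj₂ c≢α = reach-arc Fp (other⁻ {c} c≢α a) (other⁻ {c} c≢α b)
      held′ : ∀ {c} p → InF s φ p → m φ c p ≡ nothing → Held q χ c
      held′ {c} p (_ , t) h with same? c α
      ... | inj₁ refl = q , root∈ , α-q
      ... | inj₂ c≢α = p , path-invariant (InF q χ) (λ { refl → s∈ }) to t , other c≢α h

      held″ : ∀ {c} p → InF s φ p → m χ c p ≡ nothing → Held s φ c
      held″ {c} p Fp h with same? c α
      ... | inj₁ refl = s , root∈ , αs
      ... | inj₂ c≢α = p , Fp , other⁻ {c} c≢α h

  rerooted-trans : ∀ {s p v φ ψ χ} → Rerooted s p φ ψ → Rerooted p v ψ χ →
    (∀ {c} → m φ c v ≡ nothing → m ψ c v ≡ nothing) → Rerooted s v φ χ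
  rerooted-trans A B k = record
    { state = state B ; two = two B
    ; r-keep = r-keep B ∘ r-keep A
    ; edges = λ a b h → edges B a b (edges A a b h)
    ; out = λ u∉F u≢r → trans (out B (u∉F ∘ fan⊃ A) u≢r) (out A u∉F u≢r)
    ; fan⊂ = fan⊂ B ∘ fan⊂ A ; fan⊃ = fan⊃ A ∘ fan⊃ B
    ; held = held B ∘ held A ; held⁻ = held⁻ A ∘ held⁻ B
    ; keep = keep B ∘ k }
    where open Rerooted

  -- The vertices in L are kept off the path, so that nothing changes at them.
  reroot′ : ∀ N {s φ k v} (L : V → Set) → k < N → State s φ → Two φ s → ¬ L s → Missing φ v →
    Path φ (λ w → w ≡ s) (λ _ _ z → ¬ L z) k v →
    ∃ λ ψ → Rerooted s v φ ψ × (∀ {c u} → L u → u ≢ r → m ψ c u ≡ m φ c u)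
  reroot′ (suc N) {s} {φ} {k} {v} L (s≤s k≤N) st two s∉L (c₀ , c₀v) t with first-hit t
  ... | inj₁ refl = φ , record
    { state = st ; two = two ; r-keep = id ; edges = λ _ _ → id ; out = λ _ _ → refl ; fan⊂ = id ; fan⊃ = id
    ; held = id ; held⁻ = id ; keep = id } , λ _ _ → refl
  ... | inj₂ (j , p , c , j<k , t′ , cp , cv , v∉L) =
    -- Adding `v` to the protected vertices keeps the edge `rv` and the missing colours of `v`
    -- intact until the predecessor `p` has become the root.
    let L′ = λ w → L w ⊎ w ≡ v
        (ψ , A , fixed) = reroot′ N L′ (ℕ.<-≤-trans j<k k≤N) st two
          [ s∉L , s≢v t′ ]′ (c , cp)
          (path-map proj₁ (λ _ _ a b o → a , b , [ proj₁ o , proj₂ o ]′) t′)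
        v≢r : v ≢ r
        v≢r = λ { refl → adj-irrefl (edge φ cv) refl }
        cv′ = inv ψ (trans (fixed (inj₂ refl) v≢r) (inv φ cv))
        keep-v : ∀ {d} → m φ d v ≡ nothing → m ψ d v ≡ nothing
        keep-v = λ h → trans (fixed (inj₂ refl) v≢r) h
        (χ , B , far) = reroot-step (Rerooted.state A) (Rerooted.keep A cp) cv′ (keep-v c₀v)
    in χ , rerooted-trans A B keep-v , λ {d} {u} Lu u≢r →
         trans (far u≢r (λ { refl → p∉L t′ Lu }) (λ { refl → v∉L Lu })) (fixed (inj₁ Lu) u≢r)
    where
    s≢v : ∀ {j p} → Avoiding φ (λ w → w ≡ s) (λ _ _ z → ¬ L z) v j p → s ≢ v
    s≢v (here (refl , h)) = h
    s≢v (arc t _ _ _) = s≢v t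
    p∉L : ∀ {j p} → Avoiding φ (λ w → w ≡ s) (λ _ _ z → ¬ L z) v j p → ¬ L p
    p∉L (here (refl , _)) = s∉L
    p∉L (arc _ _ _ (o , _)) = o

  reroot : ∀ {s φ v} → State s φ → Two φ s → Missing φ v → InF s φ v → ∃ λ ψ → Rerooted s v φ ψ
  reroot st two mv (k , t) =
    let (ψ , A , _) = reroot′ (suc k) (λ _ → ⊥) ℕ.≤-refl st two id mv (path-map id (λ _ _ a b _ → a , b , id) t)
    in ψ , A

  -- Moving the uncoloured edge to `rv` makes `v` the root and changes neither the fan nor which
  -- colours are wild.
  wild-edge : ∀ {s φ θ x v δ τ} → State s φ → Two φ s → m φ θ r ≡ nothing → InF s φ v → Missing φ v →
    (InF s φ x → ⊥) → x ≢ r → m φ δ x ≡ nothing → Wild s φ θ δ → m φ τ v ≡ just x → Wild s φ θ τ → ⊥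
  wild-edge st two θr Fv mv x∉F x≢r δx wδ τv wτ =
    let (ψ , A) = reroot st two mv Fv
        open Rerooted A renaming (state to st′; two to two′)
    in wild-root-edge st′ two′ (r-keep θr) (x∉F ∘ fan⊃) x≢r (trans (out x∉F x≢r) δx) (wild wδ)
         (edges (fan≢r st Fv) x≢r τv) (wild wτ)

  -- Arcs never leave the fan, so a path that ends outside was never inside.
  path-outside : ∀ {s φ P k q} → Path φ P Any k q → (InF s φ q → ⊥) → Path φ P (λ _ _ z → ¬ InF s φ z) k q
  path-outside (here p) q∉F = here p
  path-outside (arc t a b _) q∉F = arc (path-outside t (λ Fp → q∉F (reach-arc Fp a b))) a b q∉F

  fan-colour : ∀ {s φ c z} → State s φ → InF s φ z → m φ c r ≡ just z → Held s φ c
  fan-colour st (_ , here refl) e = ⊥-elim (uncoloured st _ e)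
  fan-colour {φ = φ} st (_ , arc t a b _) e with uniq φ b e
  ... | refl = _ , (_ , t) , a

  module Shifted {s φ ψ q c θ} (st : State s φ) (θr : m φ θ r ≡ nothing) (q∉F : InF s φ q → ⊥)
    (R : Recoloured φ ψ r q c θ) where

    open Recoloured R

    state′ : State s ψ
    state′ = state-recolour st R

    fan-same : ∀ {d v} → InF s φ v → m ψ d v ≡ m φ d v
    fan-same Fv = far _ (fan≢r st Fv) (λ { refl → q∉F Fv })

    r-keep : ∀ {d z} → z ≢ q → m φ d r ≡ just z → m ψ d r ≡ just z
    r-keep z≢q h = trans (other r (λ { refl → z≢q (just-injective (trans (≡sym h) was)) })
      (λ { refl → just≢nothing h θr })) h

    r-back : ∀ {d z} → m ψ d r ≡ just z → (z ≡ q × d ≡ θ) ⊎ m φ d r ≡ just z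
    r-back {d} h with among? d c θ
    ... | inj₁ refl = ⊥-elim (just≢nothing h old-x)
    ... | inj₂ (inj₁ refl) = inj₁ (just-injective (trans (≡sym h) new-x) , refl)
    ... | inj₂ (inj₂ (a , b)) = inj₂ (trans (≡sym (other r a b)) h)

    fan⊂ : ∀ {v} → InF s φ v → InF s ψ v
    fan⊂ (k , t) = k , path-map id (λ {k} t _ a b o →
      trans (fan-same (k , t)) a , r-keep (λ { refl → q∉F (reach-arc (k , t) a b) }) b , o) t

    fan⊃ : ∀ {v} → InF s ψ v → InF s φ v
    fan⊃ (_ , t) = path-invariant (InF s φ) reach-here step t
      where
      step : ∀ {p d z} → InF s φ p → m ψ d p ≡ nothing → m ψ d r ≡ just z → ⊤ → InF s φ z
      step Fp a b _ with r-back b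
      ... | inj₁ (refl , refl) = ⊥-elim (fan-disjoint-r s st θr Fp (trans (≡sym (fan-same Fp)) a))
      ... | inj₂ b′ = reach-arc Fp (trans (≡sym (fan-same Fp)) a) b′

    held⊂ : ∀ {d} → Held s φ d → Held s ψ d
    held⊂ (p , Fp , h) = p , fan⊂ Fp , trans (fan-same Fp) h

    path-shift : ∀ {ρ j p} → ρ ≢ θ → Avoiding φ (λ z → m φ ρ r ≡ just z) Any q j p →
      Path ψ (λ z → m ψ ρ r ≡ just z) Any j p
    path-shift ρ≢θ = path-map (λ { (e , z≢q) → r-keep z≢q e })
      (λ t _ a b o → trans (far _ (source≢r {φ} a b) (avoiding-≢ t)) a , r-keep (proj₂ o) b , tt)

  module Away-path {s φ θ γ T} (W : Away s φ θ γ T) (θr : m φ θ r ≡ nothing) (Hγ : Held s φ γ) where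
    open Away W

    away-path : ∀ {ρ k q} → Path φ (λ z → m φ ρ r ≡ just z) (λ _ _ z → ¬ InF s φ z) k q →
      Path ψ (λ z → m ψ ρ r ≡ just z) (λ _ _ z → ¬ InF s ψ z) k q
    away-path = path-map r-same (λ t _ a b o →
      other (λ { refl → just≢nothing b θr }) (λ { refl → o (reach-arc (proj₁ (proj₂ Hγ)) (proj₂ (proj₂ Hγ)) b) }) a
      , r-same b , o ∘ fan⊃)

  forget : ∀ {φ P Ok k q} → Path φ P Ok k q → Path φ P Any k q
  forget = path-map id (λ _ _ a b _ → a , b , tt)

-- Branches opened by edges from the fan to a wild vertex

module FanPool {n : ℕ} (G : Graph n) (D : ℕ) (r : Fin n) (no-total : ∀ φ → Centre.Total G D r φ → ⊥)
  (NC : Fin n → Set)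
  (missing : ∀ {s φ v} → Centre.State G D r s φ → NC v → Fan.Missing G D r no-total φ v)
  (two : ∀ {s φ} → Centre.State G D r s φ → NC s → Fan.Two G D r no-total φ s)
  where

  open Matchings G D
  open Centre G D r
  open Fan G D r no-total

  Via : Col → C → V → Set
  Via φ ρ z = m φ ρ r ≡ just z

  -- If r could be made to miss the colour of an edge vx between the fan and a wild vertex x, that edge would be wild.
  branch-disjoint-r : ∀ N {s φ θ v x ρ δ k q} → k < N → State s φ → NC s → m φ θ r ≡ nothing → InF s φ v → NC v →
    m φ ρ v ≡ just x → (InF s φ x → ⊥) → x ≢ r → m φ δ x ≡ nothing → Held s φ δ →
    Path φ (Via φ ρ) Any k q → (InF s φ q → ⊥) → m φ θ q ≡ nothing → ⊥
  branch-disjoint-r (suc N) {s} {φ} {θ} {v} {x} {ρ} {δ} {k} {q} (s≤s k≤N) st ncs θr Fv ncv ρv x∉F x≢r δx Hδ t q∉F θq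
    with same? ρ θ
  ... | inj₁ refl = wild-edge st (two st ncs) θr Fv (missing st ncv) x∉F x≢r δx (inj₂ Hδ) ρv (inj₁ refl)
  ... | inj₂ ρ≢θ with first-hit t
  ...   | inj₁ ρq = let (ψ , R) = recolour φ ρq θr θq
                        open Recoloured R
                        open Shifted st θr q∉F R
                    in wild-edge state′ (two state′ ncs) old-x (fan⊂ Fv) (missing state′ ncv) (x∉F ∘ fan⊃) x≢r
                         (keeps (held≢θ st θr Hδ) δx) (inj₂ (held⊂ Hδ)) (trans (fan-same Fv) ρv) (inj₁ refl)
  ...   | inj₂ (j , p , c , j<k , t′ , cp , cq , _) =
    let (ψ , R) = recolour φ cq θr θq
        open Recoloured R
        open Shifted st θr q∉F R
    in branch-disjoint-r N (ℕ.<-≤-trans j<k k≤N) state′ ncs old-x (fan⊂ Fv) ncv (trans (fan-same Fv) ρv)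
         (x∉F ∘ fan⊃) x≢r (keeps (held≢θ st θr Hδ) δx) (held⊂ Hδ) (path-shift ρ≢θ t′)
         (λ Fp → q∉F (reach-arc (fan⊃ Fp) cp cq))
         (trans (far c (source≢r {φ} cp cq) (avoiding-≢ t′)) cp)

  module _ {s φ θ x δ} (st : State s φ) (ncs : NC s) (θr : m φ θ r ≡ nothing)
    (x∉F : InF s φ x → ⊥) (x≢r : x ≢ r) (δx : m φ δ x ≡ nothing) (Hδ : Held s φ δ) where

    not-wild : ∀ {v ρ} → InF s φ v → NC v → m φ ρ v ≡ just x → Wild s φ θ ρ → ⊥
    not-wild Fv ncv ρv w = wild-edge st (two st ncs) θr Fv (missing st ncv) x∉F x≢r δx (inj₂ Hδ) ρv w

    -- A θ,`c`-change on the chain of `q` turns a held `c` into θ. The condition `c ≢ δ` lets `x`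
    -- keep its held colour δ under this change.
    branch-disjoint : ∀ {v ρ k q c} → InF s φ v → NC v → m φ ρ v ≡ just x →
      Path φ (Via φ ρ) Any k q → (InF s φ q → ⊥) → m φ c q ≡ nothing → Wild s φ θ c → c ≢ δ → ⊥
    branch-disjoint Fv ncv ρv t q∉F cq (inj₁ refl) _ =
      branch-disjoint-r _ ℕ.≤-refl st ncs θr Fv ncv ρv x∉F x≢r δx Hδ t q∉F cq
    branch-disjoint {v} {ρ} {k} {q} {c} Fv ncv ρv t q∉F cq (inj₂ Hc) c≢δ =
      wild-chain st θr Hc (inj₂ cq) q∉F q≢r λ T W Tq _ →
        let open Away W
            open Away-path W θr Hc
        in branch-disjoint-r _ ℕ.≤-refl state′ ncs (r-same θr) (fan⊂ Fv) ncv
             (other (λ { refl → not-wild Fv ncv ρv (inj₁ refl) }) (λ { refl → not-wild Fv ncv ρv (inj₂ Hc) }) ρv)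
             (x∉F ∘ fan⊃) x≢r (other (held≢θ st θr Hδ) (λ e → c≢δ (≡sym e)) δx) (held⊂ Hδ)
             (forget (away-path (path-outside t q∉F))) (q∉F ∘ fan⊃) (in-θ Tq cq)
      where
      q≢r : q ≢ r
      q≢r refl = path≢r t refl
        where
        path≢r : ∀ {k z} → Path φ (Via φ ρ) Any k z → z ≢ r
        path≢r (here e) refl = adj-irrefl (edge φ e) refl
        path≢r (arc _ _ e _) refl = adj-irrefl (edge φ e) refl

  module _ {s φ θ x δ} (st : State s φ) (ncs : NC s) (θr : m φ θ r ≡ nothing)
    (x∉F : InF s φ x → ⊥) (x≢r : x ≢ r) (δx : m φ δ x ≡ nothing) (Hδ : Held s φ δ) where

    -- The coloured edge vx is used to add the branch of its colour to the fan, rerooted at v.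
    record Grown (v u : V) (ρ : C) (χ : Col) : Set where
      field
        state : State v χ
        θr′ : m χ θ r ≡ nothing
        new-v : m χ ρ v ≡ nothing
        new-x : m χ ρ x ≡ nothing
        u∈ : InF v χ u
        branch∈ : ∀ {k q} → Path φ (Via φ ρ) Any k q → (InF s φ q → ⊥) → InF v χ q
        keep : ∀ {c w} → (InF s φ w → ⊥) → w ≢ r → (Wild s φ θ c → ⊥) → m φ c w ≡ nothing → m χ c w ≡ nothing
        branch : ∀ {ρ′ k q} → (Wild s φ θ ρ′ → ⊥) → Path φ (Via φ ρ′) Any k q → (InF s φ q → ⊥) →
          Path χ (Via χ ρ′) Any k q
        edges : ∀ {c w} → w ≢ r → (Wild s φ θ c → ⊥) → c ≢ ρ → m φ c w ≡ just x → m χ c w ≡ just x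

      x∉ : x ≢ v → InF v χ x → ⊥
      x∉ x≢v Fx = fan-elementary v state θr′ Fx root∈ new-x new-v x≢v

    -- Once `v` is the root, it has two missing colours; the exchange gives up one whose loss does
    -- not cut `u` off from the fan.
    grow : ∀ {v u ρ} → InF s φ v → NC v → m φ ρ v ≡ just x → InF s φ u → (∀ χ → Grown v u ρ χ → ⊥) → ⊥
    grow {v} {u} {ρ} Fv ncv ρv Fu k =
      let (ψ , A) = reroot st (two st ncs) (missing st ncv) Fv
          open Rerooted A using () renaming (two to two-v)
          (a , b , a≢b , av , bv) = two-v
      in [ go ψ A av , go ψ A bv ]′ (without-one a≢b (Rerooted.fan⊂ A Fu))
      where
      nw : Wild s φ θ ρ → ⊥
      nw = not-wild st ncs θr x∉F x≢r δx Hδ Fv ncv ρv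
      go : ∀ ψ (A : Rerooted s v φ ψ) → ∀ {γ} → m ψ γ v ≡ nothing → Without v γ ψ u → ⊥
      go ψ A {γ} γv w =
        exchange (Rerooted.state A) (r-keep θr) γv (x∉F ∘ fan⊃) x≢r (trans (out x∉F x≢r) δx) (wild (inj₂ Hδ))
          (edges (fan≢r st Fv) x≢r ρv) (nw ∘ inj₁) λ χ E → k χ record
            { state = Exchange.state E
            ; θr′ = Exchange.r-same E (r-keep θr)
            ; new-v = Exchange.new-s E
            ; new-x = Exchange.new-x E
            ; u∈ = Exchange.fan⊂ E w
            ; branch∈ = λ t q∉F → Exchange.fan-new E (r-keep θr) (outside nw (path-outside t q∉F))
            ; keep = λ w∉F w≢r nwc h → Exchange.keep E (nwc ∘ wild⁻) (trans (out w∉F w≢r) h)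
            ; branch = λ nwρ t q∉F → path-map (Exchange.r-same E) (λ { t _ a b o → conv E t a b o , Exchange.r-same E b , tt })
                (outside nwρ (path-outside t q∉F))
            ; edges = λ w≢r nwc c≢ρ h → Exchange.other E (nwc ∘ wild⁻) c≢ρ (edges w≢r x≢r h) }
        where
        open Rerooted A hiding (state; two)
        wild⁻ : ∀ {c} → Wild v ψ θ c → Wild s φ θ c
        wild⁻ (inj₁ e) = inj₁ e
        wild⁻ (inj₂ h) = inj₂ (held⁻ h)
        start∉ : ∀ {ρ′ z} → (Wild s φ θ ρ′ → ⊥) → m φ ρ′ r ≡ just z → InF s φ z → ⊥
        start∉ nwρ e Fz = nwρ (inj₂ (fan-colour st Fz e))
        source∉ : ∀ {ρ′ k q} → (Wild s φ θ ρ′ → ⊥) → Path φ (Via φ ρ′) (λ _ _ z → ¬ InF s φ z) k q → InF s φ q → ⊥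
        source∉ nwρ (here e) = start∉ nwρ e
        source∉ nwρ (arc _ _ _ o) = o
        outside : ∀ {ρ′ k q} → (Wild s φ θ ρ′ → ⊥) → Path φ (Via φ ρ′) (λ _ _ z → ¬ InF s φ z) k q →
          Path ψ (Via ψ ρ′) (λ _ _ z → ¬ InF v ψ z) k q
        outside nwρ = path-map (λ e → r-out (start∉ nwρ e) e)
          (λ t _ a b o → trans (out (source∉ nwρ t) (source≢r {φ} a b)) a , r-out o b , o ∘ fan⊃)
        conv : ∀ {χ ρ′ k q c z} → Exchange v ψ χ x θ ρ γ → Path ψ (Via ψ ρ′) (λ _ _ z → ¬ InF v ψ z) k q →
          m ψ c q ≡ nothing → m ψ c r ≡ just z → ¬ InF v ψ z → m χ c q ≡ nothing
        conv E t a b o = Exchange.keep E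
          (λ { (inj₁ refl) → just≢nothing b (r-keep θr) ; (inj₂ (p , Fp , h)) → o (reach-arc Fp h b) }) a

    private
      ≢x : ∀ {v} → InF s φ v → x ≢ v
      ≢x Fv refl = x∉F Fv

      nw : ∀ {v ρ} → InF s φ v → NC v → m φ ρ v ≡ just x → Wild s φ θ ρ → ⊥
      nw = not-wild st ncs θr x∉F x≢r δx Hδ

    branch-avoids-x : ∀ {v ρ k} → InF s φ v → NC v → m φ ρ v ≡ just x → Path φ (Via φ ρ) Any k x → ⊥
    branch-avoids-x Fv ncv ρv t = grow Fv ncv ρv root∈ λ χ H →
      Grown.x∉ H (≢x Fv) (Grown.branch∈ H t x∉F)

    via≢r : ∀ {ρ k z} → Path φ (Via φ ρ) Any k z → z ≢ r
    via≢r (here e) refl = adj-irrefl (edge φ e) refl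
    via≢r (arc _ _ e _) refl = adj-irrefl (edge φ e) refl

    -- Growing the fan at `v′` brings `q` into it. If ρ and ρ′ agree, `q` shares ρ with the new
    -- root. Otherwise `vx` is still coloured ρ, which is now held, and an edge from the fan to the
    -- wild vertex `x` cannot have a held colour.
    branch-edge : ∀ {v v′ ρ ρ′ k q} → InF s φ v → NC v → m φ ρ v ≡ just x → InF s φ v′ → NC v′ → m φ ρ′ v′ ≡ just x →
      Path φ (Via φ ρ′) Any k q → (InF s φ q → ⊥) → m φ ρ q ≡ nothing → ⊥
    branch-edge {v} {v′} {ρ} {ρ′} {k} {q} Fv ncv ρv Fv′ ncv′ ρv′ t q∉F ρq = grow Fv′ ncv′ ρv′ Fv λ χ H →
      let open Grown H
          ρq′ = keep q∉F (via≢r t) (nw Fv ncv ρv) ρq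
      in by-cases (ρ ≡ ρ′)
        (λ { refl → fan-elementary v′ state θr′ (branch∈ t q∉F) root∈ ρq′ new-v (λ { refl → q∉F Fv′ }) })
        (λ ρ≢ρ′ → wild-edge state (two state ncv′) θr′ u∈ (missing state ncv) (x∉ (≢x Fv′)) x≢r new-x
          (inj₂ (v′ , root∈ , new-v)) (edges (fan≢r st Fv) (nw Fv ncv ρv) ρ≢ρ′ ρv)
          (inj₂ (q , branch∈ t q∉F , ρq′)))

    -- Growing along `vx` puts `q` into the fan and makes `c` held. Then `q′` is either in the new
    -- fan too, or on a branch that must not miss a held colour.
    branches-disjoint : ∀ {v v′ ρ ρ′ k k′ q q′ c} → InF s φ v → NC v → m φ ρ v ≡ just x →
      InF s φ v′ → NC v′ → m φ ρ′ v′ ≡ just x →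
      Path φ (Via φ ρ) Any k q → (InF s φ q → ⊥) → Path φ (Via φ ρ′) Any k′ q′ → (InF s φ q′ → ⊥) →
      m φ c q ≡ nothing → m φ c q′ ≡ nothing → (Wild s φ θ c → ⊥) → q ≢ q′ → ⊥
    branches-disjoint {v} {v′} {ρ} {ρ′} {q = q} {q′} {c} Fv ncv ρv Fv′ ncv′ ρv′ t q∉F t′ q′∉F cq cq′ nwc q≢q′ =
      grow Fv ncv ρv Fv′ λ χ H →
        let open Grown H
            c-q = keep q∉F (via≢r t) nwc cq
            c-q′ = keep q′∉F (via≢r t′) nwc cq′
            both = λ Fq′ → fan-elementary v state θr′ (branch∈ t q∉F) Fq′ c-q c-q′ q≢q′
        in by-cases (ρ ≡ ρ′)
          (λ { refl → both (branch∈ t′ q′∉F) })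
          (λ ρ≢ρ′ → by-cases (InF v χ q′) both λ q′∉ →
            branch-disjoint state ncv θr′ (x∉ (≢x Fv)) x≢r new-x (v , root∈ , new-v) u∈ ncv′
              (edges (fan≢r st Fv′) (nw Fv′ ncv′ ρv′) (λ e → ρ≢ρ′ (≡sym e)) ρv′)
              (branch (nw Fv′ ncv′ ρv′) t′ q′∉F) q′∉ c-q′ (inj₂ (q , branch∈ t q∉F , c-q)) c≢ρ)
      where
      c≢ρ : c ≢ ρ
      c≢ρ refl = branch-edge Fv ncv ρv Fv ncv ρv t q∉F cq

    -- Two branch vertices that miss a colour α of x and of the root are both joined to x by the chain
    -- of θ and α; otherwise x could be given another colour β of the root without affecting one of them.
    partner-unique : ∀ {α β} → m φ α s ≡ nothing → m φ β s ≡ nothing → α ≢ β → m φ α x ≡ nothing →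
      ∀ {v v′ ρ ρ′ k k′ q q′} → InF s φ v → NC v → m φ ρ v ≡ just x → InF s φ v′ → NC v′ → m φ ρ′ v′ ≡ just x →
      Path φ (Via φ ρ) Any k q → (InF s φ q → ⊥) → Path φ (Via φ ρ′) Any k′ q′ → (InF s φ q′ → ⊥) →
      m φ α q ≡ nothing → m φ α q′ ≡ nothing → q ≢ q′ → ⊥
    partner-unique {α} {β} αs βs α≢β αx {q = q} {q′} Fv ncv ρv Fv′ ncv′ ρv′ t q∉F t′ q′∉F αq αq′ q≢q′ =
      wild-chain st θr (s , root∈ , αs) (inj₂ αx) x∉F x≢r λ T W Tx ends →
        by-cases (T q ≡ true)
          (λ Tq → by-cases (T q′ ≡ true)
            (λ Tq′ → q≢q′ (ends Tq (≢-x Fv ncv ρv t) (inj₂ αq) Tq′ (≢-x Fv′ ncv′ ρv′ t′) (inj₂ αq′)))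
            (λ h → off W Tx Fv′ ncv′ ρv′ t′ q′∉F αq′ (not-true h)))
          (λ h → off W Tx Fv ncv ρv t q∉F αq (not-true h))
      where
      ≢-x : ∀ {v ρ k q} → InF s φ v → NC v → m φ ρ v ≡ just x → Path φ (Via φ ρ) Any k q → q ≢ x
      ≢-x Fv ncv ρv t refl = branch-avoids-x Fv ncv ρv t
      α≢θ : α ≢ θ
      α≢θ = held≢θ st θr (s , root∈ , αs)
      off : ∀ {T} (W : Away s φ θ α T) → T x ≡ true → ∀ {v ρ k q} → InF s φ v → NC v → m φ ρ v ≡ just x →
        Path φ (Via φ ρ) Any k q → (InF s φ q → ⊥) → m φ α q ≡ nothing → T q ≡ false → ⊥
      off {T} W Tx {v} {ρ} {k} {q} Fv ncv ρv t q∉F αq Tq =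
        wild-chain state′ (r-same θr) Hβ (inj₁ (in-θ Tx αx)) (x∉F ∘ fan⊃) x≢r λ T₂ W₂ T₂x _ →
          branch-disjoint (Away.state′ W₂) ncs (Away.r-same W₂ (r-same θr)) (x∉F ∘ fan⊃ ∘ Away.fan⊃ W₂) x≢r
            (Away.in-γ W₂ T₂x (in-θ Tx αx)) (Away.held⊂ W₂ Hβ) (Away.fan⊂ W₂ (fan⊂ Fv)) ncv
            (Away.other W₂ ρ≢θ (ρ≢ βs) (other ρ≢θ (ρ≢ αs) ρv))
            (forget (Away-path.away-path W₂ (r-same θr) Hβ (Away-path.away-path W θr (s , root∈ , αs) (path-outside t q∉F))))
            (q∉F ∘ fan⊃ ∘ Away.fan⊃ W₂) (Away.other W₂ α≢θ α≢β (out Tq αq))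
            (inj₂ (Away.held⊂ W₂ (held⊂ (s , root∈ , αs)))) α≢β
        where
        open Away W
        Hβ : Held s ψ β
        Hβ = s , root∈ , fan-keep root∈ βs
        ρ≢θ : ρ ≢ θ
        ρ≢θ e = nw Fv ncv ρv (inj₁ e)
        ρ≢ : ∀ {c} → m φ c s ≡ nothing → ρ ≢ c
        ρ≢ h refl = nw Fv ncv ρv (inj₂ (s , root∈ , h))

-- Further start vertices

module Robust {n : ℕ} (G : Graph n) (D : ℕ) (r : Fin n) (no-total : ∀ φ → Centre.Total G D r φ → ⊥)
  (NC : Fin n → Set)
  (missing : ∀ {s φ v} → Centre.State G D r s φ → NC v → Fan.Missing G D r no-total φ v)
  (two : ∀ {s φ} → Centre.State G D r s φ → NC s → Fan.Two G D r no-total φ s)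
  (s : Fin n) (ncs : NC s) (big : Fin n → Bool) (α β : Fin D) (leaf : Fin n)
  where

  open Matchings G D
  open Centre G D r
  open Fan G D r no-total
  open FanPool G D r no-total NC missing two using (Via; via≢r)

  -- big will be the vertex set of a largest fan and leaf a core vertex.
  record Cls (φ : Col) : Set where
    field
      state : State s φ
      big⊂ : ∀ {v} → big v ≡ true → InF s φ v
      αs : m φ α s ≡ nothing
      βs : m φ β s ≡ nothing
      αr : m φ α r ≡ just leaf

    leaf∈ : InF s φ leaf
    leaf∈ = reach-arc root∈ αs αr

  F∌ : Col → V → Set
  F∌ φ v = InF s φ v → ⊥

  cls-away : ∀ {φ a b T} → Cls φ → (W : Away s φ a b T) → Cls (Away.ψ W)
  cls-away cl W = record
    { state = Away.state′ W ; big⊂ = Away.fan⊂ W ∘ big⊂ ; αs = Away.fan-keep W root∈ αs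
    ; βs = Away.fan-keep W root∈ βs ; αr = Away.r-same W αr }
    where open Cls cl

  cls-shift : ∀ {φ ψ q c θ} → Cls φ → m φ θ r ≡ nothing → F∌ φ q → Recoloured φ ψ r q c θ → Cls ψ
  cls-shift cl θr q∉F R = record
    { state = state′ ; big⊂ = fan⊂ ∘ big⊂ ; αs = trans (fan-same root∈) αs ; βs = trans (fan-same root∈) βs
    ; αr = r-keep (λ { refl → q∉F leaf∈ }) αr }
    where
    open Cls cl
    open Shifted state θr q∉F R

  module Outside {φ ψ x y c d} (R : Recoloured φ ψ x y c d) (x∉F : F∌ φ x) (y∉F : F∌ φ y) (x≢r : x ≢ r) (y≢r : y ≢ r) where

    open Recoloured R

    r-far : ∀ {e} → m ψ e r ≡ m φ e r
    r-far = far _ (λ e → x≢r (≡sym e)) (λ e → y≢r (≡sym e))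

    fan-far : ∀ {e v} → InF s φ v → m ψ e v ≡ m φ e v
    fan-far Fv = far _ (λ { refl → x∉F Fv }) (λ { refl → y∉F Fv })

    fan⊂ : ∀ {v} → InF s φ v → InF s ψ v
    fan⊂ (k , t) = k , path-map id (λ {k} t _ a b o → trans (fan-far (k , t)) a , trans r-far b , o) t

    fan⊃ : ∀ {v} → InF s ψ v → InF s φ v
    fan⊃ (_ , t) = path-invariant (InF s φ) reach-here
      (λ Fq a b _ → reach-arc Fq (trans (≡sym (fan-far Fq)) a) (trans (≡sym r-far) b)) t

    cls′ : Cls φ → Cls ψ
    cls′ cl = record
      { state = state-recolour state R ; big⊂ = fan⊂ ∘ big⊂ ; αs = trans (fan-far root∈) αs
      ; βs = trans (fan-far root∈) βs ; αr = trans r-far αr }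
      where open Cls cl

  -- What the argument requires of additional start vertices, so that it can be run for two
  -- different sets of them. `P°` is the stronger condition that still yields `P` after a Kempe
  -- change; `Flat` marks the colours γ whose changes with θ preserve `P°` in both directions, and
  -- `route` supplies a detour through α for the others.
  record Starts : Set₁ where
    field
      P P° : Col → V → Set
      P°⊂P : ∀ {φ v} → P° φ v → P φ v
      P-nc : ∀ {φ v} → P φ v → NC v
      P≢r : ∀ {φ v} → Cls φ → P φ v → v ≢ r
      star : ∀ {φ θ y c} → Cls φ → m φ θ r ≡ nothing → P φ y → F∌ φ y → m φ c y ≡ nothing → Wild s φ θ c → ⊥
      P-shift : ∀ {φ ψ q c θ y} → Cls φ → m φ θ r ≡ nothing → F∌ φ q → m φ θ q ≡ nothing →
        Recoloured φ ψ r q c θ → P φ y → P ψ y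
      P-away : ∀ {φ θ γ T y} → Cls φ → m φ θ r ≡ nothing → (W : Away s φ θ γ T) → P° φ y → P (Away.ψ W) y
      P-up : ∀ {φ θ y x} → Cls φ → m φ θ r ≡ nothing → m φ θ y ≡ just x → F∌ φ x → P φ y → P° φ y
      P°-away : ∀ {φ a b T y} → (W : Away s φ a b T) → T s ≡ false →
        (P° φ y → P° (Away.ψ W) y) × (P° (Away.ψ W) y → P° φ y)
      P°-far : ∀ {φ ψ y} → (∀ c → m ψ c r ≡ m φ c r) → (∀ c → m ψ c s ≡ m φ c s) → P° φ y → P° ψ y
      P-far : ∀ {φ ψ y} → (∀ c → m ψ c r ≡ m φ c r) → (∀ c → m ψ c s ≡ m φ c s) → P φ y → P ψ y
      Flat : Col → C → Set
      flat-r : ∀ {φ ψ c} → (∀ c → m ψ c r ≡ m φ c r) → Flat φ c → Flat ψ c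
      flat-away : ∀ {φ θ γ T y} → Cls φ → m φ θ r ≡ nothing → Flat φ γ → (W : Away s φ θ γ T) →
        (P° φ y → P° (Away.ψ W) y) × (P° (Away.ψ W) y → P° φ y)
      route : ∀ {φ θ y x γ} → Cls φ → m φ θ r ≡ nothing → P° φ y → F∌ φ y → m φ γ y ≡ nothing →
        F∌ φ x → x ≢ r → x ≢ y → Misses φ α γ x → (Flat φ γ → ⊥) →
        (∀ T → Away s φ α γ T → T x ≡ true → T s ≡ false → T y ≡ false → ⊥) → ⊥

  module System (S : Starts) where

    open Starts S

    P⁺ P⁺° : Col → V → Set
    P⁺ φ v = v ≡ s ⊎ P φ v
    P⁺° φ v = v ≡ s ⊎ P° φ v

    mk-away : ∀ {φ θ γ T} → Cls φ → m φ θ r ≡ nothing → Closed φ θ γ T → T r ≡ false → Away s φ θ γ T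
    mk-away {T = T} cl θr c Tr = record
      { state = state ; closed = c ; r∉ = Tr
      ; fan∉ = λ { Fv (inj₁ h) → ⊥-elim (fan-disjoint-r s state θr Fv h)
                 ; Fv (inj₂ h) → not-true λ Tv → fan-linked s state θr Fv h T c Tv Tr } }
      where open Cls cl

    private
      no-start : ∀ {φ θ v} → Cls φ → m φ θ r ≡ nothing → P⁺ φ v → m φ θ v ≡ nothing → ⊥
      no-start cl θr (inj₁ e) h = root-disjoint (Cls.state cl) θr e h
      no-start {φ} {v = v} cl θr (inj₂ p) h = by-cases (InF s φ v)
        (λ Fv → fan-disjoint-r s (Cls.state cl) θr Fv h)
        (λ v∉F → star cl θr p v∉F h (inj₁ refl))

      shift : ∀ {φ θ q c} → Cls φ → m φ θ r ≡ nothing → m φ θ q ≡ nothing → m φ c r ≡ just q →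
        (∀ ψ → Recoloured φ ψ r q c θ → Cls ψ → (∀ {v} → P⁺ φ v → P⁺ ψ v) → ⊥) → ⊥
      shift {φ} {q = q} cl θr θq e k = by-cases (InF s φ q)
        (λ Fq → fan-disjoint-r s (Cls.state cl) θr Fq θq)
        (λ q∉F → let (ψ , R) = recolour φ e θr θq in
          k ψ R (cls-shift cl θr q∉F R) [ inj₁ , inj₂ ∘ P-shift cl θr q∉F θq R ]′)

      kempe : ∀ {φ θ γ T} → Cls φ → m φ θ r ≡ nothing → (c : Closed φ θ γ T) → T r ≡ false →
        (Cls (swap φ θ γ T c) → (∀ {v} → P⁺° φ v → P⁺ (swap φ θ γ T c) v) → ⊥) → ⊥
      kempe cl θr c Tr k = k (cls-away cl W) (λ { (inj₁ e) → inj₁ e ; (inj₂ p) → inj₂ (P-away cl θr W p) })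
        where
        W = mk-away cl θr c Tr

    open Elementary Cls P⁺ P⁺° [ inj₁ , inj₂ ∘ P°⊂P ]′ no-start shift kempe
      public

    Q : Col → V → Set
    Q φ v = Reach φ (P⁺° φ) v

    QHeld : Col → C → Set
    QHeld φ c = ∃ λ p → Q φ p × m φ c p ≡ nothing

    fan⊂Q : ∀ {φ v} → InF s φ v → Q φ v
    fan⊂Q (k , t) = k , path-map inj₁ (λ _ _ a b o → a , b , o) t

    start∈Q : ∀ {φ v} → P° φ v → Q φ v
    start∈Q {φ} p = reach-here {φ} {P⁺° φ} (inj₂ p)

    root∈Q : ∀ {φ} → Q φ s
    root∈Q {φ} = reach-here {φ} {P⁺° φ} (inj₁ refl)

    Q-disjoint-r : ∀ {φ θ v} → Cls φ → m φ θ r ≡ nothing → Q φ v → m φ θ v ≡ nothing → ⊥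
    Q-disjoint-r cl θr Qv = disjoint-r cl θr (weaken Qv)

    qheld≢θ : ∀ {φ θ c} → Cls φ → m φ θ r ≡ nothing → QHeld φ c → c ≢ θ
    qheld≢θ cl θr (p , Qp , h) refl = Q-disjoint-r cl θr Qp h

    record QAway (φ : Col) (a b : C) (T : V → Bool) : Set where
      field
        away : Away s φ a b T
        Q∉ : ∀ {v} → Q φ v → Misses φ a b v → T v ≡ false

    mk-qaway : ∀ {φ θ γ T} → Cls φ → m φ θ r ≡ nothing → Closed φ θ γ T → T r ≡ false → QAway φ θ γ T
    mk-qaway {T = T} cl θr c Tr = record { away = mk-away cl θr c Tr ; Q∉ = λ
      { Qv (inj₁ h) → ⊥-elim (Q-disjoint-r cl θr Qv h)
      ; Qv (inj₂ h) → not-true λ Tv → linked cl θr Qv h T c Tv Tr } }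

    q-chain : ∀ {φ θ γ x} → Cls φ → m φ θ r ≡ nothing → QHeld φ γ → Misses φ θ γ x → (Q φ x → ⊥) → x ≢ r →
      (∀ T → QAway φ θ γ T → T x ≡ true →
        (∀ {v} → T v ≡ true → v ≢ x → Misses φ θ γ v → (∀ {w} → T w ≡ true → w ≢ x → Misses φ θ γ w → v ≡ w)) → ⊥) → ⊥
    q-chain cl θr (p , Qp , γp) mx x∉Q x≢r k =
      own-chain cl θr Qp γp mx (λ { refl → x∉Q Qp }) x≢r λ T c Tx _ Tr ends →
        k T (mk-qaway cl θr c Tr) Tx ends

    -- A θ,δ-change carries `y` along with `x`, so `yx` gets colour δ and `x` misses θ. A second
    -- change, of θ with a colour γ missing at `y`, makes `x` miss γ without affecting `y`.
    -- Recolouring `yx` with γ leaves `y` missing δ, a colour of `s`, against `star`.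
    start-edge : ∀ {φ θ y x δ} → Cls φ → m φ θ r ≡ nothing → P φ y → F∌ φ y → F∌ φ x → x ≢ r →
      m φ δ x ≡ nothing → m φ δ s ≡ nothing → m φ θ y ≡ just x → ⊥
    start-edge {φ} {θ} {y} {x} {δ} cl θr Py y∉F x∉F x≢r δx δs θy =
      wild-chain (Cls.state cl) θr (s , root∈ , δs) (inj₂ δx) x∉F x≢r λ T W Tx _ →
        let open Away W
            Ty = closed (inj₁ refl) (inv φ θy) Tx
            Ts = fan∉ root∈ (inj₂ δs)
            cl₁ = cls-away cl W
            θr₁ = r-same θr
            P₁ = proj₁ (P°-away W Ts) (P-up cl θr θy x∉F Py)
            y∉F₁ = y∉F ∘ fan⊃
            x∉F₁ = x∉F ∘ fan⊃
            δs₁ = fan-keep root∈ δs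
            δy₁ = in-γ Ty θy
            (γ , γy) = missing (Cls.state cl₁) (P-nc (P°⊂P P₁))
        in q-chain cl₁ θr₁ (y , start∈Q P₁ , γy) (inj₁ (in-θ Tx δx))
             (λ Qx → x∉Q₁ W Qx (in-θ Tx δx) cl₁ θr₁) x≢r
             λ T₂ W₂ T₂x _ → finish cl₁ θr₁ P₁ y∉F₁ x∉F₁ δs₁ δy₁ γy W₂ T₂x (in-θ Tx δx)
      where
      x∉Q₁ : ∀ {T} (W : Away s φ θ δ T) → Q (Away.ψ W) x → m (Away.ψ W) θ x ≡ nothing → Cls (Away.ψ W) →
        m (Away.ψ W) θ r ≡ nothing → ⊥
      x∉Q₁ W Qx θx cl₁ θr₁ = Q-disjoint-r cl₁ θr₁ Qx θx
      finish : ∀ {ψ γ T₂} → Cls ψ → m ψ θ r ≡ nothing → P° ψ y → F∌ ψ y → F∌ ψ x → m ψ δ s ≡ nothing →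
        m ψ δ y ≡ just x → m ψ γ y ≡ nothing → QAway ψ θ γ T₂ → T₂ x ≡ true → m ψ θ x ≡ nothing → ⊥
      finish {ψ} {γ} {T₂} cl₁ θr₁ P₁ y∉F₁ x∉F₁ δs₁ δy₁ γy W₂ T₂x θx =
        let open Away (QAway.away W₂) renaming (ψ to ψ₂)
            γ≢δ : γ ≢ δ
            γ≢δ = λ { refl → just≢nothing δy₁ γy }
            δ≢θ : δ ≢ θ
            δ≢θ = held≢θ (Cls.state cl₁) θr₁ (s , root∈ , δs₁)
            cl₂ = cls-away cl₁ (QAway.away W₂)
            P₂ = P-away cl₁ θr₁ (QAway.away W₂) P₁
            (χ , R) = recolour ψ₂ (other δ≢θ (λ e → γ≢δ (≡sym e)) δy₁)
                        (out (QAway.Q∉ W₂ (start∈Q P₁) (inj₂ γy)) γy) (in-γ T₂x θx)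
            open Outside R (y∉F₁ ∘ fan⊃) (x∉F₁ ∘ fan⊃) (P≢r cl₂ P₂) x≢r renaming (fan⊃ to fan⊃χ)
        in star (cls′ cl₂) (trans r-far (r-same θr₁)) (P-far (λ _ → r-far) (λ _ → fan-far root∈) P₂)
             (y∉F₁ ∘ fan⊃ ∘ fan⊃χ) (Recoloured.old-x R)
             (inj₂ (s , root∈ , trans (fan-far root∈) (fan-keep root∈ δs₁)))

    q-path-outside : ∀ {φ P′ k q} → Path φ P′ Any k q → (Q φ q → ⊥) → Path φ P′ (λ _ _ z → ¬ Q φ z) k q
    q-path-outside (here p) q∉Q = here p
    q-path-outside (arc t a b _) q∉Q = arc (q-path-outside t (λ Qp → q∉Q (reach-arc Qp a b))) a b q∉Q

    -- The edges of the branch are shifted one after another until `r` misses ρ itself; then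
    -- `start-edge` applies to the edge `vx`.
    start-branch-r : ∀ N {φ θ v x ρ δ k q} → k < N → Cls φ → m φ θ r ≡ nothing → P φ v → F∌ φ v →
      m φ ρ v ≡ just x → F∌ φ x → x ≢ r → m φ δ x ≡ nothing → m φ δ s ≡ nothing →
      Path φ (Via φ ρ) Any k q → F∌ φ q → m φ θ q ≡ nothing → ⊥
    start-branch-r (suc N) {φ} {θ} {v} {x} {ρ} {δ} {k} {q} (s≤s k≤N) cl θr Pv v∉F ρv x∉F x≢r δx δs t q∉F θq
      with same? ρ θ
    ... | inj₁ refl = start-edge cl θr Pv v∉F x∉F x≢r δx δs ρv
    ... | inj₂ ρ≢θ with same? v q
    ...   | inj₁ refl = star cl θr Pv v∉F θq (inj₁ refl)
    ...   | inj₂ v≢q with first-hit t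
    ...     | inj₁ ρq =
      let (ψ , R) = recolour φ ρq θr θq
          open Recoloured R
          open Shifted (Cls.state cl) θr q∉F R
          δ≢θ = held≢θ (Cls.state cl) θr (s , root∈ , δs)
      in start-edge (cls-shift cl θr q∉F R) old-x (P-shift cl θr q∉F θq R Pv) (v∉F ∘ fan⊃) (x∉F ∘ fan⊃) x≢r
           (keeps δ≢θ δx) (keeps δ≢θ δs) (trans (far ρ (P≢r cl Pv) v≢q) ρv)
    ...     | inj₂ (j , p , c , j<k , t′ , cp , cq , _) =
      let (ψ , R) = recolour φ cq θr θq
          open Recoloured R
          open Shifted (Cls.state cl) θr q∉F R
          δ≢θ = held≢θ (Cls.state cl) θr (s , root∈ , δs)
      in start-branch-r N (ℕ.<-≤-trans j<k k≤N) (cls-shift cl θr q∉F R) old-x (P-shift cl θr q∉F θq R Pv)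
           (v∉F ∘ fan⊃) (trans (far ρ (P≢r cl Pv) v≢q) ρv) (x∉F ∘ fan⊃) x≢r (keeps δ≢θ δx) (keeps δ≢θ δs)
           (path-shift ρ≢θ t′) (λ Fp → q∉F (reach-arc (fan⊃ Fp) cp cq))
           (trans (far c (source≢r {φ} cp cq) (avoiding-≢ t′)) cp)

    start-branch : ∀ {φ θ v x ρ δ k q c} → Cls φ → m φ θ r ≡ nothing → P° φ v → F∌ φ v →
      m φ ρ v ≡ just x → F∌ φ x → x ≢ r → m φ δ x ≡ nothing → m φ δ s ≡ nothing →
      Path φ (Via φ ρ) Any k q → (Q φ q → ⊥) → m φ c q ≡ nothing → c ≡ θ ⊎ QHeld φ c → c ≢ δ → c ≢ ρ → ⊥
    start-branch cl θr Pv v∉F ρv x∉F x≢r δx δs t q∉Q cq (inj₁ refl) _ _ =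
      start-branch-r _ ℕ.≤-refl cl θr (P°⊂P Pv) v∉F ρv x∉F x≢r δx δs t (q∉Q ∘ fan⊂Q) cq
    start-branch {φ} {θ} {v} {x} {ρ} {δ} {k} {q} {c} cl θr Pv v∉F ρv x∉F x≢r δx δs t q∉Q cq (inj₂ (p , Qp , cp)) c≢δ c≢ρ =
      q-chain cl θr (p , Qp , cp) (inj₂ cq) q∉Q (via≢r (Cls.state cl) ncs θr x∉F x≢r δx (s , root∈ , δs) t) λ T W Tq _ →
        let open Away (QAway.away W)
            δ≢θ = held≢θ (Cls.state cl) θr (s , root∈ , δs)
        in start-branch-r _ ℕ.≤-refl (cls-away cl (QAway.away W)) (r-same θr) (P-away cl θr (QAway.away W) Pv) (v∉F ∘ fan⊃)
             (other (λ { refl → start-edge cl θr (P°⊂P Pv) v∉F x∉F x≢r δx δs ρv }) (λ e → c≢ρ (≡sym e)) ρv)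
             (x∉F ∘ fan⊃) x≢r (other δ≢θ (λ e → c≢δ (≡sym e)) δx) (fan-keep root∈ δs)
             (path-map r-same (λ t _ a b o → other (λ { refl → just≢nothing b θr })
               (λ { refl → o (reach-arc Qp cp b) }) a , r-same b , tt) (q-path-outside t q∉Q))
             (q∉Q ∘ fan⊂Q ∘ fan⊃) (in-θ Tq cq)

-- Branches opened by edges from start vertices

module Branches {n : ℕ} (G : Graph n) (D : ℕ) (r : Fin n) (no-total : ∀ φ → Centre.Total G D r φ → ⊥)
  (NC : Fin n → Set)
  (missing : ∀ {s φ v} → Centre.State G D r s φ → NC v → Fan.Missing G D r no-total φ v)
  (two : ∀ {s φ} → Centre.State G D r s φ → NC s → Fan.Two G D r no-total φ s)
  (s : Fin n) (ncs : NC s) (big : Fin n → Bool) (α β : Fin D) (leaf : Fin n)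
  (S : Robust.Starts G D r no-total NC missing two s ncs big α β leaf)
  where

  open Matchings G D
  open Centre G D r
  open Fan G D r no-total
  open FanPool G D r no-total NC missing two using (Via; via≢r)
  open Robust G D r no-total NC missing two s ncs big α β leaf
  open Starts S
  open System S

  record Kept (φ ψ : Col) : Set where
    field
      cls : Cls ψ
      r-same : ∀ c → m ψ c r ≡ m φ c r
      fan⊃ : ∀ {v} → InF s ψ v → InF s φ v
      P°⊂ : ∀ {v} → P° φ v → P° ψ v
      P°⊃ : ∀ {v} → P° ψ v → P° φ v
      Q-keep : ∀ {v c} → Q φ v → m φ c v ≡ nothing → m ψ c v ≡ nothing
      Q-keep⁻ : ∀ {v c} → Q φ v → m ψ c v ≡ nothing → m φ c v ≡ nothing

    Q⊂ : ∀ {v} → Q φ v → Q ψ v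
    Q⊂ (k , t) = k , path-map [ inj₁ , inj₂ ∘ P°⊂ ]′
      (λ {k} t _ a b o → Q-keep (k , t) a , trans (r-same _) b , o) t

    Q⊃ : ∀ {v} → Q ψ v → Q φ v
    Q⊃ (_ , t) = path-invariant (Q φ) (λ p → reach-here {φ} {P⁺° φ} ([ inj₁ , inj₂ ∘ P°⊃ ]′ p))
      (λ Qq a b _ → reach-arc Qq (Q-keep⁻ Qq a) (trans (≡sym (r-same _)) b)) t

  kept-trans : ∀ {φ ψ χ} → Kept φ ψ → Kept ψ χ → Kept φ χ
  kept-trans A B = record
    { cls = cls B ; r-same = λ c → trans (r-same B c) (r-same A c) ; fan⊃ = fan⊃ A ∘ fan⊃ B
    ; P°⊂ = P°⊂ B ∘ P°⊂ A ; P°⊃ = P°⊃ A ∘ P°⊃ B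
    ; Q-keep = λ Qv h → Q-keep B (Q⊂ A Qv) (Q-keep A Qv h)
    ; Q-keep⁻ = λ Qv h → Q-keep⁻ A Qv (Q-keep⁻ B (Q⊂ A Qv) h) }
    where open Kept

  kept-away : ∀ {φ a b T} → Cls φ → (W : QAway φ a b T) →
    (∀ {v} → (P° φ v → P° (Away.ψ (QAway.away W)) v) × (P° (Away.ψ (QAway.away W)) v → P° φ v)) →
    Kept φ (Away.ψ (QAway.away W))
  kept-away cl W p = record
    { cls = cls-away cl away ; r-same = λ _ → r-same refl ; fan⊃ = fan⊃ ; P°⊂ = proj₁ p ; P°⊃ = proj₂ p
    ; Q-keep = λ Qv → keep (Q∉ Qv) ; Q-keep⁻ = λ Qv → keep⁻ (Q∉ Qv) }
    where
    open QAway W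
    open Away away

  data Gained (φ : Col) (γ : C) (x : V) (ψ : Col) : Misses φ α γ x → Set where
    gain-γ : ∀ {h} → m ψ γ x ≡ nothing → Gained φ γ x ψ (inj₁ h)
    gain-α : ∀ {h} → m ψ α x ≡ nothing → Gained φ γ x ψ (inj₂ h)

  gained-γ : ∀ {φ γ x ψ h} → Gained φ γ x ψ (inj₁ h) → m ψ γ x ≡ nothing
  gained-γ (gain-γ h) = h

  gained-α : ∀ {φ γ x ψ h} → Gained φ γ x ψ (inj₂ h) → m ψ α x ≡ nothing
  gained-α (gain-α h) = h

  record Pivoted (φ ψ : Col) (θ γ : C) (x : V) (mx : Misses φ α γ x) : Set where
    field
      kept : Kept φ ψ
      other : ∀ {c v w} → c ≢ θ → c ≢ α → c ≢ γ → m φ c v ≡ w → m ψ c v ≡ w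
      gained : Gained φ γ x ψ mx

  ∉Q : ∀ {φ θ y x γ} → Cls φ → m φ θ r ≡ nothing → P° φ y → m φ γ y ≡ nothing → F∌ φ x → x ≢ y →
    Misses φ α γ x → Q φ x → ⊥
  ∉Q cl θr Py γy x∉F x≢y (inj₁ h) Qx = elementary cl θr Qx root∈Q h (Cls.αs cl) (λ { refl → x∉F root∈ })
  ∉Q cl θr Py γy x∉F x≢y (inj₂ h) Qx = elementary cl θr Qx (start∈Q Py) h γy x≢y

  -- The purpose is to trade α and γ at `x` while `Q` stays fixed. For a flat γ this takes two
  -- changes, both involving θ. Otherwise the α,γ-chain of `x` is swapped directly: in `Q` only `s`
  -- misses α and only `y` misses γ, and `route` keeps the chain away from both.
  pivot : ∀ {φ θ y x γ} → Cls φ → m φ θ r ≡ nothing → P° φ y → F∌ φ y → m φ γ y ≡ nothing →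
    F∌ φ x → x ≢ r → x ≢ y → (mx : Misses φ α γ x) → (∀ ψ → Pivoted φ ψ θ γ x mx → ⊥) → ⊥
  pivot {φ} {θ} {y} {x} {γ} cl θr Py y∉F γy x∉F x≢r x≢y mx k =
    by-cases (Flat φ γ) (λ fl → via-θ fl mx k) (λ nf → route cl θr Py y∉F γy x∉F x≢r x≢y mx nf (via-α mx k))
    where
    open Cls cl
    x∉Q = ∉Q cl θr Py γy x∉F x≢y mx
    via-α : (mx : Misses φ α γ x) → (∀ ψ → Pivoted φ ψ θ γ x mx → ⊥) →
      ∀ T → Away s φ α γ T → T x ≡ true → T s ≡ false → T y ≡ false → ⊥
    via-α mx k T W Tx Ts Ty = k _ record
      { kept = kept-away cl record { away = W ; Q∉ = Q∉ } (λ {v} → P°-away W Ts)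
      ; other = λ _ a b h → Away.other W a b h ; gained = gain mx }
      where
      Q∉ : ∀ {v} → Q φ v → Misses φ α γ v → T v ≡ false
      Q∉ {v} Qv (inj₁ h) with v ≟ s
      ... | yes refl = Ts
      ... | no ne = ⊥-elim (elementary cl θr Qv root∈Q h αs ne)
      Q∉ {v} Qv (inj₂ h) with v ≟ y
      ... | yes refl = Ty
      ... | no ne = ⊥-elim (elementary cl θr Qv (start∈Q Py) h γy ne)
      gain : ∀ mx → Gained φ γ x (Away.ψ W) mx
      gain (inj₁ h) = gain-γ (Away.in-γ W Tx h)
      gain (inj₂ h) = gain-α (Away.in-θ W Tx h)
    via-θ : Flat φ γ → (mx : Misses φ α γ x) → (∀ ψ → Pivoted φ ψ θ γ x mx → ⊥) → ⊥
    via-θ fl (inj₁ αx) k = q-chain cl θr (s , root∈Q , αs) (inj₂ αx) x∉Q x≢r λ T W Tx _ →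
      let open Away (QAway.away W)
          K = kept-away cl W (λ {v} → P°-away (QAway.away W) (QAway.Q∉ W root∈Q (inj₂ αs)))
          cl₁ = cls-away cl (QAway.away W)
          θr₁ = r-same θr
      in q-chain cl₁ θr₁ (y , start∈Q (Kept.P°⊂ K Py) , Kept.Q-keep K (start∈Q Py) γy)
           (inj₁ (in-θ Tx αx)) (x∉Q ∘ Kept.Q⊃ K) x≢r λ T₂ W₂ T₂x _ →
           k _ record
             { kept = kept-trans K (kept-away cl₁ W₂ (flat-away cl₁ θr₁ (flat-r (Kept.r-same K) fl) (QAway.away W₂)))
             ; other = λ a b c h → Away.other (QAway.away W₂) a c (other a b h)
             ; gained = gain-γ (Away.in-γ (QAway.away W₂) T₂x (in-θ Tx αx)) }
    via-θ fl (inj₂ γx) k = q-chain cl θr (y , start∈Q Py , γy) (inj₂ γx) x∉Q x≢r λ T W Tx _ →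
      let open Away (QAway.away W)
          K = kept-away cl W (flat-away cl θr fl (QAway.away W))
          cl₁ = cls-away cl (QAway.away W)
          θr₁ = r-same θr
      in q-chain cl₁ θr₁ (s , root∈Q , Cls.αs cl₁)
           (inj₁ (in-θ Tx γx)) (x∉Q ∘ Kept.Q⊃ K) x≢r λ T₂ W₂ T₂x _ →
           k _ record
             { kept = kept-trans K (kept-away cl₁ W₂
                 (λ {v} → P°-away (QAway.away W₂) (QAway.Q∉ W₂ root∈Q (inj₂ (Cls.αs cl₁)))))
             ; other = λ a b c h → Away.other (QAway.away W₂) a b (other a c h)
             ; gained = gain-α (Away.in-γ (QAway.away W₂) T₂x (in-θ Tx γx)) }

  QWild : Col → C → C → Set
  QWild φ θ c = c ≡ θ ⊎ QHeld φ c

  Edge : Col → V → V → C → Set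
  Edge φ x y ρ = P° φ y × F∌ φ y × m φ ρ y ≡ just x

  q-outside : ∀ {φ} {P′ : V → Set} {k q} → Path φ P′ Any k q → (Q φ q → ⊥) →
    Path φ (λ z → P′ z × ¬ Q φ z) (λ t _ z → ¬ Q φ t × ¬ Q φ z) k q
  q-outside (here p) q∉Q = here (p , q∉Q)
  q-outside {φ} (arc t a b _) q∉Q = arc (q-outside t p∉Q) a b (p∉Q , q∉Q)
    where p∉Q = λ Qp → q∉Q (reach-arc {φ} Qp a b)

  -- The arc of a start vertex y along one of its missing colours γ is replaced by an arc along the colour
  -- ρ of an edge yx.
  record Stepped (φ χ : Col) (θ : C) (x y : V) (γ ρ : C) : Set where
    field
      cls : Cls χ
      r-same : ∀ c → m χ c r ≡ m φ c r
      fan⊃ : ∀ {v} → InF s χ v → InF s φ v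
      P°⊂ : ∀ {v} → P° φ v → P° χ v
      P°⊃ : ∀ {v} → P° χ v → P° φ v
      γy : m φ γ y ≡ nothing
      new-y : m χ ρ y ≡ nothing
      new-x : m χ ρ x ≡ nothing
      other : ∀ {c v w} → c ≢ θ → c ≢ α → c ≢ γ → c ≢ ρ → m φ c v ≡ w → m χ c v ≡ w
      keep : ∀ {c v} → c ≢ θ → c ≢ α → c ≢ γ → m φ c v ≡ nothing → m χ c v ≡ nothing
      Q-keep : ∀ {v c} → Q φ v → (v ≢ y ⊎ c ≢ γ) → m φ c v ≡ nothing → m χ c v ≡ nothing
      Q-keep⁻ : ∀ {v c} → Q φ v → m χ c v ≡ nothing → m φ c v ≡ nothing ⊎ c ≡ ρ

  module Base {φ θ x} (cl : Cls φ) (θr : m φ θ r ≡ nothing) (x∉F : F∌ φ x) (x≢r : x ≢ r) (αx : m φ α x ≡ nothing) where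

    open Cls cl using () renaming (state to st; αs to α-s; βs to β-s)

    α≢θ : α ≢ θ
    α≢θ = held≢θ st θr (s , root∈ , α-s)

    x∉Q : Q φ x → ⊥
    x∉Q Qx = elementary cl θr Qx root∈Q αx α-s (λ { refl → x∉F root∈ })

    edge≢θ : ∀ {y ρ} → Edge φ x y ρ → ρ ≢ θ
    edge≢θ (Py , y∉F , ρy) refl = start-edge cl θr (P°⊂P Py) y∉F x∉F x≢r αx α-s ρy

    edge≢α : ∀ {y ρ} → Edge φ x y ρ → ρ ≢ α
    edge≢α (_ , _ , ρy) refl = just≢nothing (inv φ ρy) αx

    x≢y : ∀ {y ρ} → Edge φ x y ρ → x ≢ y
    x≢y (_ , _ , ρy) refl = adj-irrefl (edge φ ρy) refl

    step : ∀ {y ρ} → Edge φ x y ρ → (∀ χ γ → Stepped φ χ θ x y γ ρ → ⊥) → ⊥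
    step {y} {ρ} e@(Py , y∉F , ρy) k =
      let (γ , γy) = missing st (P-nc (P°⊂P Py)) in
      pivot cl θr Py y∉F γy x∉F x≢r (x≢y e) (inj₁ αx) λ ψ Π →
        let open Pivoted Π
            open Kept kept renaming (fan⊃ to fan⊃ψ; r-same to rψ; Q-keep to keepψ; Q-keep⁻ to keepψ⁻; P°⊂ to P°⊂ψ; P°⊃ to P°⊃ψ)
            ρ≢γ : ρ ≢ γ
            ρ≢γ = λ { refl → just≢nothing ρy γy }
            (χ , R) = recolour ψ (other (edge≢θ e) (edge≢α e) ρ≢γ ρy) (keepψ (start∈Q Py) γy) (gained-γ gained)
            open Recoloured R renaming (other to otherχ)
            open Outside R (y∉F ∘ fan⊃ψ) (x∉F ∘ fan⊃ψ) (P≢r cl (P°⊂P Py)) x≢r renaming (fan⊃ to fan⊃χ)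
        in k χ γ record
          { cls = cls′ cls
          ; r-same = λ c → trans r-far (rψ c)
          ; fan⊃ = fan⊃ψ ∘ fan⊃χ
          ; P°⊂ = P°-far (λ _ → r-far) (λ _ → fan-far root∈) ∘ P°⊂ψ
          ; P°⊃ = P°⊃ψ ∘ P°-far (λ _ → ≡sym r-far) (λ _ → ≡sym (fan-far root∈))
          ; γy = γy ; new-y = old-x ; new-x = old-y
          ; other = λ {_} {v} a b c d h → trans (otherχ v d c) (other a b c h)
          ; keep = λ a b c h → keeps c (other a b c h)
          ; Q-keep = λ { {v} {c} Qv o h → qkeep R (x∉Q) Qv o (keepψ Qv h) }
          ; Q-keep⁻ = λ { {v} {c} Qv h → [ inj₁ ∘ keepψ⁻ Qv , inj₂ ]′ (qkeep⁻ R x∉Q Qv h) } }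
      where
      qkeep : ∀ {ψ χ γ v c} → Recoloured ψ χ y x ρ γ → (Q φ x → ⊥) → Q φ v → (v ≢ y ⊎ c ≢ γ) →
        m ψ c v ≡ nothing → m χ c v ≡ nothing
      qkeep {γ = γ} {v} {c} R x∉Q Qv o h with same? c γ
      ... | inj₂ c≢γ = Recoloured.keeps R c≢γ h
      qkeep R x∉Q Qv (inj₂ c≢γ) h | inj₁ refl = ⊥-elim (c≢γ refl)
      qkeep R x∉Q Qv (inj₁ v≢y) h | inj₁ refl = trans (Recoloured.far R _ v≢y (λ { refl → x∉Q Qv })) h
      qkeep⁻ : ∀ {ψ χ γ v c} → Recoloured ψ χ y x ρ γ → (Q φ x → ⊥) → Q φ v →
        m χ c v ≡ nothing → m ψ c v ≡ nothing ⊎ c ≡ ρ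
      qkeep⁻ {γ = γ} {v} {c} R x∉Q Qv h with same? c ρ
      ... | inj₁ e = inj₂ e
      ... | inj₂ c≢ρ with same? v y
      ...   | inj₂ v≢y = inj₁ (trans (≡sym (Recoloured.far R _ v≢y (λ { refl → x∉Q Qv }))) h)
      ...   | inj₁ refl with same? c γ
      ...     | inj₁ refl = ⊥-elim (just≢nothing (Recoloured.new-x R) h)
      ...     | inj₂ c≢γ = inj₁ (trans (≡sym (Recoloured.other R v c≢ρ c≢γ)) h)

    -- After the step, `x` and `y` both miss ρ. A second pivot, along ρ, gives `x` its colour α
    -- back, so that further steps can follow.
    full-step : ∀ {y ρ} → Edge φ x y ρ →
      (∀ χ γ → Stepped φ χ θ x y γ ρ → ∀ ψ → Kept χ ψ → m ψ α x ≡ nothing →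
        (∀ {c v w} → c ≢ θ → c ≢ α → c ≢ ρ → m χ c v ≡ w → m ψ c v ≡ w) → ⊥) → ⊥
    full-step e@(Py , y∉F , ρy) k = step e λ χ γ E →
      let open Stepped E in
      pivot cls (trans (r-same θ) θr) (P°⊂ Py) (y∉F ∘ fan⊃) new-y (x∉F ∘ fan⊃) x≢r (x≢y e) (inj₂ new-x) λ ψ Π →
        k χ γ E ψ (Pivoted.kept Π) (gained-α (Pivoted.gained Π)) (Pivoted.other Π)

    module _ {χ y γ ρ} (e : Edge φ x y ρ) (E : Stepped φ χ θ x y γ ρ) where

      open Stepped E

      qwild-γ : QWild φ θ γ
      qwild-γ = inj₂ (y , start∈Q (proj₁ e) , γy)

      keep-tame : ∀ {c v} → (QWild φ θ c → ⊥) → m φ c v ≡ nothing → m χ c v ≡ nothing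
      keep-tame nw = keep (nw ∘ inj₁) (λ { refl → nw (inj₂ (s , root∈Q , α-s)) }) (λ { refl → nw qwild-γ })

      outer-colour : ∀ {c z} → ¬ Q φ z → m φ c r ≡ just z → QWild φ θ c → ⊥
      outer-colour z∉Q b (inj₁ refl) = just≢nothing b θr
      outer-colour z∉Q b (inj₂ (p , Qp , h)) = z∉Q (reach-arc Qp h b)

      branch-path : ∀ {k q} → Path φ (Via φ ρ) Any k q → (Q φ q → ⊥) →
        Path χ (λ w → w ≡ y) (λ t _ _ → t ≡ y ⊎ ¬ Q φ t) (suc k) q
      branch-path t q∉Q = go (q-outside t q∉Q)
        where
        go : ∀ {k q} → Path φ (λ z → Via φ ρ z × ¬ Q φ z) (λ t _ z → ¬ Q φ t × ¬ Q φ z) k q →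
          Path χ (λ w → w ≡ y) (λ t _ _ → t ≡ y ⊎ ¬ Q φ t) (suc k) q
        go (here (v , z∉Q)) = arc (here refl) new-y (trans (r-same _) v) (inj₁ refl)
        go (arc t a b (p∉Q , z∉Q)) = arc (go t) (keep-tame (outer-colour z∉Q b) a) (trans (r-same _) b) (inj₂ p∉Q)

      branch∈ : ∀ {k q} → Path φ (Via φ ρ) Any k q → (Q φ q → ⊥) → Q χ q
      branch∈ t q∉Q = _ , path-map (λ { refl → inj₂ (P°⊂ (proj₁ e)) }) (λ _ _ a b _ → a , b , tt) (branch-path t q∉Q)

    branch-avoids-x : ∀ {y ρ k} → Edge φ x y ρ → Path φ (Via φ ρ) Any k x → ⊥
    branch-avoids-x e t = step e λ χ γ E →
      let open Stepped E in
      elementary cls (trans (r-same θ) θr) (branch∈ e E t x∉Q) (start∈Q (P°⊂ (proj₁ e))) new-x new-y (x≢y e)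

    ∉start : ∀ {y ρ q} → Edge φ x y ρ → (Q φ q → ⊥) → q ≢ y
    ∉start (Py , _) q∉Q refl = q∉Q (start∈Q Py)

    -- Without this condition a colour could be counted twice, once as missing in `Q` and once as
    -- the colour of an edge to `x`.
    Tame : Set
    Tame = ∀ {y ρ} → Edge φ x y ρ → QHeld φ ρ → ⊥

  module Tamed {φ θ x} (cl : Cls φ) (θr : m φ θ r ≡ nothing) (x∉F : F∌ φ x) (x≢r : x ≢ r) (αx : m φ α x ≡ nothing)
    (tame : Base.Tame cl θr x∉F x≢r αx) where

    open Base cl θr x∉F x≢r αx
    open Cls cl using () renaming (αs to α-s; βs to β-s)

    not-qwild : ∀ {y ρ} → Edge φ x y ρ → QWild φ θ ρ → ⊥
    not-qwild e (inj₁ h) = edge≢θ e h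
    not-qwild e (inj₂ h) = tame e h

    other-edge : ∀ {χ y y′ γ ρ ρ′} → Edge φ x y ρ → (E : Stepped φ χ θ x y γ ρ) → Edge φ x y′ ρ′ → ρ′ ≢ ρ →
      ∀ {ψ} → (K : Kept χ ψ) → (∀ {c v w} → c ≢ θ → c ≢ α → c ≢ ρ → m χ c v ≡ w → m ψ c v ≡ w) → Edge ψ x y′ ρ′
    other-edge e E e′@(Py′ , y′∉F , ρ′y′) ne K o =
      Kept.P°⊂ K (Stepped.P°⊂ E Py′) , y′∉F ∘ Stepped.fan⊃ E ∘ Kept.fan⊃ K
      , o (edge≢θ e′) (edge≢α e′) ne (Stepped.other E (edge≢θ e′) (edge≢α e′)
          (λ { refl → not-qwild e′ (qwild-γ e E) }) ne ρ′y′)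

    -- If the colours differ, a full step along `v′x` is followed by a step along `vx`. The path to
    -- `q` has as sources only `v′` and vertices outside the old `Q`; so `v` is not among them, and
    -- the colour given up at `v` does not break it. In the end `q` and `v` share ρ within `Q`.
    branch-edge : ∀ {v v′ ρ ρ′ k q} → Edge φ x v ρ → Edge φ x v′ ρ′ → Path φ (Via φ ρ′) Any k q → (Q φ q → ⊥) →
      m φ ρ q ≡ nothing → ⊥
    branch-edge {v} {v′} {ρ} {ρ′} {k} {q} e e′ t q∉Q ρq with same? ρ ρ′
    ... | inj₁ refl = step e′ λ χ γ E →
      let open Stepped E in
      elementary cls (trans (r-same θ) θr) (branch∈ e′ E t q∉Q) (start∈Q (P°⊂ (proj₁ e′)))
        (keep-tame e′ E (not-qwild e) ρq) new-y (∉start e′ q∉Q)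
    ... | inj₂ ne = full-step e′ λ χ γ E ψ K αx′ o → later E K o αx′
      where
      later : ∀ {χ γ ψ} → Stepped φ χ θ x v′ γ ρ′ → (K : Kept χ ψ) →
        (∀ {c w z} → c ≢ θ → c ≢ α → c ≢ ρ′ → m χ c w ≡ z → m ψ c w ≡ z) → m ψ α x ≡ nothing → ⊥
      later {χ} {γ} {ψ} E K o αx′ = Base.step (Kept.cls K) θψ (x∉F ∘ Stepped.fan⊃ E ∘ Kept.fan⊃ K) x≢r αx′ eψ λ χ₂ γ₂ E₂ →
        let open Stepped E₂
            path₂ : Q χ₂ q
            path₂ = _ , path-map (λ { refl → inj₂ (P°⊂ (Kept.P°⊂ K (Stepped.P°⊂ E (proj₁ e′)))) })
              (λ { t _ a b o′ → Q-keep (Qψ t) (inj₁ (≢v o′)) a , trans (r-same _) b , tt }) tψ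
        in elementary cls (trans (r-same θ) θψ) path₂ (start∈Q (P°⊂ (proj₁ eψ)))
             (Q-keep (Qψ tψ) (inj₁ (∉start e q∉Q)) ρqψ) new-y (∉start e q∉Q)
        where
        θψ : m ψ θ r ≡ nothing
        θψ = trans (Kept.r-same K θ) (trans (Stepped.r-same E θ) θr)
        eψ : Edge ψ x v ρ
        eψ = other-edge e′ E e ne K o
        ρqψ : m ψ ρ q ≡ nothing
        ρqψ = o (edge≢θ e) (edge≢α e) ne (keep-tame e′ E (not-qwild e) ρq)
        Ok : V → C → V → Set
        Ok = λ p _ _ → p ≡ v′ ⊎ ¬ Q φ p
        Qχ : ∀ {j p} → Path χ (λ w → w ≡ v′) Ok j p → Q χ p
        Qχ t = _ , path-map (λ { refl → inj₂ (Stepped.P°⊂ E (proj₁ e′)) }) (λ _ _ a b _ → a , b , tt) t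
        tψ : Path ψ (λ w → w ≡ v′) Ok (suc k) q
        tψ = path-map id (λ t _ a b o′ → Kept.Q-keep K (Qχ t) a , trans (Kept.r-same K _) b , o′) (branch-path e′ E t q∉Q)
        Qψ : ∀ {j p} → Path ψ (λ w → w ≡ v′) Ok j p → Q ψ p
        Qψ t = _ , path-map (λ { refl → inj₂ (Kept.P°⊂ K (Stepped.P°⊂ E (proj₁ e′))) }) (λ _ _ a b _ → a , b , tt) t
        ≢v : ∀ {p} → p ≡ v′ ⊎ ¬ Q φ p → p ≢ v
        ≢v (inj₁ refl) refl = ne (uniq φ (proj₂ (proj₂ e)) (proj₂ (proj₂ e′)))
        ≢v (inj₂ h) refl = h (start∈Q (proj₁ e))

    -- A full step along `vx` brings `q` into `Q`. If ρ′ is another colour, the branch of `q′`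
    -- survives it, because by `branch-edge` no source on that branch misses ρ.
    branches-disjoint : ∀ {v v′ ρ ρ′ k k′ q q′ c} → Edge φ x v ρ → Edge φ x v′ ρ′ →
      Path φ (Via φ ρ) Any k q → (Q φ q → ⊥) → Path φ (Via φ ρ′) Any k′ q′ → (Q φ q′ → ⊥) →
      m φ c q ≡ nothing → m φ c q′ ≡ nothing → (QWild φ θ c → ⊥) → q ≢ q′ → ⊥
    branches-disjoint {v} {v′} {ρ} {ρ′} {k} {k′} {q} {q′} {c} e e′ t q∉Q t′ q′∉Q cq cq′ nw q≢q′ with same? ρ ρ′
    ... | inj₁ refl = step e λ χ γ E →
      let open Stepped E in
      elementary cls (trans (r-same θ) θr) (branch∈ e E t q∉Q) (branch∈ e E t′ q′∉Q)
        (keep-tame e E nw cq) (keep-tame e E nw cq′) q≢q′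
    ... | inj₂ ne = full-step e λ χ γ E ψ K αx′ o → later E K o αx′
      where
      c≢α : c ≢ α
      c≢α refl = nw (inj₂ (s , root∈Q , α-s))
      c≢ρ : c ≢ ρ
      c≢ρ refl = branch-edge e e t q∉Q cq
      c≢ρ′ : c ≢ ρ′
      c≢ρ′ refl = branch-edge e′ e′ t′ q′∉Q cq′
      later : ∀ {χ γ ψ} → Stepped φ χ θ x v γ ρ → (K : Kept χ ψ) →
        (∀ {c w z} → c ≢ θ → c ≢ α → c ≢ ρ → m χ c w ≡ z → m ψ c w ≡ z) → m ψ α x ≡ nothing → ⊥
      later {χ} {γ} {ψ} E K o αx′ = by-cases (Q ψ q′)
          (λ Qq′ → elementary clψ θψ Qq Qq′ cqψ (keepψ nw c≢ρ cq′) q≢q′)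
          (λ q′∉ → let (Pv , v∉F , ρv) = other-edge e E e′ (ne ∘ ≡sym) K o in
            start-branch clψ θψ Pv v∉F ρv (x∉F ∘ Stepped.fan⊃ E ∘ Kept.fan⊃ K) x≢r αx′ (Cls.αs clψ)
              tψ q′∉ (keepψ nw c≢ρ cq′) (inj₂ (q , Qq , cqψ)) c≢α c≢ρ′)
        where
        clψ = Kept.cls K
        rψ : ∀ {d w} → m φ d r ≡ w → m ψ d r ≡ w
        rψ {d} h = trans (Kept.r-same K d) (trans (Stepped.r-same E d) h)
        θψ = rψ θr
        keepψ : ∀ {d w} → (QWild φ θ d → ⊥) → d ≢ ρ → m φ d w ≡ nothing → m ψ d w ≡ nothing
        keepψ nw d≢ρ h = o (nw ∘ inj₁) (λ { refl → nw (inj₂ (s , root∈Q , α-s)) }) d≢ρ (keep-tame e E nw h)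
        Qq : Q ψ q
        Qq = Kept.Q⊂ K (branch∈ e E t q∉Q)
        cqψ = keepψ nw c≢ρ cq
        tψ : Path ψ (Via ψ ρ′) Any k′ q′
        tψ = path-map (rψ ∘ proj₁) (λ { t _ a b (p∉Q , z∉Q) → keepψ (outer-colour e E z∉Q b)
          (λ { refl → branch-edge e e′ (path-map proj₁ (λ _ _ a b _ → a , b , tt) t) p∉Q a }) a , rψ b , tt })
          (q-outside t′ q′∉Q)

    branch-disjoint : ∀ {y ρ k q c} → Edge φ x y ρ → Path φ (Via φ ρ) Any k q → (Q φ q → ⊥) →
      m φ c q ≡ nothing → QWild φ θ c → c ≢ α → ⊥
    branch-disjoint e@(Py , y∉F , ρy) t q∉Q cq w c≢α =
      start-branch cl θr Py y∉F ρy x∉F x≢r αx α-s t q∉Q cq w c≢α (λ { refl → not-qwild e w })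

    partner-unique : α ≢ β → ∀ {v v′ ρ ρ′ k k′ q q′} → Edge φ x v ρ → Edge φ x v′ ρ′ →
      Path φ (Via φ ρ) Any k q → (Q φ q → ⊥) → Path φ (Via φ ρ′) Any k′ q′ → (Q φ q′ → ⊥) →
      m φ α q ≡ nothing → m φ α q′ ≡ nothing → q ≢ q′ → ⊥
    partner-unique α≢β {q = q} {q′} e e′ t q∉Q t′ q′∉Q αq αq′ q≢q′ =
      q-chain cl θr (s , root∈Q , α-s) (inj₂ αx) x∉Q x≢r λ T W Tx ends →
        by-cases (T q ≡ true)
          (λ Tq → by-cases (T q′ ≡ true)
            (λ Tq′ → q≢q′ (ends Tq (λ { refl → branch-avoids-x e t }) (inj₂ αq)
                             Tq′ (λ { refl → branch-avoids-x e′ t′ }) (inj₂ αq′)))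
            (λ h → off W Tx e′ t′ q′∉Q αq′ (not-true h)))
          (λ h → off W Tx e t q∉Q αq (not-true h))
      where
      off : ∀ {T} → QAway φ θ α T → T x ≡ true → ∀ {y ρ k q} → Edge φ x y ρ → Path φ (Via φ ρ) Any k q →
        (Q φ q → ⊥) → m φ α q ≡ nothing → T q ≡ false → ⊥
      off {T} W Tx {y} {ρ} {k} {q} e@(Py , y∉F , ρy) t q∉Q αq Tq =
        q-chain cl₁ θr₁ (s , root∈Q , Cls.βs cl₁) (inj₁ (in-θ Tx αx)) (x∉Q ∘ Kept.Q⊃ K) x≢r λ T₂ W₂ T₂x _ →
          let module A₂ = Away (QAway.away W₂)
              K₂ = kept-away cl₁ W₂ (λ {v} → P°-away (QAway.away W₂) (QAway.Q∉ W₂ root∈Q (inj₂ (Cls.βs cl₁))))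
              c₂ : ∀ {d w u} → (QWild φ θ d → ⊥) → m φ d w ≡ u → m A₂.ψ d w ≡ u
              c₂ = λ nw h → A₂.other (nw ∘ inj₁) (λ { refl → nw (inj₂ (s , root∈Q , β-s)) })
                     (other (nw ∘ inj₁) (λ { refl → nw (inj₂ (s , root∈Q , α-s)) }) h)
          in start-branch (Kept.cls K₂) (A₂.r-same θr₁) (Kept.P°⊂ K₂ (Kept.P°⊂ K Py)) (y∉F ∘ fan⊃ ∘ A₂.fan⊃)
               (c₂ (not-qwild e) ρy) (x∉F ∘ fan⊃ ∘ A₂.fan⊃) x≢r (A₂.in-γ T₂x (in-θ Tx αx)) (Cls.βs (Kept.cls K₂))
               (path-map (λ h → A₂.r-same (r-same (proj₁ h))) (λ { _ _ a b (_ , z∉Q) →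
                 c₂ (outer z∉Q b) a , A₂.r-same (r-same b) , tt }) (q-outside t q∉Q))
               (q∉Q ∘ Kept.Q⊃ K ∘ Kept.Q⊃ K₂) (A₂.other α≢θ α≢β (out Tq αq))
               (inj₂ (s , root∈Q , Cls.αs (Kept.cls K₂))) α≢β (λ { refl → edge≢α e refl })
        where
        open Away (QAway.away W)
        cl₁ = cls-away cl (QAway.away W)
        θr₁ = r-same θr
        K = kept-away cl W (λ {v} → P°-away (QAway.away W) (QAway.Q∉ W root∈Q (inj₂ α-s)))
        outer : ∀ {c z} → ¬ Q φ z → m φ c r ≡ just z → QWild φ θ c → ⊥
        outer z∉Q b (inj₁ refl) = just≢nothing b θr
        outer z∉Q b (inj₂ (p , Qp , h)) = z∉Q (reach-arc Qp h b)

  -- A colouring that is not tame allows a step after which Q has become smaller.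
  tame-exists : ∀ {x} (x≢r : x ≢ r) → (∀ {φ θ} (cl : Cls φ) (θr : m φ θ r ≡ nothing) (x∉F : F∌ φ x) (αx : m φ α x ≡ nothing) →
      Base.Tame cl θr x∉F x≢r αx → ⊥) →
    ∀ N {φ θ} → Cls φ → m φ θ r ≡ nothing → F∌ φ x → m φ α x ≡ nothing →
    (T : V → Bool) → (∀ {v} → Q φ v → T v ≡ true) → ∑ (λ v → ⟦ T v ⟧) < N → ⊥
  tame-exists {x} x≢r k (suc N) {φ} {θ} cl θr x∉F αx T Q⊂T (s≤s size) = k cl θr x∉F αx tame
    where
    open Base cl θr x∉F x≢r αx
    tame : Tame
    tame {y} {ρ} e@(Py , y∉F , ρy) (q , Qq , ρq) = full-step e λ χ γ E ψ K αx′ _ →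
      by-cases (Q ψ q)
        (λ Qψ → elementary (Stepped.cls E) (trans (Stepped.r-same E θ) θr) (Kept.Q⊃ K Qψ)
          (start∈Q (Stepped.P°⊂ E Py)) (Stepped.Q-keep E Qq (inj₁ q≢y) ρq) (Stepped.new-y E) q≢y)
        (λ q∉ → tame-exists x≢r k N (Kept.cls K) (trans (Kept.r-same K θ) (trans (Stepped.r-same E θ) θr))
          (x∉F ∘ Stepped.fan⊃ E ∘ Kept.fan⊃ K) αx′ T′
          (λ {v} Qv → ∧-intro (Q⊂T (smaller E (Kept.Q⊃ K Qv))) (cong not (not-true λ h → q∉ (subst (Q ψ) (==-true h) Qv))))
          (ℕ.<-≤-trans less size))
      where
      q≢y : q ≢ y
      q≢y refl = just≢nothing ρy ρq
      T′ : V → Bool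
      T′ v = T v ∧ not (v == q)
      smaller : ∀ {χ γ} → Stepped φ χ θ x y γ ρ → ∀ {v} → Q χ v → Q φ v
      smaller {χ} E (_ , t) = path-invariant (Q φ) (λ p → reach-here {φ} {P⁺° φ} ([ inj₁ , inj₂ ∘ Stepped.P°⊃ E ]′ p)) go t
        where
        go : ∀ {p c z} → Q φ p → m χ c p ≡ nothing → m χ c r ≡ just z → ⊤ → Q φ z
        go {c = c} Qp a b _ with Stepped.Q-keep⁻ E {c = c} Qp a
        ... | inj₁ a′ = reach-arc Qp a′ (trans (≡sym (Stepped.r-same E _)) b)
        -- The only kind of arc that is new has colour ρ, and its target is also that of the old arc
        -- of `q` along ρ.
        ... | inj₂ refl = reach-arc Qq ρq (trans (≡sym (Stepped.r-same E _)) b)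
      less : ∑ (λ v → ⟦ T′ v ⟧) < ∑ (λ v → ⟦ T v ⟧)
      less = ℕ.≤-trans (ℕ.≤-reflexive (trans (ℕ.+-comm 1 _) (trans (cong (∑ (λ v → ⟦ T′ v ⟧) +_) (≡sym (∑-δ q)))
               (≡sym (∑-+ (λ v → ⟦ T′ v ⟧) (λ v → ⟦ v == q ⟧)))))) (∑-mono pointwise)
        where
        pointwise : ∀ v → ⟦ T′ v ⟧ + ⟦ v == q ⟧ ≤ ⟦ T v ⟧
        pointwise v with v ≟ q
        ... | yes refl = ℕ.≤-reflexive (trans (cong (λ b → ⟦ b ⟧ + 1) (B.∧-zeroʳ (T v))) (≡sym (⟦⟧-true (Q⊂T Qq))))
        ... | no _ = ℕ.≤-reflexive (trans (ℕ.+-identityʳ _) (cong ⟦_⟧ (B.∧-identityʳ (T v))))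

-- The two sets of start vertices

module StartSets {n : ℕ} (G : Graph n) (D : ℕ) (r : Fin n) (no-total : ∀ φ → Centre.Total G D r φ → ⊥)
  (NC : Fin n → Set)
  (missing : ∀ {s φ v} → Centre.State G D r s φ → NC v → Fan.Missing G D r no-total φ v)
  (two : ∀ {s φ} → Centre.State G D r s φ → NC s → Fan.Two G D r no-total φ s)
  (non-core : ∀ {s φ v} → Centre.State G D r s φ → NC s → Fan.Missing G D r no-total φ v → v ≢ r → NC v)
  (r-unique : ∀ {s φ θ η} → Centre.State G D r s φ → Matchings.m φ θ r ≡ nothing → Matchings.m φ η r ≡ nothing → θ ≡ η)
  (s : Fin n) (ncs : NC s) (big : Fin n → Bool) (α β : Fin D) (leaf : Fin n) (leaf-core : NC leaf → ⊥)
  where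

  open Matchings G D
  open Centre G D r
  open Fan G D r no-total
  open Robust G D r no-total NC missing two s ncs big α β leaf

  module AllNeighbours (star-all : ∀ {φ θ y c} → Cls φ → m φ θ r ≡ nothing → NC y × adj G r y ≡ true → F∌ φ y →
    m φ c y ≡ nothing → Wild s φ θ c → ⊥) where

    starts : Starts
    starts = record
      { P = λ _ y → NC y × adj G r y ≡ true
      ; P° = λ _ y → NC y × adj G r y ≡ true
      ; P°⊂P = id
      ; P-nc = proj₁
      ; P≢r = λ _ p e → adj-irrefl (proj₂ p) (≡sym e)
      ; star = star-all
      ; P-shift = λ _ _ _ _ _ → id
      ; P-away = λ _ _ _ → id
      ; P-up = λ _ _ _ _ → id
      ; P°-away = λ _ _ → id , id
      ; P°-far = λ _ _ → id
      ; P-far = λ _ _ → id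
      ; Flat = λ _ _ → ⊤
      ; flat-r = λ _ _ → tt
      ; flat-away = λ _ _ _ _ → id , id
      ; route = λ _ _ _ _ _ _ _ _ _ nf _ → nf tt }

  -- The start vertices are the neighbours y of s for which r has no core neighbour along the colour of sy.
  module RootNeighbours (s⋆ : V) (nc⋆ : NC s⋆) (big⋆ : big s⋆ ≡ true)
    (maximal : ∀ {s′ φ θ x} → State s′ φ → NC s′ → m φ θ r ≡ nothing → x ≢ r → m φ θ x ≡ nothing → InF s′ φ s⋆ →
      (S : V → Bool) → (∀ {v} → S v ≡ true → InF s′ φ v) → ∑ (λ v → ⟦ big v ⟧) < ∑ (λ v → ⟦ S v ⟧) → ⊥) where

    Larger : Col → Set
    Larger ψ = ∃ λ (S : V → Bool) → (∀ {v} → S v ≡ true → InF s ψ v) × InF s ψ s⋆ ×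
      ∑ (λ v → ⟦ big v ⟧) < ∑ (λ v → ⟦ S v ⟧)

    -- When `s` trades α for γ, only `leaf` can drop out, since no arc leaves a core vertex. New are
    -- `z` and the target `z′` of an arc from `z`: if `z′` were an old fan vertex other than `leaf`,
    -- some vertex still in the fan would share a missing colour with `z`.
    larger : ∀ {φ ψ θ γ z} → Cls φ → State s ψ → m φ θ r ≡ nothing → (Wild s φ θ γ → ⊥) → m φ γ r ≡ just z → NC z →
      (∀ c → m ψ c r ≡ m φ c r) → (∀ {p c} → InF s φ p → c ≢ α → m φ c p ≡ nothing → m ψ c p ≡ nothing) →
      m ψ γ s ≡ nothing → Larger ψ
    larger {φ} {ψ} {θ} {γ} {z} cl st θr nwγ γr ncz r-same keep γs = S , S⊂ , old⊂ (big⊂ big⋆) (λ { refl → leaf-core nc⋆ }) , grown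
      where
      open Cls cl
      θψ = trans (r-same θ) θr
      z∈ : InF s ψ z
      z∈ = reach-arc root∈ γs (trans (r-same γ) γr)
      z∉ : InF s φ z → ⊥
      z∉ Fz = nwγ (inj₂ (fan-colour state Fz γr))
      ≢leaf : ∀ {p c} → InF s φ p → m φ c p ≡ nothing → p ≢ leaf
      ≢leaf Fp h refl = leaf-core (non-core state ncs (_ , h) (fan≢r state Fp))
      ≢α : ∀ {c v} → v ≢ leaf → m φ c r ≡ just v → c ≢ α
      ≢α v≢ h refl = v≢ (just-injective (trans (≡sym h) αr))
      old⊂ : ∀ {v} → InF s φ v → v ≢ leaf → InF s ψ v
      old⊂ (_ , t₀) = go t₀
        where
        go : ∀ {k v} → Path φ (λ w → w ≡ s) Any k v → v ≢ leaf → InF s ψ v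
        go (here refl) _ = root∈
        go (arc {k} {q} {c} t a b _) v≢ = reach-arc (go t (≢leaf (k , t) a)) (keep (k , t) (≢α v≢ b) a) (trans (r-same c) b)
      c′ = proj₁ (missing st ncz)
      c′z : m ψ c′ z ≡ nothing
      c′z = proj₂ (missing st ncz)
      next : ∃ λ z′ → m ψ c′ r ≡ just z′
      next with just-or-nothing (m ψ c′ r)
      ... | inj₁ h = h
      ... | inj₂ h = ⊥-elim (fan-disjoint-r s st h z∈ c′z)
      z′ = proj₁ next
      z′r : m ψ c′ r ≡ just z′
      z′r = proj₂ next
      z′∈ : InF s ψ z′
      z′∈ = reach-arc z∈ c′z z′r
      z≢z′ : z ≢ z′
      z≢z′ e = just≢nothing (inv ψ (trans z′r (cong just (≡sym e)))) c′z
      z′-new : z′ ≢ leaf → big z′ ≡ true → ⊥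
      z′-new z′≢ bz′ =
        let z′φ = trans (≡sym (r-same c′)) z′r
            (p , Fp , h) = fan-colour state (big⊂ bz′) z′φ
        in fan-elementary s st θψ (old⊂ Fp (≢leaf Fp h)) z∈ (keep Fp (≢α z′≢ z′φ) h) c′z (λ e → z∉ (subst (InF s φ) e Fp))
      S : V → Bool
      S = replace big leaf z z′
      S⊂ : ∀ {v} → S v ≡ true → InF s ψ v
      S⊂ {v} h with ∨-elim {big v ∧ not (v == leaf)} h
      ... | inj₁ h₁ = old⊂ (big⊂ (∧-true₁ h₁)) (λ e → true≢false (==-refl e) (not-false (∧-true₂ {big v} h₁)))
        where
        not-false : ∀ {b} → not b ≡ true → b ≡ false
        not-false {false} _ = refl
      ... | inj₂ h₁ with ∨-elim {v == z} h₁
      ...   | inj₁ e = subst (InF s ψ) (≡sym (==-true e)) z∈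
      ...   | inj₂ e = subst (InF s ψ) (≡sym (==-true e)) z′∈
      grown : ∑ (λ v → ⟦ big v ⟧) < ∑ (λ v → ⟦ S v ⟧)
      grown = ∑-replace big leaf z z′ (z∉ ∘ big⊂) (λ e → leaf-core (subst NC e ncz)) z≢z′ z′-new

    no-conflict : ∀ {ψ ψ′ θ x} → Larger ψ → (∀ {v} → InF s ψ v → InF s ψ′ v) → State s ψ′ → m ψ′ θ r ≡ nothing →
      x ≢ r → m ψ′ θ x ≡ nothing → ⊥
    no-conflict (S , S⊂ , F⋆ , lt) fan⊂ st θr x≢r θx = maximal st ncs θr x≢r θx (fan⊂ F⋆) S (fan⊂ ∘ S⊂) lt

    no-wild : ∀ {ψ θ x c} → Larger ψ → State s ψ → m ψ θ r ≡ nothing → x ≢ r → (InF s ψ x → ⊥) →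
      m ψ c x ≡ nothing → Wild s ψ θ c → ⊥
    no-wild L st θr x≢r x∉ h (inj₁ refl) = no-conflict L id st θr x≢r h
    no-wild L st θr x≢r x∉ h (inj₂ Hc) = wild-chain st θr Hc (inj₂ h) x∉ x≢r λ T W Tx _ →
      no-conflict L (Away.fan⊂ W) (Away.state′ W) (Away.r-same W θr) x≢r (Away.in-θ W Tx h)

    N₁ : V → Set
    N₁ y = NC y × adj G r y ≡ true

    -- A change of θ with γ may turn the colour γ of `sy` into θ, along which `r` has no neighbour
    -- at all. `P` tolerates this and `P°` does not, so `P°` before a change yields only `P` after
    -- it.
    P P° : Col → V → Set
    P φ y = N₁ y × ∃ λ τ → m φ τ s ≡ just y × (∀ z → m φ τ r ≡ just z → NC z)
    P° φ y = N₁ y × ∃ λ τ → ∃ λ z → m φ τ s ≡ just y × m φ τ r ≡ just z × NC z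

    P°⊂P : ∀ {φ y} → P° φ y → P φ y
    P°⊂P (n , τ , z , a , b , c) = n , τ , a , λ z′ h → subst NC (just-injective (trans (≡sym b) h)) c

    N₁≢r : ∀ {y} → N₁ y → y ≢ r
    N₁≢r p e = adj-irrefl (proj₂ p) (≡sym e)

    -- An exchange on `sy` makes `s` and `y` both miss τ. If τ leads from `r` to a non-core vertex,
    -- this enlarges the fan while `y` is still wild, against maximality; if `r` misses τ, the edge
    -- `sy` has colour θ, which is excluded for a wild `y`.
    star : ∀ {φ θ y c} → Cls φ → m φ θ r ≡ nothing → P φ y → F∌ φ y → m φ c y ≡ nothing → Wild s φ θ c → ⊥
    star {φ} {θ} {y} {c} cl θr (n₁ , τ , τs , ncτ) y∉F cy wc with just-or-nothing (m φ τ r)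
    ... | inj₂ h = wild-root-edge (Cls.state cl) (two (Cls.state cl) ncs) θr y∉F (N₁≢r n₁) cy wc τs
                     (inj₁ (r-unique (Cls.state cl) h θr))
    ... | inj₁ (z , τr) = exchange state θr αs y∉F (N₁≢r n₁) cy wc τs (nwτ ∘ inj₁) λ χ E →
      let open Exchange E renaming (state to stχ)
          L = larger cl stχ θr nwτ τr (ncτ z τr) (λ c → r-same refl) fan-keep new-s
      in no-wild L stχ (r-same θr) (N₁≢r n₁)
           (λ Fy → fan-elementary s stχ (r-same θr) Fy root∈ new-x new-s (λ { refl → y∉F root∈ })) new-x
           (inj₂ (s , root∈ , new-s))
      where
      open Cls cl
      nwτ : Wild s φ θ τ → ⊥
      nwτ = wild-root-edge state (two state ncs) θr y∉F (N₁≢r n₁) cy wc τs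

    Flat : Col → C → Set
    Flat φ γ = ∃ λ z → m φ γ r ≡ just z × (NC z → ⊥)

    -- The α,γ-chain of `s` contains `r`, or swapping it would enlarge the fan and leave a wild
    -- vertex. It also contains `y`, or `y` could be made to miss α, which `s` misses. So its ends
    -- are `s` and `y`, and the chain of `x` avoids `s`, `y` and `r`.
    route : ∀ {φ θ y x γ} → Cls φ → m φ θ r ≡ nothing → P° φ y → F∌ φ y → m φ γ y ≡ nothing →
      F∌ φ x → x ≢ r → x ≢ y → Misses φ α γ x → (Flat φ γ → ⊥) →
      (∀ T → Away s φ α γ T → T x ≡ true → T s ≡ false → T y ≡ false → ⊥) → ⊥
    route {φ} {θ} {y} {x} {γ} cl θr Py y∉F γy x∉F x≢r x≢y mx nf k with just-or-nothing (m φ γ r)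
    ... | inj₂ h = star cl θr (P°⊂P {φ} Py) y∉F γy (inj₁ (r-unique (Cls.state cl) h θr))
    ... | inj₁ (z , γr) = by-cases (NC z) (λ ncz → chain φ α γ s (inj₁ αs) λ Ks → through ncz Ks) (λ h → nf (z , γr , h))
      where
      open Cls cl
      nwγ : Wild s φ θ γ → ⊥
      nwγ = star cl θr (P°⊂P {φ} Py) y∉F γy
      y≢r : y ≢ r
      y≢r = N₁≢r (proj₁ Py)
      y≢s : y ≢ s
      y≢s refl = y∉F root∈
      x≢s : x ≢ s
      x≢s refl = x∉F root∈
      away-from-s : ∀ {T} → Closed φ α γ T → T r ≡ false → T s ≡ false → Away s φ α γ T
      away-from-s c Tr Ts = record { state = state ; closed = c ; r∉ = Tr ; fan∉ = λ
        { {v} Fv (inj₁ h) → case v ≟ s of λ { (yes refl) → Ts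
            ; (no ne) → ⊥-elim (fan-elementary s state θr Fv root∈ h αs ne) }
        ; Fv (inj₂ h) → ⊥-elim (nwγ (inj₂ (_ , Fv , h))) } }
      module _ (ncz : NC z) (Ks : Chain φ α γ s) where
        open Chain Ks
        not-off-r : T r ≡ false → ⊥
        not-off-r Tr = [ (λ Ty → y-in Ty (not-true λ Tx → x≢y (ends Tx Ty x≢s y≢s mx (inj₂ γy))))
                       , (λ Ty → γ-wild y≢r (λ { refl → y∉F root∈ }) (sw-out Ty γy)) ]′ (true-or-false (T y))
          where
          ψ : Col
          ψ = swap φ α γ T closed
          stψ : State s ψ
          stψ = state-swap closed state
          sw-out : ∀ {v c w} → T v ≡ false → m φ c v ≡ w → m ψ c v ≡ w
          sw-out {c = c} Tv h = trans (swap-out φ α γ T c Tv) h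
          θψ : m ψ θ r ≡ nothing
          θψ = sw-out Tr θr
          γs : m ψ γ s ≡ nothing
          γs = trans (swap-in φ α γ T γ origin) (trans (cong (λ d → m φ d s) (transp-b α γ)) αs)
          L : Larger ψ
          L = larger cl stψ θr nwγ γr ncz (λ c → sw-out Tr refl)
            (λ Fp c≢α h → trans (swap-other φ α γ T _ c≢α (λ { refl → nwγ (inj₂ (_ , Fp , h)) })) h) γs
          γ-wild : ∀ {v} → v ≢ r → v ≢ s → m ψ γ v ≡ nothing → ⊥
          γ-wild v≢r v≢s h = no-wild L stψ θψ v≢r (λ Fv → fan-elementary s stψ θψ Fv root∈ h γs v≢s) h
            (inj₂ (s , root∈ , γs))
          -- If α is held, one of `x` and `y` is outside the fan and hence wild. If not, the
          -- θ,α-chains of `x` and `y` cannot both end at `r`, and a change on one that avoids `r`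
          -- gives a second vertex missing θ.
          two-α : m ψ α x ≡ nothing → m ψ α y ≡ nothing → ⊥
          two-α αx αy =
            by-cases (Held s ψ α)
              (λ Hα → by-cases (InF s ψ x)
                (λ Fx → no-wild L stψ θψ y≢r (λ Fy → fan-elementary s stψ θψ Fx Fy αx αy x≢y) αy (inj₂ Hα))
                (λ x∉ → no-wild L stψ θψ x≢r x∉ αx (inj₂ Hα)))
              (λ ¬H → chain ψ θ α x (inj₂ αx) λ Kx → chain ψ θ α y (inj₂ αy) λ Ky →
                by-cases (Chain.T Kx r ≡ true)
                  (λ rx → by-cases (Chain.T Ky r ≡ true)
                    (λ ry → y≢r (Chain.ends Kx (Chain.least Ky (Chain.closed Kx) ry rx) rx
                      (λ e → x≢y (≡sym e)) (λ e → x≢r (≡sym e)) (inj₂ αy) (inj₁ θψ)))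
                    (λ h → off ¬H Ky y≢r αy (not-true h)))
                  (λ h → off ¬H Kx x≢r αx (not-true h)))
            where
            off : (Held s ψ α → ⊥) → ∀ {v} (K : Chain ψ θ α v) → v ≢ r → m ψ α v ≡ nothing → Chain.T K r ≡ false → ⊥
            off ¬H K v≢r αv Kr = no-conflict L (Away.fan⊂ W) (Away.state′ W) (Away.r-same W θψ) v≢r
                (Away.in-θ W (Chain.origin K) αv)
              where
              W : Away s ψ θ α (Chain.T K)
              W = record { state = stψ ; closed = Chain.closed K ; r∉ = Kr ; fan∉ = λ
                { Fv (inj₁ h) → ⊥-elim (fan-disjoint-r s stψ θψ Fv h)
                ; Fv (inj₂ h) → ⊥-elim (¬H (_ , Fv , h)) } }
          y-in : T y ≡ true → T x ≡ false → ⊥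
          y-in Ty Tx = [ (λ αx → two-α (sw-out Tx αx)
                            (trans (swap-in φ α γ T α Ty) (trans (cong (λ d → m φ d y) (transp-a α γ)) γy)))
                       , (λ γx → γ-wild x≢r x≢s (sw-out Tx γx)) ]′ mx

        P°-swap : ∀ {T′} (W : Away s φ α γ T′) → T′ s ≡ false → P° φ y → P° (Away.ψ W) y
        P°-swap W Ts (n₁ , τ , w , a , b , c) = n₁ , τ , w , Away.out W Ts a , Away.r-same W b , c

        through : ⊥
        through = by-cases (T r ≡ true)
          (λ Tr → by-cases (T y ≡ true)
            (λ Ty → chain φ α γ x mx λ Kx →
              let x∉ : T x ≡ true → ⊥
                  x∉ Tx = x≢y (ends Tx Ty x≢s y≢s mx (inj₂ γy))
                  off : ∀ {v} → T v ≡ true → Chain.T Kx v ≡ false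
                  off Tv = not-true λ h → x∉ (Chain.least Kx closed h Tv)
              in k (Chain.T Kx) (away-from-s (Chain.closed Kx) (off Tr) (off origin)) (Chain.origin Kx) (off origin) (off Ty))
            (λ h → chain φ α γ y (inj₂ γy) λ Ky →
              let off : ∀ {v} → T v ≡ true → Chain.T Ky v ≡ false
                  off Tv = not-true λ g → h (Chain.least Ky closed g Tv)
                  W = away-from-s (Chain.closed Ky) (off Tr) (off origin)
              in star (cls-away cl W) (Away.r-same W θr) (P°⊂P {Away.ψ W} (P°-swap W (off origin) Py)) (y∉F ∘ Away.fan⊃ W)
                   (Away.in-θ W (Chain.origin Ky) γy) (inj₂ (s , root∈ , Away.fan-keep W root∈ αs))))
          (λ h → not-off-r (not-true h))

    starts : Starts
    starts = record
      { P = P ; P° = P° ; P°⊂P = λ {φ} {y} → P°⊂P {φ} {y}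
      ; P-nc = proj₁ ∘ proj₁
      ; P≢r = λ _ p → N₁≢r (proj₁ p)
      ; star = star
      ; P-shift = P-shift
      ; P-away = P-away
      ; P-up = P-up
      ; P°-away = λ { W Ts →
          (λ { (n₁ , τ , z , a , b , c) → n₁ , τ , z , Away.out W Ts a , Away.r-same W b , c })
          , (λ { (n₁ , τ , z , a , b , c) → n₁ , τ , z , trans (≡sym (Away.out W Ts refl)) a , Away.r-same⁻ W b , c }) }
      ; P°-far = λ { f g (n₁ , τ , z , a , b , c) → n₁ , τ , z , trans (g τ) a , trans (f τ) b , c }
      ; P-far = λ { f g (n₁ , τ , a , b) → n₁ , τ , trans (g τ) a , λ z h → b z (trans (≡sym (f τ)) h) }
      ; Flat = Flat
      ; flat-r = λ { f (z , a , b) → z , trans (f _) a , b }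
      ; flat-away = flat-away
      ; route = route }
      where
      P-shift : ∀ {φ ψ q c θ y} → Cls φ → m φ θ r ≡ nothing → F∌ φ q → m φ θ q ≡ nothing →
        Recoloured φ ψ r q c θ → P φ y → P ψ y
      P-shift {φ} {ψ} {q} {c} cl θr q∉F θq R (n₁ , τ , a , b) = n₁ , τ , trans (fan-same root∈) a , λ z h → nc z (r-back h)
        where
        open Shifted (Cls.state cl) θr q∉F R
        nc : ∀ z → (z ≡ q × τ ≡ _) ⊎ m φ τ r ≡ just z → NC z
        nc z (inj₁ (refl , _)) = non-core (Cls.state cl) ncs (_ , θq)
          (λ e → adj-irrefl (edge φ (Recoloured.was R)) (≡sym e))
        nc z (inj₂ h) = b z h
      P-away : ∀ {φ θ γ T y} → Cls φ → m φ θ r ≡ nothing → (W : Away s φ θ γ T) → P° φ y → P (Away.ψ W) y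
      P-away {φ} {θ} {γ} {T} cl θr W (n₁ , τ , z , a , b , c) with same? τ γ | true-or-false (T s)
      ... | inj₁ refl | inj₁ Ts = n₁ , θ , Away.in-θ W Ts a , λ z′ h → ⊥-elim (just≢nothing h (Away.r-same W θr))
      ... | inj₁ refl | inj₂ Ts = P°⊂P {Away.ψ W} (n₁ , τ , z , Away.out W Ts a , Away.r-same W b , c)
      ... | inj₂ ne | _ = P°⊂P {Away.ψ W} (n₁ , τ , z , Away.other W (λ { refl → just≢nothing b θr }) ne a , Away.r-same W b , c)
      P-up : ∀ {φ θ y x} → Cls φ → m φ θ r ≡ nothing → m φ θ y ≡ just x → F∌ φ x → P φ y → P° φ y
      P-up {φ} cl θr θy x∉F (n₁ , τ , a , b) with just-or-nothing (m φ τ r)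
      ... | inj₁ (z , h) = n₁ , τ , z , a , h , b z h
      ... | inj₂ h with r-unique (Cls.state cl) h θr
      ...   | refl = ⊥-elim (x∉F (subst (InF s φ) (just-injective (trans (≡sym (inv φ a)) θy)) root∈))
      flat-away : ∀ {φ θ γ T y} → Cls φ → m φ θ r ≡ nothing → Flat φ γ → (W : Away s φ θ γ T) →
        (P° φ y → P° (Away.ψ W) y) × (P° (Away.ψ W) y → P° φ y)
      flat-away {φ} {θ} {γ} cl θr (w , γr , core) W =
        (λ { (n₁ , τ , z , a , b , c) → n₁ , τ , z , Away.other W (≢θ b) (≢γ b c) a , Away.r-same W b , c })
        , (λ { (n₁ , τ , z , a , b , c) → let b′ = Away.r-same⁻ W b in
                n₁ , τ , z , trans (≡sym (Away.other W (≢θ b′) (≢γ b′ c) refl)) a , b′ , c })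
        where
        ≢θ : ∀ {τ z} → m φ τ r ≡ just z → τ ≢ θ
        ≢θ b refl = just≢nothing b θr
        ≢γ : ∀ {τ z} → m φ τ r ≡ just z → NC z → τ ≢ γ
        ≢γ b c refl = core (subst NC (just-injective (trans (≡sym b) γr)) c)

-- Degrees, missing colours and the central count

∑-two : ∀ {n} (p : Fin n → Bool) → 2 ≤ ∑ (λ i → ⟦ p i ⟧) → ∃ λ i → ∃ λ j → i ≢ j × p i ≡ true × p j ≡ true
∑-two {suc n} p h with p zero in e
... | false = let (i , j , ne , a , b) = ∑-two (p ∘ suc) h in suc i , suc j , ne ∘ F.suc-injective , a , b
... | true = let (j , b) = ∑-find (p ∘ suc) (ℕ.≤-pred h) in zero , suc j , (λ ()) , e , b

∑-pair : ∀ {n} (p : Fin n → Bool) {i j} → i ≢ j → p i ≡ true → p j ≡ true → 2 ≤ ∑ (λ i → ⟦ p i ⟧)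
∑-pair p {i} {j} i≢j pi pj = ℕ.≤-trans
  (ℕ.≤-reflexive (≡sym (trans (∑-+ (λ k → ⟦ k == i ⟧) (λ k → ⟦ k == j ⟧)) (cong₂ _+_ (∑-δ i) (∑-δ j)))))
  (∑-mono pointwise)
  where
  pointwise : ∀ k → ⟦ k == i ⟧ + ⟦ k == j ⟧ ≤ ⟦ p k ⟧
  pointwise k with k ≟ i | k ≟ j
  ... | yes refl | yes e = ⊥-elim (i≢j e)
  ... | yes refl | no _ = ℕ.≤-reflexive (≡sym (⟦⟧-true pi))
  ... | no _ | yes refl = ℕ.≤-reflexive (≡sym (⟦⟧-true pj))
  ... | no _ | no _ = z≤n

-- A partial injection c ↦ t c covers each vertex at most once.
∑-image : ∀ {n k} (t : Fin k → Maybe (Fin n)) → (∀ {c d w} → t c ≡ just w → t d ≡ just w → c ≡ d) →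
  (p q : Fin n → Bool) → (∀ {c w} → t c ≡ just w → p w ≡ true → q w ≡ true) →
  ∑ (λ c → ∑ (λ w → ⟦ is-just (t c) w ∧ p w ⟧)) ≤ ∑ (λ w → ⟦ q w ⟧)
∑-image t inj p q h = ℕ.≤-trans (ℕ.≤-reflexive (∑-swap (λ c w → ⟦ is-just (t c) w ∧ p w ⟧))) (∑-mono column)
  where
  column : ∀ w → ∑ (λ c → ⟦ is-just (t c) w ∧ p w ⟧) ≤ ⟦ q w ⟧
  column w with q w in e
  ... | true = ∑-unique (λ c → is-just (t c) w ∧ p w) (λ c d a b → inj (is-just-true (∧-true₁ a)) (is-just-true (∧-true₁ b)))
  ... | false = ℕ.≤-reflexive (∑-none (λ c → is-just (t c) w ∧ p w) (λ c a →
                  true≢false (h (is-just-true (∧-true₁ a)) (∧-true₂ {is-just (t c) w} a)) e))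

module Degrees {n : ℕ} (G : Graph n) (D : ℕ) (r : Fin n) where

  open Matchings G D
  open Centre G D r

  d : V → ℕ
  d v = ∑ (λ w → ⟦ adj G v w ⟧)

  μ : Col → V → ℕ
  μ φ v = ∑ (λ c → ⟦ is-nothing (m φ c v) ⟧)

  -- A colour is either missing at `v` or colours exactly one edge there; the correction accounts
  -- for the uncoloured edge `rs`.
  degree-μ : ∀ {s φ} → State s φ → ∀ v → μ φ v + d v ≡ D + (⟦ v == r ⟧ + ⟦ v == s ⟧)
  degree-μ {s} {φ} st v = begin
    μ φ v + d v ≡⟨ cong (μ φ v +_) (trans (∑-cong column) (∑-+ (λ w → ∑ (λ c → ⟦ is-just (m φ c v) w ⟧)) (λ w → ⟦ e w ⟧))) ⟩
    μ φ v + (∑ (λ w → ∑ (λ c → ⟦ is-just (m φ c v) w ⟧)) + ∑ (λ w → ⟦ e w ⟧))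
      ≡⟨ ≡sym (ℕ.+-assoc (μ φ v) _ _) ⟩
    μ φ v + ∑ (λ w → ∑ (λ c → ⟦ is-just (m φ c v) w ⟧)) + ∑ (λ w → ⟦ e w ⟧)
      ≡⟨ cong₂ _+_ all-colours ends ⟩
    D + (⟦ v == r ⟧ + ⟦ v == s ⟧) ∎
    where
    open ≡-Reasoning
    e : V → Bool
    e w = ((v == r) ∧ (w == s)) ∨ ((v == s) ∧ (w == r))
    r≢s = adj-irrefl (rs st)
    row : ∀ c → ⟦ is-nothing (m φ c v) ⟧ + ∑ (λ w → ⟦ is-just (m φ c v) w ⟧) ≡ 1
    row c with m φ c v
    ... | nothing = cong suc (∑-zero {n} (λ _ → refl))
    ... | just z = trans (∑-cong (λ w → cong ⟦_⟧ (flip w))) (∑-δ z)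
      where
      flip : ∀ w → (z == w) ≡ (w == z)
      flip w with z ≟ w | w ≟ z
      ... | yes _ | yes _ = refl
      ... | no _ | no _ = refl
      ... | yes p | no q = ⊥-elim (q (≡sym p))
      ... | no p | yes q = ⊥-elim (p (≡sym q))
    all-colours : μ φ v + ∑ (λ w → ∑ (λ c → ⟦ is-just (m φ c v) w ⟧)) ≡ D
    all-colours = trans (cong (μ φ v +_) (∑-swap (λ w c → ⟦ is-just (m φ c v) w ⟧)))
      (trans (≡sym (∑-+ (λ c → ⟦ is-nothing (m φ c v) ⟧) (λ c → ∑ (λ w → ⟦ is-just (m φ c v) w ⟧))))
        (trans (∑-cong row) (trans (∑-const D 1) (ℕ.*-identityʳ D))))
    ends : ∑ (λ w → ⟦ e w ⟧) ≡ ⟦ v == r ⟧ + ⟦ v == s ⟧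
    ends with v ≟ r | v ≟ s
    ... | yes refl | yes refl = ⊥-elim (r≢s refl)
    ... | yes refl | no _ = trans (∑-cong (λ w → cong ⟦_⟧ (B.∨-identityʳ (w == s)))) (∑-δ s)
    ... | no _ | yes refl = ∑-δ r
    ... | no _ | no _ = ∑-zero {n} (λ _ → refl)
    e-ends : ∀ {w} → e w ≡ true → (v ≡ r × w ≡ s) ⊎ (v ≡ s × w ≡ r)
    e-ends {w} h with ∨-elim {(v == r) ∧ (w == s)} h
    ... | inj₁ h₁ = inj₁ (==-true (∧-true₁ h₁) , ==-true (∧-true₂ {v == r} h₁))
    ... | inj₂ h₁ = inj₂ (==-true (∧-true₁ h₁) , ==-true (∧-true₂ {v == s} h₁))
    e-intro : ∀ {w} → (v ≡ r × w ≡ s) ⊎ (v ≡ s × w ≡ r) → e w ≡ true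
    e-intro (inj₁ (a , b)) = ∨-intro₁ (∧-intro (==-refl a) (==-refl b))
    e-intro {w} (inj₂ (a , b)) = ∨-intro₂ {(v == r) ∧ (w == s)} (∧-intro (==-refl a) (==-refl b))
    e-adj : ∀ {w} → e w ≡ true → adj G v w ≡ true
    e-adj {w} h with e-ends {w} h
    ... | inj₁ (refl , refl) = rs st
    ... | inj₂ (refl , refl) = adj-sym (rs st)
    e-uncoloured : ∀ {w c} → e w ≡ true → m φ c v ≡ just w → ⊥
    e-uncoloured {w} h g with e-ends {w} h
    ... | inj₁ (refl , refl) = uncoloured st _ g
    ... | inj₂ (refl , refl) = uncoloured st _ (inv φ g)
    column : ∀ w → ⟦ adj G v w ⟧ ≡ ∑ (λ c → ⟦ is-just (m φ c v) w ⟧) + ⟦ e w ⟧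
    column w with true-or-false (adj G v w)
    ... | inj₂ na = trans (cong ⟦_⟧ na) (≡sym (cong₂ _+_
            (∑-none (λ c → is-just (m φ c v) w) (λ c h → true≢false (edge φ (is-just-true h)) na))
            (⟦⟧-false (λ h → true≢false (e-adj {w} h) na))))
    ... | inj₁ a with cover st a
    ...   | inj₁ (c , h) = trans (cong ⟦_⟧ a) (≡sym (cong₂ _+_
              (ℕ.≤-antisym (∑-unique (λ c → is-just (m φ c v) w) (λ c c′ p q → uniq φ (is-just-true p) (is-just-true q)))
                (∑-pos (λ c → is-just (m φ c v) w) c (is-just-intro h)))
              (⟦⟧-false (λ g → e-uncoloured {w} g h))))
    ...   | inj₂ o = trans (cong ⟦_⟧ a) (≡sym (cong₂ _+_
              (∑-none (λ c → is-just (m φ c v) w) (λ c h → e-uncoloured {w} (e-intro o) (is-just-true h))) (⟦⟧-true (e-intro {w} o))))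

  NC : V → Set
  NC v = d v < D

  core? : V → Bool
  core? v = does (D ℕ.≤? d v)

  core-elim : ∀ {v} → core? v ≡ true → NC v → ⊥
  core-elim {v} h nc = ℕ.<⇒≱ nc (ℕ.≤ᵇ⇒≤ D (d v) (subst IsTrue (≡sym h) tt))

  core-intro : ∀ {v} → (NC v → ⊥) → core? v ≡ true
  core-intro {v} h with core? v in e
  ... | true = refl
  ... | false = ⊥-elim (h (ℕ.≰⇒> λ le → subst IsTrue e (ℕ.≤⇒≤ᵇ le)))

  def : V → ℕ
  def v = D ∸ d v

  module _ {s φ} (st : State s φ) where

    μ≡ : ∀ {v} → v ≢ r → μ φ v + d v ≡ D + ⟦ v == s ⟧
    μ≡ {v} v≢r = trans (degree-μ st v) (cong (D +_) (cong (_+ ⟦ v == s ⟧) (⟦⟧-false (v≢r ∘ ==-true))))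

    nc-missing : ∀ {v} → NC v → ∃ λ c → m φ c v ≡ nothing
    nc-missing {v} nc = let (c , h) = ∑-find (λ c → is-nothing (m φ c v)) positive in c , is-nothing-true h
      where
      positive : 1 ≤ μ φ v
      positive = ℕ.+-cancelʳ-≤ (d v) 1 (μ φ v) (ℕ.≤-trans nc
        (ℕ.≤-trans (ℕ.m≤m+n D _) (ℕ.≤-reflexive (≡sym (degree-μ st v)))))

    root-two : NC s → ∃ λ a → ∃ λ b → a ≢ b × m φ a s ≡ nothing × m φ b s ≡ nothing
    root-two nc = let (a , b , ne , p , q) = ∑-two (λ c → is-nothing (m φ c s)) two in a , b , ne , is-nothing-true p , is-nothing-true q
      where
      two : 2 ≤ μ φ s
      two = ℕ.+-cancelʳ-≤ (d s) 2 (μ φ s) (ℕ.≤-trans (s≤s nc)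
        (ℕ.≤-trans (ℕ.≤-reflexive (trans (ℕ.+-comm 1 D) (cong (D +_) (≡sym (⟦⟧-true (==-refl {i = s} refl))))))
          (ℕ.≤-reflexive (≡sym (μ≡ (λ e → adj-irrefl (rs st) (≡sym e)))))))

    missing-nc : NC s → ∀ {v} → (∃ λ c → m φ c v ≡ nothing) → v ≢ r → NC v
    missing-nc ncs {v} (c , h) v≢r with v ≟ s
    ... | yes refl = ncs
    ... | no v≢s = ℕ.≤-trans (ℕ.+-monoˡ-≤ (d v) (∑-pos (λ c → is-nothing (m φ c v)) c (is-nothing-intro h)))
      (ℕ.≤-reflexive (trans (μ≡ v≢r) (trans (cong (D +_) (⟦⟧-false (v≢s ∘ ==-true))) (ℕ.+-identityʳ D))))

    r-missing : d r ≤ D → ∃ λ c → m φ c r ≡ nothing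
    r-missing le = let (c , h) = ∑-find (λ c → is-nothing (m φ c r)) positive in c , is-nothing-true h
      where
      positive : 1 ≤ μ φ r
      positive = ℕ.+-cancelʳ-≤ (d r) 1 (μ φ r) (ℕ.≤-trans (s≤s le) (ℕ.≤-trans
        (ℕ.≤-reflexive (trans (ℕ.+-comm 1 D) (cong (D +_) (≡sym (⟦⟧-true (==-refl {i = r} refl))))))
        (ℕ.≤-trans (ℕ.+-monoʳ-≤ D (ℕ.m≤m+n _ _)) (ℕ.≤-reflexive (≡sym (degree-μ st r))))))

    r-missing-unique : (NC r → ⊥) → ∀ {θ η} → m φ θ r ≡ nothing → m φ η r ≡ nothing → θ ≡ η
    r-missing-unique core {θ} {η} a b with θ ≟ η
    ... | yes e = e
    ... | no ne = ⊥-elim (core (ℕ.+-cancelˡ-≤ 1 _ _ (ℕ.≤-trans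
        (ℕ.+-monoˡ-≤ (d r) (∑-pair (λ c → is-nothing (m φ c r)) ne (is-nothing-intro a) (is-nothing-intro b)))
        (ℕ.≤-reflexive (trans (degree-μ st r) (trans (cong (D +_) (cong₂ _+_ (⟦⟧-true (==-refl {i = r} refl))
          (⟦⟧-false (adj-irrefl (rs st) ∘ ==-true)))) (ℕ.+-comm D 1)))))))

  -- What is needed to count: a set Q closed under arcs, with pairwise disjoint sets of missing colours,
  -- edges to a vertex x, and the branches that the colours of these edges would add to Q.
  record Pool (s : V) (φ : Col) (α : C) (x : V) (Q : V → Set) (E : V → C → Set) : Set where
    Branch : V → Set
    Branch q = ∃ λ y → ∃ λ ρ → E y ρ × ∃ λ k → Path φ (λ z → m φ ρ r ≡ just z) Any k q
    Held′ : C → Set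
    Held′ c = ∃ λ p → Q p × m φ c p ≡ nothing
    field
      state : State s φ
      αs : m φ α s ≡ nothing
      Q-root : Q s
      Q≢r : ∀ {q} → Q q → q ≢ r
      Q-core : ∀ {q} → Q q → (NC q → ⊥) → adj G r q ≡ true
      Q-arc : ∀ {q c z} → Q q → m φ c q ≡ nothing → m φ c r ≡ just z → Q z
      Q-present : ∀ {q c} → Q q → m φ c q ≡ nothing → m φ c r ≡ nothing → ⊥
      Q-elementary : ∀ {p q c} → Q p → Q q → m φ c p ≡ nothing → m φ c q ≡ nothing → p ≢ q → ⊥
      E-Q : ∀ {y ρ} → E y ρ → Q y
      E-edge : ∀ {y ρ} → E y ρ → m φ ρ y ≡ just x
      E-present : ∀ {y ρ} → E y ρ → m φ ρ r ≡ nothing → ⊥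
      E-tame : ∀ {y ρ} → E y ρ → Held′ ρ → ⊥
      x-α : ∀ {y ρ} → E y ρ → m φ α x ≡ nothing
      branch-present : ∀ {q c} → Branch q → (Q q → ⊥) → m φ c q ≡ nothing → m φ c r ≡ nothing → ⊥
      branch-held : ∀ {q c} → Branch q → (Q q → ⊥) → m φ c q ≡ nothing → Held′ c → c ≢ α → ⊥
      branch-edge : ∀ {q y ρ} → E y ρ → Branch q → (Q q → ⊥) → m φ ρ q ≡ nothing → ⊥
      branch-branch : ∀ {q q′ c} → Branch q → (Q q → ⊥) → Branch q′ → (Q q′ → ⊥) → m φ c q ≡ nothing → m φ c q′ ≡ nothing →
        (m φ c r ≡ nothing → ⊥) → (Held′ c → ⊥) → q ≢ q′ → ⊥
      branch-partner : ∀ {q q′} → Branch q → (Q q → ⊥) → Branch q′ → (Q q′ → ⊥) →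
        m φ α q ≡ nothing → m φ α q′ ≡ nothing → q ≢ q′ → ⊥

  record PoolBound (s : V) (x : V) (E : V → C → Set) (Q⁺ : V → Set) : Set where
    field
      A K : V → Bool
      A-E : ∀ {y ρ} → E y ρ → A y ≡ true
      K-Q : ∀ {v} → K v ≡ true → Q⁺ v
      bound : ∀ {t} → Q⁺ t → NC t → def t + ∑ (λ v → ⟦ A v ⟧) ≤ ∑ (λ v → ⟦ K v ∧ core? v ⟧)

  module Counting (degrees : ∀ v → d v ≤ D) {s φ α x Q E} (P : Pool s φ α x Q E) where

    open Pool P

    Q⁺ : V → Set
    Q⁺ v = Q v ⊎ Branch v

    module _ (K : V → Bool) (K→ : ∀ {v} → K v ≡ true → Q⁺ v) (→K : ∀ {v} → Q⁺ v → K v ≡ true)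
      (A : V → Bool) (A→ : ∀ {v} → A v ≡ true → ∃ λ ρ → E v ρ) (→A : ∀ {v} → (∃ λ ρ → E v ρ) → A v ≡ true) where

      hit : V → C → Bool
      hit v c = is-nothing (m φ c v) ∨ (A v ∧ is-just (m φ c v) x)

      Hits : V → C → Set
      Hits v c = Q⁺ v × (m φ c v ≡ nothing ⊎ E v c)

      hit-elim : ∀ {v c} → K v ∧ hit v c ≡ true → Hits v c
      hit-elim {v} {c} h = K→ (∧-true₁ h) , [ inj₁ ∘ is-nothing-true , inj₂ ∘ special ]′ (∨-elim (∧-true₂ {K v} h))
        where
        special : A v ∧ is-just (m φ c v) x ≡ true → E v c
        special g with A→ (∧-true₁ g)
        ... | ρ , e with uniq φ (E-edge e) (is-just-true (∧-true₂ {A v} g))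
        ...   | refl = e

      hits-present : ∀ {v c} → Hits v c → m φ c r ≡ nothing → ⊥
      hits-present (_ , inj₂ e) h = E-present e h
      hits-present (inj₁ Qv , inj₁ c∅) h = Q-present Qv c∅ h
      hits-present {v} (inj₂ Bv , inj₁ c∅) h = by-cases (Q v) (λ Qv → Q-present Qv c∅ h)
        (λ v∉Q → branch-present Bv v∉Q c∅ h)

      hits-target : ∀ {v c} → Hits v c → ∃ λ z → m φ c r ≡ just z × K z ≡ true
      hits-target {v} {c} h with just-or-nothing (m φ c r)
      ... | inj₂ n = ⊥-elim (hits-present h n)
      hits-target {v} (inj₁ Qv , inj₁ c∅) | inj₁ (z , e) = z , e , →K (inj₁ (Q-arc Qv c∅ e))
      hits-target {v} (inj₂ (y , ρ , ε , k , t) , inj₁ c∅) | inj₁ (z , e) =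
        z , e , →K (inj₂ (y , ρ , ε , suc k , arc t c∅ e tt))
      hits-target {v} {c} (_ , inj₂ ε) | inj₁ (z , e) = z , e , →K (inj₂ (v , c , ε , 0 , here e))

      -- The colour α is exempt because `x` misses it: `branch-held` does not prevent a branch
      -- vertex from sharing α with `s`.
      hits-unique : ∀ {c v w} → c ≢ α → Hits v c → Hits w c → v ≢ w → ⊥
      hits-unique _ (_ , inj₂ e) (_ , inj₂ e′) ne = ne (other-end φ (E-edge e) (E-edge e′))
      hits-unique {v = v} _ (Q⁺v , inj₁ c∅) (_ , inj₂ e) ne = by-cases (Q v)
        (λ Qv → E-tame e (v , Qv , c∅))
        (λ v∉Q → [ v∉Q , (λ Bv → branch-edge e Bv v∉Q c∅) ]′ Q⁺v)
      hits-unique c≢α a@(_ , inj₂ _) b@(_ , inj₁ _) ne = hits-unique c≢α b a (λ e → ne (≡sym e))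
      hits-unique {c} {v} {w} c≢α a@(Q⁺v , inj₁ cv) (Q⁺w , inj₁ cw) ne =
        by-cases (Q v)
          (λ Qv → by-cases (Q w)
            (λ Qw → Q-elementary Qv Qw cv cw ne)
            (λ w∉Q → [ w∉Q , (λ Bw → branch-held Bw w∉Q cw (v , Qv , cv) c≢α) ]′ Q⁺w))
          (λ v∉Q → [ v∉Q , (λ Bv → by-cases (Held′ c)
            (λ H → branch-held Bv v∉Q cv H c≢α)
            (λ ¬H → [ (λ Qw → ¬H (w , Qw , cw)) , (λ Bw → by-cases (Q w) (λ Qw → ¬H (w , Qw , cw))
              (λ w∉Q → branch-branch Bv v∉Q Bw w∉Q cv cw (hits-present a) ¬H ne)) ]′ Q⁺w)) ]′ Q⁺v)

      target-count : ∀ {c z} → m φ c r ≡ just z → K z ≡ true → 1 ≤ ∑ (λ w → ⟦ is-just (m φ c r) w ∧ K w ⟧)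
      target-count {c} {z} e k = ∑-pos (λ w → is-just (m φ c r) w ∧ K w) z (∧-intro (is-just-intro e) k)

      colour-bound : ∀ c → ∑ (λ v → ⟦ K v ∧ hit v c ⟧) ≤ ∑ (λ w → ⟦ is-just (m φ c r) w ∧ K w ⟧) + ⟦ c == α ⟧
      colour-bound c with c ≟ α
      ... | no c≢α = ℕ.≤-trans le (ℕ.≤-reflexive (≡sym (ℕ.+-identityʳ _)))
        where
        single : ∑ (λ v → ⟦ K v ∧ hit v c ⟧) ≤ 1
        single = ∑-unique (λ v → K v ∧ hit v c) λ v w a b → case v ≟ w of λ
          { (yes e) → e ; (no ne) → ⊥-elim (hits-unique c≢α (hit-elim a) (hit-elim b) ne) }
        le : ∑ (λ v → ⟦ K v ∧ hit v c ⟧) ≤ ∑ (λ w → ⟦ is-just (m φ c r) w ∧ K w ⟧)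
        le with ∑ (λ v → ⟦ K v ∧ hit v c ⟧) in eq
        ... | zero = z≤n
        ... | suc j = ℕ.≤-trans (subst (_≤ 1) eq single)
          (let (v , h) = ∑-find (λ v → K v ∧ hit v c) (subst (1 ≤_) (≡sym eq) (s≤s z≤n))
               (z , e , k) = hits-target (hit-elim h) in target-count e k)
      -- The occurrence of α at `s` is paid for by the target of its arc. By `branch-partner` there
      -- is at most one further occurrence, for which the additional unit is provided.
      ... | yes refl = ℕ.≤-trans (∑-mono split) (ℕ.≤-trans (ℕ.≤-reflexive (∑-+ (λ v → ⟦ v == s ⟧) (λ v → ⟦ extra v ⟧)))
              (ℕ.+-mono-≤ (ℕ.≤-trans (ℕ.≤-reflexive (∑-δ s)) root-target) (∑-unique extra extra-unique)))
        where
        extra : V → Bool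
        extra v = (K v ∧ hit v c) ∧ not (v == s)
        split : ∀ v → ⟦ K v ∧ hit v c ⟧ ≤ ⟦ v == s ⟧ + ⟦ extra v ⟧
        split v with v ≟ s
        ... | yes _ = ℕ.≤-trans (⟦⟧≤1 (K v ∧ hit v c)) (s≤s z≤n)
        ... | no _ = ℕ.≤-reflexive (cong ⟦_⟧ (≡sym (B.∧-identityʳ (K v ∧ hit v c))))
        root-target : 1 ≤ ∑ (λ w → ⟦ is-just (m φ c r) w ∧ K w ⟧)
        root-target = let (z , e , k) = hits-target (inj₁ Q-root , inj₁ αs) in target-count e k
        outside : ∀ {v} → extra v ≡ true → m φ c v ≡ nothing × (Q v → ⊥) × Branch v
        outside {v} h with hit-elim {v} {c} (∧-true₁ h)
        ... | _ , inj₂ e = ⊥-elim (just≢nothing (inv φ (E-edge e)) (x-α e))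
        ... | inj₁ Qv , inj₁ c∅ = ⊥-elim (Q-elementary Qv Q-root c∅ αs (≢s h))
          where
          ≢s : extra v ≡ true → v ≢ s
          ≢s h refl = true≢false (∧-true₂ {K v ∧ hit v c} h) (cong not (==-refl {i = v} refl))
        ... | inj₂ Bv , inj₁ c∅ = c∅ , (λ Qv → Q-elementary Qv Q-root c∅ αs (≢s h)) , Bv
          where
          ≢s : extra v ≡ true → v ≢ s
          ≢s h refl = true≢false (∧-true₂ {K v ∧ hit v c} h) (cong not (==-refl {i = v} refl))
        extra-unique : ∀ v w → extra v ≡ true → extra w ≡ true → v ≡ w
        extra-unique v w a b = case v ≟ w of λ
          { (yes e) → e
          ; (no ne) → let (av , v∉ , Bv) = outside a ; (aw , w∉ , Bw) = outside b in
              ⊥-elim (branch-partner Bv v∉ Bw w∉ av aw ne) }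

      vertex-bound : ∀ v → K v ≡ true → μ φ v + ⟦ A v ⟧ ≤ ∑ (λ c → ⟦ hit v c ⟧)
      vertex-bound v _ = ℕ.≤-trans (ℕ.+-monoʳ-≤ (μ φ v) special)
          (ℕ.≤-trans (ℕ.≤-reflexive (≡sym (∑-+ (λ c → ⟦ is-nothing (m φ c v) ⟧) (λ c → ⟦ A v ∧ is-just (m φ c v) x ⟧))))
            (∑-mono disjoint))
        where
        special : ⟦ A v ⟧ ≤ ∑ (λ c → ⟦ A v ∧ is-just (m φ c v) x ⟧)
        special = ⟦⟧-mono λ a → let (ρ , e) = A→ a in
          ∑-pos (λ c → A v ∧ is-just (m φ c v) x) ρ (∧-intro a (is-just-intro (E-edge e)))
        disjoint : ∀ c → ⟦ is-nothing (m φ c v) ⟧ + ⟦ A v ∧ is-just (m φ c v) x ⟧ ≤ ⟦ hit v c ⟧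
        disjoint c with m φ c v
        ... | just z = ℕ.≤-refl
        ... | nothing = ℕ.≤-reflexive (cong (λ b → 1 + ⟦ b ⟧) (B.∧-zeroʳ (A v)))

      -- Summing over colours, each hit is charged to the target of its colour, and targets of
      -- different colours are different. Since `rs` is uncoloured, `s` is never a target; the last
      -- unit is for the second occurrence of α.
      total : ∑ (λ v → ⟦ K v ⟧ * (μ φ v + ⟦ A v ⟧)) ≤ ∑ (λ v → ⟦ K v ∧ not (v == s) ⟧) + 1
      total = ℕ.≤-trans (∑-mono row) (ℕ.≤-trans (ℕ.≤-reflexive (∑-swap (λ v c → ⟦ K v ∧ hit v c ⟧)))
        (ℕ.≤-trans (∑-mono colour-bound) (ℕ.≤-trans
          (ℕ.≤-reflexive (∑-+ (λ c → ∑ (λ w → ⟦ is-just (m φ c r) w ∧ K w ⟧)) (λ c → ⟦ c == α ⟧)))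
          (ℕ.+-mono-≤ (∑-image (λ c → m φ c r) (uniq φ) K (λ v → K v ∧ not (v == s)) avoid)
            (ℕ.≤-reflexive (∑-δ α))))))
        where
        row : ∀ v → ⟦ K v ⟧ * (μ φ v + ⟦ A v ⟧) ≤ ∑ (λ c → ⟦ K v ∧ hit v c ⟧)
        row v with K v in e
        ... | false = z≤n
        ... | true = ℕ.≤-trans (ℕ.≤-reflexive (ℕ.*-identityˡ _)) (vertex-bound v e)
        avoid : ∀ {c w} → m φ c r ≡ just w → K w ≡ true → K w ∧ not (w == s) ≡ true
        avoid e k = ∧-intro k (cong not (not-true λ h → uncoloured state _ (trans e (cong just (==-true h)))))

      K≢r : ∀ {v} → K v ≡ true → v ≢ r
      K≢r k with K→ k
      ... | inj₁ Qv = Q≢r Qv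
      ... | inj₂ (_ , _ , _ , _ , here e) = λ { refl → adj-irrefl (edge φ e) refl }
      ... | inj₂ (_ , _ , _ , _ , arc _ _ e _) = λ { refl → adj-irrefl (edge φ e) refl }

      μ-def : ∀ {v} → K v ≡ true → μ φ v ≡ def v + ⟦ v == s ⟧
      μ-def {v} k = ℕ.+-cancelʳ-≡ (d v) _ _ (trans (μ≡ state (K≢r k)) (≡sym
        (trans (ℕ.+-assoc (def v) _ _) (trans (cong (def v +_) (ℕ.+-comm ⟦ v == s ⟧ (d v)))
          (trans (≡sym (ℕ.+-assoc (def v) _ _)) (cong (_+ ⟦ v == s ⟧) (ℕ.m∸n+n≡m (degrees v))))))))

      final : ∀ {t} → K t ≡ true → NC t → def t + ∑ (λ v → ⟦ A v ⟧) ≤ ∑ (λ v → ⟦ K v ∧ core? v ⟧)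
      final {t} kt nct = arithmetic
        where
        ∑K = ∑ (λ v → ⟦ K v ⟧)
        ∑K′ = ∑ (λ v → ⟦ K v ∧ not (v == s) ⟧)
        ∑A = ∑ (λ v → ⟦ A v ⟧)
        ∑D = ∑ (λ v → ⟦ K v ⟧ * def v)
        ∑C = ∑ (λ v → ⟦ K v ∧ core? v ⟧)
        AK : ∀ {v} → A v ≡ true → K v ≡ true
        AK a = →K (inj₁ (E-Q (proj₂ (A→ a))))
        -- The 1 is the extra missing colour of `s`, due to the uncoloured edge.
        split : ∑D + (1 + ∑A) ≤ ∑K′ + 1
        split = ℕ.≤-trans (ℕ.≤-reflexive (trans (cong (∑D +_) (trans (cong (_+ ∑A) (≡sym (∑-δ s)))
                  (≡sym (∑-+ (λ v → ⟦ v == s ⟧) (λ v → ⟦ A v ⟧)))))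
                  (≡sym (∑-+ (λ v → ⟦ K v ⟧ * def v) (λ v → ⟦ v == s ⟧ + ⟦ A v ⟧)))))
                (ℕ.≤-trans (∑-mono pointwise) total)
          where
          pointwise : ∀ v → ⟦ K v ⟧ * def v + (⟦ v == s ⟧ + ⟦ A v ⟧) ≤ ⟦ K v ⟧ * (μ φ v + ⟦ A v ⟧)
          pointwise v with true-or-false (K v)
          ... | inj₁ k rewrite k | μ-def k = ℕ.≤-reflexive (trans (cong (_+ (⟦ v == s ⟧ + ⟦ A v ⟧)) (ℕ.*-identityˡ (def v)))
                  (trans (≡sym (ℕ.+-assoc (def v) _ _)) (≡sym (ℕ.*-identityˡ _))))
          ... | inj₂ nk rewrite nk = ℕ.≤-reflexive (cong₂ _+_
                  (⟦⟧-false (λ h → true≢false (→K (inj₁ (subst Q (≡sym (==-true h)) Q-root))) nk))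
                  (⟦⟧-false (λ a → true≢false (AK a) nk)))
        without-root : ∑K′ + 1 ≡ ∑K
        without-root = trans (cong (∑K′ +_) (≡sym (∑-δ s))) (trans (≡sym (∑-+ (λ v → ⟦ K v ∧ not (v == s) ⟧) (λ v → ⟦ v == s ⟧)))
            (∑-cong pointwise))
          where
          pointwise : ∀ v → ⟦ K v ∧ not (v == s) ⟧ + ⟦ v == s ⟧ ≡ ⟦ K v ⟧
          pointwise v with v ≟ s
          ... | yes refl = trans (cong (λ b → ⟦ b ⟧ + 1) (B.∧-zeroʳ (K v))) (≡sym (⟦⟧-true (→K (inj₁ Q-root))))
          ... | no _ = trans (ℕ.+-identityʳ _) (cong ⟦_⟧ (B.∧-identityʳ (K v)))
        -- A non-core vertex has deficiency at least 1 and so pays for itself. For `t` the whole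
        -- deficiency is kept, which makes it count once too often; hence the 1 on the right.
        deficiency : ∑K + def t ≤ ∑D + ∑C + 1
        deficiency = ℕ.≤-trans (ℕ.≤-reflexive (trans (cong (∑K +_) (≡sym weight)) (≡sym (∑-+ (λ v → ⟦ K v ⟧) (λ v → ⟦ v == t ⟧ * def v)))))
            (ℕ.≤-trans (∑-mono pointwise) (ℕ.≤-reflexive (trans (∑-+ (λ v → ⟦ K v ⟧ * def v + ⟦ K v ∧ core? v ⟧) (λ v → ⟦ v == t ⟧))
              (cong₂ _+_ (∑-+ (λ v → ⟦ K v ⟧ * def v) (λ v → ⟦ K v ∧ core? v ⟧)) (∑-δ t)))))
          where
          weight : ∑ (λ v → ⟦ v == t ⟧ * def v) ≡ def t
          weight = trans (∑-single _ t (λ v ne → cong (_* def v) (⟦⟧-false (ne ∘ ==-true))))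
            (trans (cong (_* def t) (⟦⟧-true (==-refl {i = t} refl))) (ℕ.*-identityˡ (def t)))
          pointwise : ∀ v → ⟦ K v ⟧ + ⟦ v == t ⟧ * def v ≤ ⟦ K v ⟧ * def v + ⟦ K v ∧ core? v ⟧ + ⟦ v == t ⟧
          pointwise v with v ≟ t
          ... | yes refl rewrite kt = ℕ.≤-trans (ℕ.≤-reflexive (ℕ.+-comm 1 _))
                  (ℕ.+-monoˡ-≤ 1 (ℕ.m≤m+n (def v + 0) _))
          ... | no _ = ℕ.≤-trans (ℕ.≤-reflexive (ℕ.+-identityʳ _)) (ℕ.≤-trans general (ℕ.≤-reflexive (≡sym (ℕ.+-identityʳ _))))
            where
            general : ⟦ K v ⟧ ≤ ⟦ K v ⟧ * def v + ⟦ K v ∧ core? v ⟧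
            general with K v | core? v in e
            ... | false | _ = z≤n
            ... | true | true = ℕ.m≤n+m 1 (def v + 0)
            ... | true | false = ℕ.≤-trans (ℕ.m<n⇒0<n∸m {d v} {D} (ℕ.≰⇒> λ le → subst IsTrue e (ℕ.≤⇒≤ᵇ le)))
              (ℕ.≤-trans (ℕ.m≤m+n (def v) 0) (ℕ.m≤m+n (def v + 0) 0))
        arithmetic : def t + ∑A ≤ ∑C
        arithmetic = ℕ.+-cancelˡ-≤ (∑D + 1) _ _ (begin
          ∑D + 1 + (def t + ∑A) ≡⟨ cong (∑D + 1 +_) (ℕ.+-comm (def t) ∑A) ⟩
          ∑D + 1 + (∑A + def t) ≡⟨ ≡sym (ℕ.+-assoc (∑D + 1) ∑A (def t)) ⟩
          ∑D + 1 + ∑A + def t ≡⟨ cong (_+ def t) (ℕ.+-assoc ∑D 1 ∑A) ⟩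
          ∑D + (1 + ∑A) + def t ≤⟨ ℕ.+-monoˡ-≤ (def t) (ℕ.≤-trans split (ℕ.≤-reflexive without-root)) ⟩
          ∑K + def t ≤⟨ deficiency ⟩
          ∑D + ∑C + 1 ≡⟨ ℕ.+-assoc ∑D ∑C 1 ⟩
          ∑D + (∑C + 1) ≡⟨ cong (∑D +_) (ℕ.+-comm ∑C 1) ⟩
          ∑D + (1 + ∑C) ≡⟨ ≡sym (ℕ.+-assoc ∑D 1 ∑C) ⟩
          ∑D + 1 + ∑C ∎)
          where open ℕ.≤-Reasoning

    pool-bound : (PoolBound s x E Q⁺ → ⊥) → ⊥
    pool-bound k = as-bool Q⁺ λ K K→ →K → as-bool (λ v → ∃ λ ρ → E v ρ) λ A A→ →A → k record
      { A = A ; K = K ; A-E = λ e → →A (_ , e) ; K-Q = K→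
      ; bound = λ q nc → final K K→ →K A A→ →A (→K q) nc }

-- Colour functions and matchings

module Conversion {n : ℕ} (G : Graph n) (D : ℕ) where

  open Matchings G D

  search : (p : Fin n → Bool) → Maybe (Fin n)
  search p with F.any? (λ w → p w B.≟ true)
  ... | yes (w , _) = just w
  ... | no _ = nothing

  search-just : ∀ p {w} → search p ≡ just w → p w ≡ true
  search-just p e with F.any? (λ w → p w B.≟ true)
  search-just p refl | yes (_ , h) = h

  search-found : ∀ p {w} → (∀ {v} → p v ≡ true → v ≡ w) → p w ≡ true → search p ≡ just w
  search-found p {w} u h with F.any? (λ w → p w B.≟ true)
  ... | yes (v , g) = cong just (u g)
  ... | no ¬p = ⊥-elim (¬p (w , h))

  -- The colour `c₀` is a default for non-adjacent pairs, on which `Colourable` imposes nothing.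
  total-colourable : C → ∀ φ → (∀ {v w} → adj G v w ≡ true → ∃ λ c → m φ c v ≡ just w) → Colourable (adj G) D
  total-colourable c₀ φ total = col , symmetric , proper
    where
    col : V → V → C
    col v w with F.any? (λ c → is-just (m φ c v) w B.≟ true)
    ... | yes (c , _) = c
    ... | no _ = c₀
    col-spec : ∀ {v w} → adj G v w ≡ true → m φ (col v w) v ≡ just w
    col-spec {v} {w} a with F.any? (λ c → is-just (m φ c v) w B.≟ true)
    ... | yes (_ , h) = is-just-true h
    ... | no ¬p = let (c , h) = total a in ⊥-elim (¬p (c , is-just-intro h))
    symmetric : ∀ v w → adj G v w ≡ true → col v w ≡ col w v
    symmetric v w a = uniq φ (col-spec a) (inv φ (col-spec (adj-sym a)))
    proper : ∀ v w u → adj G v w ≡ true → adj G v u ≡ true → w ≢ u → col v w ≢ col v u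
    proper v w u a b ne e = ne (just-injective
      (trans (≡sym (col-spec a)) (trans (cong (λ c → m φ c v) e) (col-spec b))))

  module Deleted (r s : V) (ars : adj G r s ≡ true) where

    open Centre G D r

    end : V → V → Bool
    end v w = ((v == r) ∧ (w == s)) ∨ ((v == s) ∧ (w == r))

    end-elim : ∀ {v w} → end v w ≡ true → (v ≡ r × w ≡ s) ⊎ (v ≡ s × w ≡ r)
    end-elim {v} {w} h with ∨-elim {(v == r) ∧ (w == s)} h
    ... | inj₁ g = inj₁ (==-true (∧-true₁ g) , ==-true (∧-true₂ {v == r} g))
    ... | inj₂ g = inj₂ (==-true (∧-true₁ g) , ==-true (∧-true₂ {v == s} g))

    end-intro : ∀ {v w} → (v ≡ r × w ≡ s) ⊎ (v ≡ s × w ≡ r) → end v w ≡ true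
    end-intro (inj₁ (a , b)) = ∨-intro₁ (∧-intro (==-refl a) (==-refl b))
    end-intro {v} {w} (inj₂ (a , b)) = ∨-intro₂ {(v == r) ∧ (w == s)} (∧-intro (==-refl a) (==-refl b))

    end-sym : ∀ v w → end v w ≡ end w v
    end-sym v w = trans (B.∨-comm ((v == r) ∧ (w == s)) ((v == s) ∧ (w == r)))
      (cong₂ _∨_ (B.∧-comm (v == s) (w == r)) (B.∧-comm (v == r) (w == s)))

    deleted : Subgraph G
    deleted = record
      { vs = λ _ → true
      ; es = λ v w → adj G v w ∧ not (end v w)
      ; esSym = λ v w → cong₂ _∧_ (sym G v w) (cong not (end-sym v w))
      ; esSub = λ v w → ∧-true₁
      ; esEnd = λ _ _ _ → refl }

    deleted-proper : Proper deleted
    deleted-proper = inj₂ (r , s , ars , trans (cong (λ b → adj G r s ∧ not b) (end-intro (inj₁ (refl , refl)))) (B.∧-zeroʳ _))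

    colourable-state : Colourable (es deleted) D → ∃ λ φ → State s φ
    colourable-state (c , symmetric , proper) = φ , record { rs = ars ; cover = cover′ ; uncoloured = uncol }
      where
      E : V → V → Bool
      E = es deleted
      at : C → V → V → Bool
      at a v w = E v w ∧ (c v w == a)
      at-E : ∀ {a v w} → at a v w ≡ true → E v w ≡ true
      at-E = ∧-true₁
      at-c : ∀ {a v w} → at a v w ≡ true → c v w ≡ a
      at-c {a} {v} {w} h = ==-true (∧-true₂ {E v w} h)
      match : C → V → Maybe V
      match a v = search (at a v)
      found : ∀ {a v w} → E v w ≡ true → c v w ≡ a → match a v ≡ just w
      found {a} {v} {w} h e = search-found (at a v)
        (λ {u} g → case u ≟ w of λ
          { (yes p) → p
          ; (no ne) → ⊥-elim (proper v u w (at-E {a} {v} {u} g) h ne (trans (at-c {a} {v} {u} g) (≡sym e))) })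
        (∧-intro h (==-refl e))
      spec : ∀ {a v w} → match a v ≡ just w → E v w ≡ true × c v w ≡ a
      spec {a} {v} {w} e = let h = search-just (at a v) e in at-E {a} {v} {w} h , at-c {a} {v} {w} h
      φ : Col
      φ = record
        { m = match
        ; inv = λ {a} {v} {w} e → let (h , g) = spec {a} {v} {w} e in
            found (trans (≡sym (esSym deleted v w)) h) (trans (≡sym (symmetric v w h)) g)
        ; edge = λ {a} {v} {w} e → ∧-true₁ (proj₁ (spec {a} {v} {w} e))
        ; uniq = λ {a} {b} {v} {w} e f → trans (≡sym (proj₂ (spec {a} {v} {w} e))) (proj₂ (spec {b} {v} {w} f)) }
      cover′ : ∀ {v w} → adj G v w ≡ true → (∃ λ a → match a v ≡ just w) ⊎ ((v ≡ r × w ≡ s) ⊎ (v ≡ s × w ≡ r))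
      cover′ {v} {w} a with true-or-false (end v w)
      ... | inj₁ h = inj₂ (end-elim h)
      ... | inj₂ h = inj₁ (c v w , found (∧-intro a (cong not h)) refl)
      uncol : ∀ a → match a r ≢ just s
      uncol a e = true≢false (∧-true₂ {adj G r s} (proj₁ (spec {a} {r} {s} e)))
        (cong not (end-intro (inj₁ (refl , refl))))

  colourable-mono : ∀ {E : EdgeRel n} {j k} → j ≤ k → Colourable E j → Colourable E k
  colourable-mono j≤k (c , symmetric , proper) = (λ v w → F.inject≤ (c v w) j≤k)
    , (λ v w a → cong (λ x → F.inject≤ x j≤k) (symmetric v w a))
    , (λ v w u a b ne e → proper v w u a b ne (F.inject≤-injective j≤k j≤k _ _ e))

-- Overfullness from disjoint sets of missing colours

module Overfullness {n : ℕ} (G : Graph n) (D : ℕ) (r : Fin n) where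

  open Matchings G D
  open Centre G D r

  before : V → V → Bool
  before v w = ⌊ v F.<? w ⌋

  numEdges-∑ : numEdges G ≡ ∑ (λ v → ∑ (λ w → ⟦ before v w ∧ adj G v w ⟧))
  numEdges-∑ = trans (sum-∑ (λ v → countFin n (λ w → before v w ∧ adj G v w)) id)
    (∑-cong (λ v → countFin-∑ n (λ w → before v w ∧ adj G v w)))

  before-total : ∀ {v w} → v ≢ w → ⟦ before v w ⟧ + ⟦ before w v ⟧ ≡ 1
  before-total {v} {w} ne with F.<-cmp v w
  ... | tri≈ _ e _ = ⊥-elim (ne e)
  ... | tri< a _ b = cong₂ _+_ (cong ⟦_⟧ (on a)) (cong ⟦_⟧ (off b))
    where
    on : v F.< w → before v w ≡ true
    on p with v F.<? w
    ... | yes _ = refl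
    ... | no q = ⊥-elim (q p)
    off : ¬ w F.< v → before w v ≡ false
    off p with w F.<? v
    ... | yes q = ⊥-elim (p q)
    ... | no _ = refl
  ... | tri> b _ a = cong₂ _+_ (cong ⟦_⟧ (off b)) (cong ⟦_⟧ (on a))
    where
    on : w F.< v → before w v ≡ true
    on p with w F.<? v
    ... | yes _ = refl
    ... | no q = ⊥-elim (q p)
    off : ¬ v F.< w → before v w ≡ false
    off p with v F.<? w
    ... | yes q = ⊥-elim (p q)
    ... | no _ = refl

  class-size : Col → C → ℕ
  class-size φ c = ∑ (λ v → ∑ (λ w → ⟦ before v w ∧ is-just (m φ c v) w ⟧))

  class-double : ∀ φ c → ∑ (λ v → ∑ (λ w → ⟦ is-just (m φ c v) w ⟧)) ≡ class-size φ c + class-size φ c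
  class-double φ c = begin
    ∑ (λ v → ∑ (λ w → ⟦ J v w ⟧)) ≡⟨ ∑-cong (λ v → trans (∑-cong (split v))
      (∑-+ (λ w → ⟦ before v w ∧ J v w ⟧) (λ w → ⟦ before w v ∧ J w v ⟧))) ⟩
    ∑ (λ v → ∑ (λ w → ⟦ before v w ∧ J v w ⟧) + ∑ (λ w → ⟦ before w v ∧ J w v ⟧))
      ≡⟨ ∑-+ (λ v → ∑ (λ w → ⟦ before v w ∧ J v w ⟧)) (λ v → ∑ (λ w → ⟦ before w v ∧ J w v ⟧)) ⟩
    class-size φ c + ∑ (λ v → ∑ (λ w → ⟦ before w v ∧ J w v ⟧))
      ≡⟨ cong (class-size φ c +_) (∑-swap (λ v w → ⟦ before w v ∧ J w v ⟧)) ⟩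
    class-size φ c + class-size φ c ∎
    where
    open ≡-Reasoning
    J : V → V → Bool
    J v w = is-just (m φ c v) w
    split : ∀ v w → ⟦ J v w ⟧ ≡ ⟦ before v w ∧ J v w ⟧ + ⟦ before w v ∧ J w v ⟧
    split v w with true-or-false (J v w)
    ... | inj₂ h = trans (cong ⟦_⟧ h) (≡sym (cong₂ _+_
            (⟦⟧-false (λ g → true≢false (∧-true₂ {before v w} g) h))
            (⟦⟧-false (λ g → true≢false (is-just-intro (inv φ (is-just-true (∧-true₂ {before w v} g)))) h))))
    ... | inj₁ h = trans (cong ⟦_⟧ h) (trans (≡sym (before-total (adj-irrefl (edge φ (is-just-true h)))))
            (cong₂ _+_ (cong ⟦_⟧ (unit {before v w} h)) (cong ⟦_⟧ (unit {before w v} (is-just-intro (inv φ (is-just-true h)))))))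
      where
      unit : ∀ {a b} → b ≡ true → a ≡ a ∧ b
      unit {a} h = trans (≡sym (B.∧-identityʳ a)) (cong (a ∧_) (≡sym h))

  -- A colour class leaves at most one vertex unmatched, so twice its size is at least n - 1.
  class-half : ∀ φ c → (∀ v w → m φ c v ≡ nothing → m φ c w ≡ nothing → v ≡ w) → n / 2 ≤ class-size φ c
  class-half φ c u = ℕ.≮⇒≥ λ lt → ℕ.<⇒≱ (ℕ.≤-trans
      (ℕ.≤-trans (ℕ.≤-reflexive (arith (class-size φ c))) (ℕ.*-monoˡ-≤ 2 lt)) (DivMod.m/n*n≤m n 2)) size
    where
    arith : ∀ l → suc (1 + (l + l)) ≡ suc l * 2
    arith l = cong (2 +_) (trans (cong (l +_) (≡sym (ℕ.+-identityʳ l))) (ℕ.*-comm 2 l))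
    row : ∀ v → 1 ≤ ⟦ is-nothing (m φ c v) ⟧ + ∑ (λ w → ⟦ is-just (m φ c v) w ⟧)
    row v with m φ c v
    ... | nothing = s≤s z≤n
    ... | just z = ∑-pos (z ==_) z (==-refl {i = z} refl)
    size : n ≤ 1 + (class-size φ c + class-size φ c)
    size = ℕ.≤-trans (ℕ.≤-reflexive (≡sym (trans (∑-const n 1) (ℕ.*-identityʳ n))))
      (ℕ.≤-trans (∑-mono row) (ℕ.≤-trans
        (ℕ.≤-reflexive (∑-+ (λ v → ⟦ is-nothing (m φ c v) ⟧) (λ v → ∑ (λ w → ⟦ is-just (m φ c v) w ⟧))))
        (ℕ.+-mono-≤ (∑-unique (λ v → is-nothing (m φ c v)) (λ v w a b → u v w (is-nothing-true a) (is-nothing-true b)))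
          (ℕ.≤-reflexive (class-double φ c)))))

  -- The D colour classes already reach the bound D · ⌊n/2⌋, and the uncoloured edge `rs` makes the
  -- inequality strict.
  elementary-overfull : ∀ {s φ} → State s φ → (∀ c v w → m φ c v ≡ nothing → m φ c w ≡ nothing → v ≡ w) →
    D * (n / 2) < numEdges G
  elementary-overfull {s} {φ} st u = begin-strict
    D * (n / 2) ≡⟨ ≡sym (∑-const D (n / 2)) ⟩
    ∑ {D} (λ _ → n / 2) ≤⟨ ∑-mono (λ c → class-half φ c (u c)) ⟩
    ∑ (class-size φ) <⟨ ℕ.≤-refl ⟩
    1 + ∑ (class-size φ) ≡⟨ ℕ.+-comm 1 _ ⟩
    ∑ (class-size φ) + 1 ≤⟨ ℕ.+-mono-≤ (ℕ.≤-reflexive reorder) extra ⟩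
    ∑ (λ v → ∑ (λ w → ∑ (λ c → ⟦ before v w ∧ is-just (m φ c v) w ⟧))) + ∑ (λ v → ∑ (λ w → ⟦ before v w ∧ end v w ⟧))
      ≡⟨ trans (≡sym (∑-+ (λ v → ∑ (λ w → ∑ (λ c → ⟦ before v w ∧ is-just (m φ c v) w ⟧)))
                       (λ v → ∑ (λ w → ⟦ before v w ∧ end v w ⟧))))
           (∑-cong (λ v → ≡sym (∑-+ (λ w → ∑ (λ c → ⟦ before v w ∧ is-just (m φ c v) w ⟧)) (λ w → ⟦ before v w ∧ end v w ⟧)))) ⟩
    ∑ (λ v → ∑ (λ w → ∑ (λ c → ⟦ before v w ∧ is-just (m φ c v) w ⟧) + ⟦ before v w ∧ end v w ⟧))
      ≤⟨ ∑-mono (λ v → ∑-mono (pointwise v)) ⟩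
    ∑ (λ v → ∑ (λ w → ⟦ before v w ∧ adj G v w ⟧)) ≡⟨ ≡sym numEdges-∑ ⟩
    numEdges G ∎
    where
    open ℕ.≤-Reasoning
    open Conversion.Deleted G D r s (rs st) using (end; end-elim; end-intro)
    reorder : ∑ (class-size φ) ≡ ∑ (λ v → ∑ (λ w → ∑ (λ c → ⟦ before v w ∧ is-just (m φ c v) w ⟧)))
    reorder = trans (∑-swap (λ c v → ∑ (λ w → ⟦ before v w ∧ is-just (m φ c v) w ⟧)))
      (∑-cong (λ v → ∑-swap (λ c w → ⟦ before v w ∧ is-just (m φ c v) w ⟧)))
    at-end : ∀ v w → end v w ≡ true → before v w ≡ true → 1 ≤ ∑ (λ v → ∑ (λ w → ⟦ before v w ∧ end v w ⟧))
    at-end v w a b = ℕ.≤-trans (∑-pos (λ w → before v w ∧ end v w) w (∧-intro b a))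
      (∑-member (λ v → ∑ (λ w → ⟦ before v w ∧ end v w ⟧)) v)
    extra : 1 ≤ ∑ (λ v → ∑ (λ w → ⟦ before v w ∧ end v w ⟧))
    extra with true-or-false (before r s)
    ... | inj₁ b = at-end r s (end-intro (inj₁ (refl , refl))) b
    ... | inj₂ b = at-end s r (end-intro (inj₂ (refl , refl)))
            (one (trans (≡sym (cong (λ x → ⟦ x ⟧ + ⟦ before s r ⟧) b)) (before-total (adj-irrefl (rs st)))))
      where
      one : ∀ {b} → ⟦ b ⟧ ≡ 1 → b ≡ true
      one {true} _ = refl
    pointwise : ∀ v w → ∑ (λ c → ⟦ before v w ∧ is-just (m φ c v) w ⟧) + ⟦ before v w ∧ end v w ⟧ ≤ ⟦ before v w ∧ adj G v w ⟧
    pointwise v w with before v w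
    ... | false = ℕ.≤-reflexive (cong (_+ 0) (∑-zero {D} (λ _ → refl)))
    ... | true with true-or-false (end v w)
    ...   | inj₁ e = ℕ.≤-trans (ℕ.≤-reflexive (cong₂ _+_
              (∑-none (λ c → is-just (m φ c v) w) (λ c h → not-coloured (end-elim {v} {w} e) (is-just-true h))) (⟦⟧-true e)))
              (ℕ.≤-reflexive (≡sym (⟦⟧-true (adjacent (end-elim {v} {w} e)))))
      where
      not-coloured : ∀ {v w c} → (v ≡ r × w ≡ s) ⊎ (v ≡ s × w ≡ r) → m φ c v ≡ just w → ⊥
      not-coloured (inj₁ (refl , refl)) h = uncoloured st _ h
      not-coloured (inj₂ (refl , refl)) h = uncoloured st _ (inv φ h)
      adjacent : ∀ {v w} → (v ≡ r × w ≡ s) ⊎ (v ≡ s × w ≡ r) → adj G v w ≡ true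
      adjacent (inj₁ (refl , refl)) = rs st
      adjacent (inj₂ (refl , refl)) = adj-sym (rs st)
    ...   | inj₂ e rewrite e with true-or-false (adj G v w)
    ...     | inj₁ a rewrite a = ℕ.≤-trans (ℕ.≤-reflexive (ℕ.+-identityʳ _))
                (∑-unique (λ c → is-just (m φ c v) w) (λ c c′ p q → uniq φ (is-just-true p) (is-just-true q)))
    ...     | inj₂ a = ℕ.≤-trans (ℕ.≤-reflexive (cong (_+ 0)
                (∑-none (λ c → is-just (m φ c v) w) (λ c h → true≢false (edge φ (is-just-true h)) a)))) z≤n

  -- The θ,c-chains of two vertices that miss c cannot both end at r; changing one that avoids r would repeat θ.
  conflict-or-overfull : ∀ {s φ θ} → State s φ → m φ θ r ≡ nothing → (∀ {η} → m φ η r ≡ nothing → η ≡ θ) →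
    (∀ {ψ x} → State s ψ → m ψ θ r ≡ nothing → x ≢ r → m ψ θ x ≡ nothing → ⊥) → D * (n / 2) < numEdges G
  conflict-or-overfull {s} {φ} {θ} st θr unique none = elementary-overfull st λ c v w cv cw →
    case v ≟ w of λ { (yes e) → e ; (no ne) → ⊥-elim (distinct c v w cv cw ne) }
    where
    alone : ∀ {x} → m φ θ x ≡ nothing → x ≢ r → ⊥
    alone h x≢r = none st θr x≢r h
    off : ∀ {c v} → m φ c v ≡ nothing → v ≢ r → (K : Chain φ θ c v) → Chain.T K r ≡ true
    off {c} {v} cv v≢r K with true-or-false (Chain.T K r)
    ... | inj₁ h = h
    ... | inj₂ h = ⊥-elim (none (state-swap (Chain.closed K) st) (trans (swap-out φ θ c (Chain.T K) θ h) θr) v≢r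
            (trans (swap-in φ θ c (Chain.T K) θ (Chain.origin K)) (trans (cong (λ d → m φ d v) (transp-a θ c)) cv)))
    distinct : ∀ c v w → m φ c v ≡ nothing → m φ c w ≡ nothing → v ≢ w → ⊥
    distinct c v w cv cw v≢w with v ≟ r | w ≟ r
    ... | yes refl | _ with unique cv
    ...   | refl = alone cw (λ e → v≢w (≡sym e))
    distinct c v w cv cw v≢w | no v≢r | yes refl with unique cw
    ...   | refl = alone cv v≢w
    distinct c v w cv cw v≢w | no v≢r | no w≢r =
      chain φ θ c v (inj₂ cv) λ Kv → chain φ θ c w (inj₂ cw) λ Kw →
        let open Chain in
        w≢r (ends Kv (least Kw (closed Kv) (off cw w≢r Kw) (off cv v≢r Kv)) (off cv v≢r Kv)
          (λ e → v≢w (≡sym e)) (λ e → v≢r (≡sym e)) (inj₂ cw) (inj₁ θr))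

-- The count applied to fans and to start sets

module Bounds {n : ℕ} (G : Graph n) (D : ℕ) (r : Fin n) (no-total : ∀ φ → Centre.Total G D r φ → ⊥)
  (degrees : ∀ v → Degrees.d G D r v ≤ D) where

  open Matchings G D
  open Centre G D r
  open Fan G D r no-total
  open Degrees G D r

  missing : ∀ {s φ v} → State s φ → NC v → Missing φ v
  missing st nc = nc-missing st nc

  two : ∀ {s φ} → State s φ → NC s → Two φ s
  two st nc = root-two st nc

  fan-core-adj : ∀ {s φ q} → NC s → InF s φ q → (NC q → ⊥) → adj G r q ≡ true
  fan-core-adj ncs (_ , here refl) c = ⊥-elim (c ncs)
  fan-core-adj {φ = φ} ncs (_ , arc _ _ e _) c = edge φ e

  no-edges : ∀ {s φ θ α} → State s φ → NC s → m φ θ r ≡ nothing → m φ α s ≡ nothing →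
    Pool s φ α s (InF s φ) (λ _ _ → ⊥)
  no-edges {s} {φ} st ncs θr αs = record
    { state = st ; αs = αs ; Q-root = root∈ ; Q≢r = fan≢r st ; Q-core = fan-core-adj ncs ; Q-arc = reach-arc
    ; Q-present = λ Fq h hr → fan-disjoint-r s st hr Fq h
    ; Q-elementary = fan-elementary s st θr
    ; E-Q = λ () ; E-edge = λ () ; E-present = λ () ; E-tame = λ () ; x-α = λ ()
    ; branch-present = λ { (_ , _ , () , _) } ; branch-held = λ { (_ , _ , () , _) } ; branch-edge = λ ()
    ; branch-branch = λ { (_ , _ , () , _) } ; branch-partner = λ { (_ , _ , () , _) } }

  -- The central count with no edges to a further vertex and with `s` in the role of `t`; in essence
  -- Vizing's adjacency lemma. It will also be applied around a centre different from `r`.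
  fan-core-count : ∀ {s φ θ} → State s φ → NC s → m φ θ r ≡ nothing →
    (∀ (K : V → Bool) → (∀ {v} → K v ≡ true → InF s φ v) → def s ≤ ∑ (λ v → ⟦ K v ∧ core? v ⟧) → ⊥) → ⊥
  fan-core-count {s} st ncs θr k =
    let (a , b , a≢b , as , bs) = two st ncs in
    Counting.pool-bound degrees (no-edges st ncs θr as) λ B → let open PoolBound B in
      k K (λ h → [ id , (λ { (_ , _ , () , _) }) ]′ (K-Q h)) (ℕ.m+n≤o⇒m≤o (def s) (bound (inj₁ root∈) ncs))

  module _ (core-r : NC r → ⊥) where

    κ : ℕ
    κ = ∑ (λ v → ⟦ adj G r v ∧ core? v ⟧)

    core-count : ∀ {s φ α x Q E} (P : Pool s φ α x Q E) (K : V → Bool) →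
      (∀ {v} → K v ≡ true → Q v ⊎ Pool.Branch P v) → ∑ (λ v → ⟦ K v ∧ core? v ⟧) ≤ κ
    core-count {φ = φ} P K K→ = ∑-mono λ v → ⟦⟧-mono λ h → ℕ.≤-reflexive (≡sym (⟦⟧-true
      (∧-intro (adjacent (K→ (∧-true₁ h)) (core-elim (∧-true₂ {K v} h))) (∧-true₂ {K v} h))))
      where
      adjacent : ∀ {v} → _ ⊎ Pool.Branch P v → (NC v → ⊥) → adj G r v ≡ true
      adjacent (inj₁ Qv) c = Pool.Q-core P Qv c
      adjacent (inj₂ (_ , _ , _ , _ , here e)) c = edge φ e
      adjacent (inj₂ (_ , _ , _ , _ , arc _ _ e _)) c = edge φ e

    module _ {s φ θ x α β} (st : State s φ) (ncs : NC s) (θr : m φ θ r ≡ nothing) (x∉F : InF s φ x → ⊥) (x≢r : x ≢ r)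
      (αs : m φ α s ≡ nothing) (βs : m φ β s ≡ nothing) (α≢β : α ≢ β) (αx : m φ α x ≡ nothing) where

      open FanPool G D r no-total NC missing two using (not-wild; branch-disjoint)
      module FP = FanPool G D r no-total NC missing two

      FanEdge : V → C → Set
      FanEdge v ρ = InF s φ v × NC v × m φ ρ v ≡ just x

      private
        Hα : Held s φ α
        Hα = s , root∈ , αs
        θ≢α : θ ≢ α
        θ≢α e = held≢θ st θr Hα (≡sym e)
        unique : ∀ {c} → m φ c r ≡ nothing → c ≡ θ
        unique h = r-missing-unique st core-r h θr

      fan-pool : Pool s φ α x (InF s φ) FanEdge
      fan-pool = record
        { state = st ; αs = αs ; Q-root = root∈ ; Q≢r = fan≢r st ; Q-core = fan-core-adj ncs ; Q-arc = reach-arc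
        ; Q-present = λ Fq h hr → fan-disjoint-r s st hr Fq h
        ; Q-elementary = fan-elementary s st θr
        ; E-Q = proj₁ ; E-edge = proj₂ ∘ proj₂
        ; E-present = λ { (Fv , ncv , e) h → not-wild st ncs θr x∉F x≢r αx Hα Fv ncv e (inj₁ (unique h)) }
        ; E-tame = λ { (Fv , ncv , e) h → not-wild st ncs θr x∉F x≢r αx Hα Fv ncv e (inj₂ h) }
        ; x-α = λ _ → αx
        ; branch-present = λ { (_ , _ , (Fv , ncv , e) , _ , t) q∉ h hr →
            branch-disjoint st ncs θr x∉F x≢r αx Hα Fv ncv e t q∉ h (inj₁ (unique hr))
              (λ c≡α → θ≢α (trans (≡sym (unique hr)) c≡α)) }
        ; branch-held = λ { (_ , _ , (Fv , ncv , e) , _ , t) q∉ h H c≢α →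
            branch-disjoint st ncs θr x∉F x≢r αx Hα Fv ncv e t q∉ h (inj₂ H) c≢α }
        ; branch-edge = λ { (Fv , ncv , e) (_ , _ , (Fv′ , ncv′ , e′) , _ , t) q∉ h →
            FP.branch-edge st ncs θr x∉F x≢r αx Hα Fv ncv e Fv′ ncv′ e′ t q∉ h }
        ; branch-branch = λ { (_ , _ , (Fv , ncv , e) , _ , t) q∉ (_ , _ , (Fv′ , ncv′ , e′) , _ , t′) q′∉ h h′ p ¬H ne →
            FP.branches-disjoint st ncs θr x∉F x≢r αx Hα Fv ncv e Fv′ ncv′ e′ t q∉ t′ q′∉ h h′
              [ (λ { refl → p θr }) , ¬H ]′ ne }
        ; branch-partner = λ { (_ , _ , (Fv , ncv , e) , _ , t) q∉ (_ , _ , (Fv′ , ncv′ , e′) , _ , t′) q′∉ h h′ ne →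
            FP.partner-unique st ncs θr x∉F x≢r αx Hα αs βs α≢β αx Fv ncv e Fv′ ncv′ e′ t q∉ t′ q′∉ h h′ ne } }

    module _ {s : V} (ncs : NC s) (rs′ : adj G r s ≡ true) (big : V → Bool) (α β : C) (α≢β : α ≢ β) (leaf : V)
      (S : Robust.Starts G D r no-total NC missing two s ncs big α β leaf) where

      open Robust G D r no-total NC missing two s ncs big α β leaf
      open Starts S using (P°; P°⊂P; P-nc; P≢r)
      open System S using (Q; root∈Q; elementary; Q-disjoint-r; start∈Q)
      module Br = Branches G D r no-total NC missing two s ncs big α β leaf S

      start-pool : ∀ {φ θ x} (cl : Cls φ) (θr : m φ θ r ≡ nothing) (x∉F : F∌ φ x) (x≢r : x ≢ r) (αx : m φ α x ≡ nothing) →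
        Br.Base.Tame cl θr x∉F x≢r αx → Pool s φ α x (Q φ) (Br.Edge φ x)
      start-pool {φ} {θ} {x} cl θr x∉F x≢r αx tame = record
        { state = state ; αs = αs ; Q-root = root∈Q {φ}
        ; Q≢r = Q≢r
        ; Q-core = Q-core
        ; Q-arc = reach-arc
        ; Q-present = λ Qq h hr → Q-disjoint-r cl hr Qq h
        ; Q-elementary = elementary cl θr
        ; E-Q = λ e → start∈Q (proj₁ e) ; E-edge = proj₂ ∘ proj₂
        ; E-present = λ e h → not-qwild e (inj₁ (unique h))
        ; E-tame = λ e h → not-qwild e (inj₂ h)
        ; x-α = λ _ → αx
        ; branch-present = λ { (_ , _ , e , _ , t) q∉ h hr →
            branch-disjoint e t q∉ h (inj₁ (unique hr)) (λ c≡α → α≢θ (trans (≡sym c≡α) (unique hr))) }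
        ; branch-held = λ { (_ , _ , e , _ , t) q∉ h H c≢α → branch-disjoint e t q∉ h (inj₂ H) c≢α }
        ; branch-edge = λ { e (_ , _ , e′ , _ , t) q∉ h → branch-edge e e′ t q∉ h }
        ; branch-branch = λ { (_ , _ , e , _ , t) q∉ (_ , _ , e′ , _ , t′) q′∉ h h′ p ¬H ne →
            branches-disjoint e e′ t q∉ t′ q′∉ h h′ [ (λ { refl → p θr }) , ¬H ]′ ne }
        ; branch-partner = λ { (_ , _ , e , _ , t) q∉ (_ , _ , e′ , _ , t′) q′∉ h h′ ne →
            partner-unique α≢β e e′ t q∉ t′ q′∉ h h′ ne } }
        where
        open Cls cl
        open Br.Base cl θr x∉F x≢r αx using (α≢θ)
        open Br.Tamed cl θr x∉F x≢r αx tame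
        unique : ∀ {c} → m φ c r ≡ nothing → c ≡ θ
        unique h = r-missing-unique state core-r h θr
        Q≢r : ∀ {q} → Q φ q → q ≢ r
        Q≢r (_ , here (inj₁ refl)) e = adj-irrefl rs′ (≡sym e)
        Q≢r (_ , here (inj₂ p)) = P≢r cl (P°⊂P p)
        Q≢r (_ , arc _ _ e _) refl = adj-irrefl (edge φ e) refl
        Q-core : ∀ {q} → Q φ q → (NC q → ⊥) → adj G r q ≡ true
        Q-core (_ , here (inj₁ refl)) c = ⊥-elim (c ncs)
        Q-core (_ , here (inj₂ p)) c = ⊥-elim (c (P-nc (P°⊂P p)))
        Q-core (_ , arc _ _ e _) c = edge φ e

      -- In one tame colouring the count is made twice, for the start vertices outside the fan and
      -- for the fan itself; together the two sets catch the relevant neighbours of `x`.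
      neighbour-sets : ∀ {x t} → x ≢ r → NC t → big t ≡ true →
        (∀ {φ θ} (A B : V → Bool) → Cls φ → m φ θ r ≡ nothing → F∌ φ x → m φ α x ≡ nothing →
          (∀ {v ρ} → P° φ v → F∌ φ v → m φ ρ v ≡ just x → A v ≡ true) →
          (∀ {v ρ} → InF s φ v → NC v → m φ ρ v ≡ just x → B v ≡ true) →
          def t + ∑ (λ v → ⟦ A v ⟧) ≤ κ → def t + ∑ (λ v → ⟦ B v ⟧) ≤ κ → ⊥) →
        ∀ {φ θ} → Cls φ → m φ θ r ≡ nothing → F∌ φ x → m φ α x ≡ nothing → ⊥
      neighbour-sets {x} {t} x≢r nct bt k cl₀ θr₀ x∉F₀ αx₀ =
        Br.tame-exists x≢r (λ {φ} cl θr x∉F αx tame →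
          let open Cls cl
              YP = start-pool cl θr x∉F x≢r αx tame
              FP = fan-pool state ncs θr x∉F x≢r αs βs α≢β αx
              Ft = big⊂ bt
          in Counting.pool-bound degrees YP λ BY → Counting.pool-bound degrees FP λ BF →
            k (PoolBound.A BY) (PoolBound.A BF) cl θr x∉F αx
              (λ p f e → PoolBound.A-E BY (p , f , e))
              (λ f c e → PoolBound.A-E BF (f , c , e))
              (ℕ.≤-trans (PoolBound.bound BY (inj₁ (System.fan⊂Q S Ft)) nct)
                (core-count YP (PoolBound.K BY) (PoolBound.K-Q BY)))
              (ℕ.≤-trans (PoolBound.bound BF (inj₁ Ft) nct)
                (core-count FP (PoolBound.K BF) (PoolBound.K-Q BF))))
          (suc n) cl₀ θr₀ x∉F₀ αx₀ (λ _ → true) (λ _ → refl) (s≤s (∑-≤n (λ _ → true)))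

-- Numerical estimates

-- Here `x` and `y` are the degrees of the root and of the wild neighbour of `r`, each short of Δ by
-- at most `t`. The two copies of `t` are absorbed by the two bounds that contain `a` and `b`.
case₁-arithmetic : ∀ {n D κ t a b x y} → D ≤ x + t → D ≤ y + t → D + x + y ≤ n * 2 + (κ + (κ + (a + b))) →
  t + a ≤ κ → t + b ≤ κ → 3 * D ≤ 2 * n + 4 * κ
case₁-arithmetic {n} {D} {κ} {t} {a} {b} {x} {y} hx hy h ha hb = begin
  3 * D ≡⟨ solve 1 (λ D → con 3 :* D := D :+ D :+ D) refl D ⟩
  D + D + D ≤⟨ ℕ.+-mono-≤ (ℕ.+-monoʳ-≤ D hx) hy ⟩
  D + (x + t) + (y + t) ≡⟨ solve 4 (λ D x y t → D :+ (x :+ t) :+ (y :+ t) := (D :+ x :+ y) :+ (t :+ t)) refl D x y t ⟩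
  (D + x + y) + (t + t) ≤⟨ ℕ.+-monoˡ-≤ (t + t) h ⟩
  n * 2 + (κ + (κ + (a + b))) + (t + t)
    ≡⟨ solve 5 (λ n κ a b t → n :* con 2 :+ (κ :+ (κ :+ (a :+ b))) :+ (t :+ t)
                 := con 2 :* n :+ (κ :+ κ) :+ ((t :+ a) :+ (t :+ b))) refl n κ a b t ⟩
  2 * n + (κ + κ) + ((t + a) + (t + b)) ≤⟨ ℕ.+-monoʳ-≤ (2 * n + (κ + κ)) (ℕ.+-mono-≤ ha hb) ⟩
  2 * n + (κ + κ) + (κ + κ) ≡⟨ solve 2 (λ n κ → con 2 :* n :+ (κ :+ κ) :+ (κ :+ κ) := con 2 :* n :+ con 4 :* κ) refl n κ ⟩
  2 * n + 4 * κ ∎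
  where
  open ℕ.≤-Reasoning
  open +-*-Solver

-- Here `x` and δ are the degree and the deficiency of the wild vertex, and ω counts the remaining
-- vertices not adjacent to `r`.
case₂-arithmetic : ∀ {n D κ ω a b x δ} → x ≤ a + (b + (κ + ω)) → D ≤ x + δ → δ ≤ 1 + (κ + ω) → ω + D + 2 ≤ n →
  a ≤ κ → b ≤ κ → 3 * D ≤ 2 * n + 4 * κ
case₂-arithmetic {n} {D} {κ} {ω} {a} {b} {x} {δ} hx hD hδ hω ha hb = begin
  3 * D ≡⟨ solve 1 (λ D → con 3 :* D := D :+ con 2 :* D) refl D ⟩
  D + 2 * D ≤⟨ ℕ.+-monoˡ-≤ (2 * D) (ℕ.≤-trans hD (ℕ.+-mono-≤
    (ℕ.≤-trans hx (ℕ.+-mono-≤ ha (ℕ.+-monoˡ-≤ (κ + ω) hb))) hδ)) ⟩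
  -- Using `ω + D + 2 ≤ n` twice takes 4 units; the bound on δ provides one of them, and 3 are to
  -- spare.
  κ + (κ + (κ + ω)) + (1 + (κ + ω)) + 2 * D ≤⟨ ℕ.m≤m+n _ 3 ⟩
  κ + (κ + (κ + ω)) + (1 + (κ + ω)) + 2 * D + 3
    ≡⟨ solve 3 (λ κ ω D → κ :+ (κ :+ (κ :+ ω)) :+ (con 1 :+ (κ :+ ω)) :+ con 2 :* D :+ con 3
                 := con 2 :* (ω :+ D :+ con 2) :+ con 4 :* κ) refl κ ω D ⟩
  2 * (ω + D + 2) + 4 * κ ≤⟨ ℕ.+-monoˡ-≤ (4 * κ) (ℕ.*-monoʳ-≤ 2 hω) ⟩
  2 * n + 4 * κ ∎
  where
  open ℕ.≤-Reasoning
  open +-*-Solver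

degree-bound-contradiction : ∀ {n D k κ} → 1 ≤ k → κ ≤ k → 4 * n + 9 * k ≤ 6 * D → 3 * D ≤ 2 * n + 4 * κ → ⊥
degree-bound-contradiction {n} {D} {k} {κ} 1≤k κ≤k h g = ℕ.<-irrefl refl (begin-strict
  4 * n + 9 * k ≤⟨ h ⟩
  6 * D ≡⟨ solve 1 (λ D → con 6 :* D := con 2 :* (con 3 :* D)) refl D ⟩
  2 * (3 * D) ≤⟨ ℕ.*-monoʳ-≤ 2 g ⟩
  2 * (2 * n + 4 * κ) ≤⟨ ℕ.*-monoʳ-≤ 2 (ℕ.+-monoʳ-≤ (2 * n) (ℕ.*-monoʳ-≤ 4 κ≤k)) ⟩
  2 * (2 * n + 4 * k) <⟨ ℕ.+-monoʳ-≤ 1 ℕ.≤-refl ⟩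
  1 + 2 * (2 * n + 4 * k) ≤⟨ ℕ.+-monoˡ-≤ (2 * (2 * n + 4 * k)) 1≤k ⟩
  k + 2 * (2 * n + 4 * k) ≡⟨ solve 2 (λ n k → k :+ con 2 :* (con 2 :* n :+ con 4 :* k) := con 4 :* n :+ con 9 :* k) refl n k ⟩
  4 * n + 9 * k ∎)
  where
  open ℕ.≤-Reasoning
  open +-*-Solver

argmax : ∀ {n} (p : Fin n → Bool) (f : Fin n → ℕ) → (∃ λ i → p i ≡ true) →
  ∃ λ i → p i ≡ true × (∀ j → p j ≡ true → f j ≤ f i)
argmax {suc n} p f (i₀ , h₀) with F.any? (λ i → p (suc i) B.≟ true)
... | no none = zero , first i₀ h₀ , λ { zero _ → ℕ.≤-refl ; (suc j) h → ⊥-elim (none (j , h)) }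
  where
  first : ∀ i → p i ≡ true → p zero ≡ true
  first zero h = h
  first (suc i) h = ⊥-elim (none (i , h))
... | yes ex with argmax (p ∘ suc) (f ∘ suc) ex
...   | i , pi , max with true-or-false (p zero) | ℕ.≤-total (f zero) (f (suc i))
...     | inj₂ h₀′ | _ = suc i , pi , λ { zero h → ⊥-elim (true≢false h h₀′) ; (suc j) h → max j h }
...     | inj₁ _ | inj₁ le = suc i , pi , λ { zero _ → le ; (suc j) h → max j h }
...     | inj₁ h₀′ | inj₂ ge = zero , h₀′ , λ { zero _ → ℕ.≤-refl ; (suc j) h → ℕ.≤-trans (max j h) ge }

-- The two cases for a wild vertex

module Cases {n : ℕ} (G : Graph n) (D : ℕ) (r : Fin n) (no-total : ∀ φ → Centre.Total G D r φ → ⊥)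
  (degrees : ∀ v → Degrees.d G D r v ≤ D) (core-r : Degrees.NC G D r r → ⊥) where

  open Matchings G D
  open Centre G D r
  open Fan G D r no-total
  open Degrees G D r
  open Bounds G D r no-total degrees hiding (κ)

  κ : ℕ
  κ = Bounds.κ G D r no-total degrees core-r

  non-core : ∀ {s φ v} → State s φ → NC s → Missing φ v → v ≢ r → NC v
  non-core st ncs mv v≢r = missing-nc st ncs mv v≢r

  r-unique : ∀ {s φ θ η} → State s φ → m φ θ r ≡ nothing → m φ η r ≡ nothing → θ ≡ η
  r-unique st a b = r-missing-unique st core-r a b

  degree-r : D ≤ d r
  degree-r = ℕ.≮⇒≥ core-r

  deficit : ∀ v → D ≤ d v + def v
  deficit v = ℕ.≤-reflexive (≡sym (ℕ.m+[n∸m]≡n (degrees v)))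

  edge-colour : ∀ {s φ v w} → State s φ → v ≢ r → w ≢ r → adj G v w ≡ true → ∃ λ c → m φ c v ≡ just w
  edge-colour st v≢r w≢r a with cover st a
  ... | inj₁ h = h
  ... | inj₂ (inj₁ (e , _)) = ⊥-elim (v≢r e)
  ... | inj₂ (inj₂ (_ , e)) = ⊥-elim (w≢r e)

  -- Inequalities of numbers are decidable; through this, conclusions obtained under double negation
  -- return to the counts.
  ≤-stable : ∀ {a b} → (¬ a ≤ b → ⊥) → a ≤ b
  ≤-stable {a} {b} h with a ℕ.≤? b
  ... | yes p = p
  ... | no p = ⊥-elim (h p)

  core-along : Maybe V → Bool
  core-along (just w) = core? w
  core-along nothing = false

  module _ {s φ θ α leaf} (st : State s φ) (θr : m φ θ r ≡ nothing) (αs : m φ α s ≡ nothing)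
    (αr : m φ α r ≡ just leaf) (leaf-core : NC leaf → ⊥) where

    -- The colours τ for which an edge `sv` of colour τ does not make `v` a start vertex.
    bad-colour : C → Bool
    bad-colour τ = (τ == θ) ∨ core-along (m φ τ r)

    bad : V → ℕ
    bad v = ∑ (λ τ → ⟦ is-just (m φ τ s) v ∧ bad-colour τ ⟧)

    -- There are at most κ + 1 bad colours, and α is one of them because it leads to the core vertex
    -- `leaf`. As `s` misses α, at most κ remain for the edges at `s`.
    bad-count : ∑ bad ≤ κ
    bad-count = ℕ.+-cancelʳ-≤ 1 _ _ (begin
      ∑ bad + 1 ≡⟨ cong₂ _+_ (∑-swap (λ v τ → ⟦ is-just (m φ τ s) v ∧ bad-colour τ ⟧)) (≡sym (∑-δ α)) ⟩
      ∑ row + ∑ (λ τ → ⟦ τ == α ⟧) ≡⟨ ≡sym (∑-+ row (λ τ → ⟦ τ == α ⟧)) ⟩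
      ∑ (λ τ → row τ + ⟦ τ == α ⟧) ≤⟨ ∑-mono pointwise ⟩
      ∑ (λ τ → target τ + ⟦ τ == θ ⟧) ≡⟨ ∑-+ target (λ τ → ⟦ τ == θ ⟧) ⟩
      ∑ target + ∑ (λ τ → ⟦ τ == θ ⟧) ≤⟨ ℕ.+-mono-≤ (∑-image (λ τ → m φ τ r) (uniq φ) core?
          (λ w → adj G r w ∧ core? w) (λ e c → ∧-intro (edge φ e) c)) (ℕ.≤-reflexive (∑-δ θ)) ⟩
      κ + 1 ∎)
      where
      open ℕ.≤-Reasoning
      row target : C → ℕ
      row τ = ∑ (λ v → ⟦ is-just (m φ τ s) v ∧ bad-colour τ ⟧)
      target τ = ∑ (λ w → ⟦ is-just (m φ τ r) w ∧ core? w ⟧)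
      row≤1 : ∀ τ → row τ ≤ 1
      row≤1 τ = ∑-unique (λ v → is-just (m φ τ s) v ∧ bad-colour τ) λ v w a b →
        just-injective (trans (≡sym (is-just-true {x = m φ τ s} (∧-true₁ a))) (is-just-true {x = m φ τ s} (∧-true₁ b)))
      hit-target : ∀ {τ} → core-along (m φ τ r) ≡ true → 1 ≤ target τ
      hit-target {τ} h with just-or-nothing (m φ τ r)
      ... | inj₂ e = ⊥-elim (true≢false h (cong core-along e))
      ... | inj₁ (w , e) = ∑-pos (λ w → is-just (m φ τ r) w ∧ core? w) w
              (∧-intro (is-just-intro e) (trans (≡sym (cong core-along e)) h))
      pointwise : ∀ τ → row τ + ⟦ τ == α ⟧ ≤ target τ + ⟦ τ == θ ⟧
      pointwise τ with same? τ α
      ... | inj₁ refl = ℕ.≤-trans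
            (ℕ.+-mono-≤ (ℕ.≤-reflexive (∑-none (λ v → is-just (m φ τ s) v ∧ bad-colour τ)
              (λ v h → just≢nothing (is-just-true {x = m φ τ s} (∧-true₁ h)) αs))) (⟦⟧≤1 (τ == α)))
            (ℕ.≤-trans (hit-target (trans (cong core-along αr) (core-intro leaf-core))) (ℕ.m≤m+n _ _))
      ... | inj₂ τ≢α = ℕ.≤-trans (ℕ.≤-reflexive (trans (cong (row τ +_) (⟦⟧-false (τ≢α ∘ ==-true))) (ℕ.+-identityʳ _)))
            (cases (true-or-false (τ == θ)) (true-or-false (core-along (m φ τ r))))
        where
        cases : (τ == θ) ≡ true ⊎ (τ == θ) ≡ false → core-along (m φ τ r) ≡ true ⊎ core-along (m φ τ r) ≡ false →
          row τ ≤ target τ + ⟦ τ == θ ⟧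
        cases (inj₁ h) _ = ℕ.≤-trans (row≤1 τ) (ℕ.≤-trans (ℕ.≤-reflexive (≡sym (⟦⟧-true h))) (ℕ.m≤n+m _ _))
        cases _ (inj₁ h) = ℕ.≤-trans (row≤1 τ) (ℕ.≤-trans (hit-target h) (ℕ.m≤m+n _ _))
        cases (inj₂ h) (inj₂ g) = ℕ.≤-trans (ℕ.≤-reflexive (∑-none (λ v → is-just (m φ τ s) v ∧ bad-colour τ)
          (λ v e → true≢false (∧-true₂ {is-just (m φ τ s) v} e) (cong₂ _∨_ h g)))) z≤n

    -- In the sum of the degrees of `r`, `s` and `x`, a vertex exceeds its share of 2 only if it is
    -- adjacent to all three; the remaining terms pay for such vertices.
    common-neighbours : ∀ {x} (A B : V → Bool) → x ≢ r →
      (∀ {v τ} → adj G r v ≡ true → adj G x v ≡ true → NC v → m φ τ s ≡ just v → bad-colour τ ≡ false →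
        1 ≤ ⟦ A v ⟧ + ⟦ B v ⟧) →
      D + d s + d x ≤ n * 2 + (κ + (κ + (∑ (λ v → ⟦ A v ⟧) + ∑ (λ v → ⟦ B v ⟧))))
    common-neighbours {x} A B x≢r good = begin
      D + d s + d x ≤⟨ ℕ.+-monoˡ-≤ (d x) (ℕ.+-monoˡ-≤ (d s) degree-r) ⟩
      d r + d s + d x ≡⟨ ≡sym (trans (∑-+ (λ v → ⟦ adj G r v ⟧ + ⟦ adj G s v ⟧) (λ v → ⟦ adj G x v ⟧))
                            (cong (_+ d x) (∑-+ (λ v → ⟦ adj G r v ⟧) (λ v → ⟦ adj G s v ⟧)))) ⟩
      ∑ (λ v → ⟦ adj G r v ⟧ + ⟦ adj G s v ⟧ + ⟦ adj G x v ⟧) ≤⟨ ∑-mono pointwise ⟩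
      ∑ (λ v → 2 + (⟦ core′ v ⟧ + (bad v + (⟦ A v ⟧ + ⟦ B v ⟧)))) ≡⟨ sums ⟩
      n * 2 + (κ + (∑ bad + (∑ (λ v → ⟦ A v ⟧) + ∑ (λ v → ⟦ B v ⟧))))
        ≤⟨ ℕ.+-monoʳ-≤ (n * 2) (ℕ.+-monoʳ-≤ κ (ℕ.+-monoˡ-≤ _ bad-count)) ⟩
      n * 2 + (κ + (κ + (∑ (λ v → ⟦ A v ⟧) + ∑ (λ v → ⟦ B v ⟧)))) ∎
      where
      open ℕ.≤-Reasoning
      core′ : V → Bool
      core′ v = adj G r v ∧ core? v
      sums : ∑ (λ v → 2 + (⟦ core′ v ⟧ + (bad v + (⟦ A v ⟧ + ⟦ B v ⟧)))) ≡
        n * 2 + (κ + (∑ bad + (∑ (λ v → ⟦ A v ⟧) + ∑ (λ v → ⟦ B v ⟧))))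
      sums = trans (∑-+ (λ _ → 2) (λ v → ⟦ core′ v ⟧ + (bad v + (⟦ A v ⟧ + ⟦ B v ⟧)))) (cong₂ _+_ (∑-const n 2)
        (trans (∑-+ (λ v → ⟦ core′ v ⟧) (λ v → bad v + (⟦ A v ⟧ + ⟦ B v ⟧))) (cong (κ +_)
          (trans (∑-+ bad (λ v → ⟦ A v ⟧ + ⟦ B v ⟧)) (cong (∑ bad +_) (∑-+ (λ v → ⟦ A v ⟧) (λ v → ⟦ B v ⟧)))))))
      pointwise : ∀ v → ⟦ adj G r v ⟧ + ⟦ adj G s v ⟧ + ⟦ adj G x v ⟧ ≤ 2 + (⟦ core′ v ⟧ + (bad v + (⟦ A v ⟧ + ⟦ B v ⟧)))
      pointwise v with true-or-false (adj G r v) | true-or-false (adj G s v) | true-or-false (adj G x v)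
      ... | inj₂ a | _ | _ rewrite a = ℕ.≤-trans (ℕ.+-mono-≤ (⟦⟧≤1 (adj G s v)) (⟦⟧≤1 (adj G x v))) (ℕ.m≤m+n 2 _)
      ... | inj₁ _ | inj₂ a | _ rewrite a = ℕ.≤-trans
            (ℕ.+-mono-≤ (ℕ.+-mono-≤ (⟦⟧≤1 (adj G r v)) (z≤n {0})) (⟦⟧≤1 (adj G x v))) (ℕ.m≤m+n 2 _)
      ... | inj₁ _ | inj₁ _ | inj₂ a rewrite a = ℕ.≤-trans
            (ℕ.+-mono-≤ (ℕ.+-mono-≤ (⟦⟧≤1 (adj G r v)) (⟦⟧≤1 (adj G s v))) (z≤n {0})) (ℕ.m≤m+n 2 _)
      ... | inj₁ a | inj₁ b | inj₁ c = ℕ.≤-trans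
            (ℕ.+-mono-≤ (ℕ.+-mono-≤ (⟦⟧≤1 (adj G r v)) (⟦⟧≤1 (adj G s v))) (⟦⟧≤1 (adj G x v)))
            (ℕ.+-monoʳ-≤ 2 (one (true-or-false (core? v))))
        where
        v≢r : v ≢ r
        v≢r e = adj-irrefl a (≡sym e)
        one : core? v ≡ true ⊎ core? v ≡ false → 1 ≤ ⟦ core′ v ⟧ + (bad v + (⟦ A v ⟧ + ⟦ B v ⟧))
        one (inj₁ h) = ℕ.≤-trans (ℕ.≤-reflexive (≡sym (⟦⟧-true (∧-intro a h)))) (ℕ.m≤m+n _ _)
        one (inj₂ h) with edge-colour st (λ e → adj-irrefl (rs st) (≡sym e)) v≢r b
        ... | τ , τs with true-or-false (bad-colour τ)
        ...   | inj₁ g = ℕ.≤-trans (∑-pos (λ τ → is-just (m φ τ s) v ∧ bad-colour τ) τ (∧-intro (is-just-intro τs) g))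
                  (ℕ.≤-trans (ℕ.m≤m+n (bad v) _) (ℕ.m≤n+m _ ⟦ core′ v ⟧))
        ...   | inj₂ g = ℕ.≤-trans (good a c ncv τs g) (ℕ.≤-trans (ℕ.m≤n+m _ (bad v)) (ℕ.m≤n+m _ ⟦ core′ v ⟧))
          where
          ncv : NC v
          ncv = ≤-stable λ nc → true≢false (core-intro {v} nc) h

  module AtRoot {s} (ncs : NC s) (rs′ : adj G r s ≡ true) (big : V → Bool) (α β : C) (α≢β : α ≢ β) (leaf : V)
    (leaf-core : NC leaf → ⊥) (t : V) (nct : NC t) (bt : big t ≡ true)
    (def-max : ∀ v → NC v → adj G r v ≡ true → def v ≤ def t) (large : 3 * D ≤ 2 * n + 4 * κ → ⊥) where

    open Robust G D r no-total NC missing two s ncs big α β leaf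
    open StartSets G D r no-total NC missing two non-core r-unique s ncs big α β leaf leaf-core

    module _ (maximal : ∀ {s′ φ θ x} → State s′ φ → NC s′ → m φ θ r ≡ nothing → x ≢ r → m φ θ x ≡ nothing → InF s′ φ t →
      (S : V → Bool) → (∀ {v} → S v ≡ true → InF s′ φ v) → ∑ (λ v → ⟦ big v ⟧) < ∑ (λ v → ⟦ S v ⟧) → ⊥) where

      -- Both `s` and `x` are non-core neighbours of `r` here, so `def t` bounds their deficiencies.
      -- A common neighbour joined to `s` by a colour that is not bad is a start vertex, unless it
      -- already lies in the fan.
      case₁ : ∀ {φ θ x} → Cls φ → m φ θ r ≡ nothing → NC x → adj G r x ≡ true → F∌ φ x → m φ α x ≡ nothing → ⊥
      case₁ {x = x} cl₀ θr₀ ncx rx x∉F₀ αx₀ = neighbour-sets core-r ncs rs′ big α β α≢β leaf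
        (RootNeighbours.starts t nct bt maximal) x≢r nct bt
        (λ {φ} {θ} A B cl θr x∉F αx fA fB bA bB →
          let open Cls cl
              good : ∀ {v τ} → adj G r v ≡ true → adj G x v ≡ true → NC v → m φ τ s ≡ just v →
                bad-colour state θr αs αr leaf-core τ ≡ false → 1 ≤ ⟦ A v ⟧ + ⟦ B v ⟧
              good {v} {τ} rv xv ncv τs nb = ≤-stable λ h →
                let (ρ , e) = edge-colour state (λ e → adj-irrefl rv (≡sym e)) x≢r (adj-sym xv) in
                by-cases (InF s φ v)
                  (λ Fv → h (ℕ.≤-trans (ℕ.≤-reflexive (≡sym (⟦⟧-true (fB Fv ncv e)))) (ℕ.m≤n+m _ ⟦ A v ⟧)))
                  (λ v∉F → h (ℕ.≤-trans (ℕ.≤-reflexive (≡sym (⟦⟧-true (fA ((ncv , rv) , τ , along cl θr τs nb) v∉F e)))) (ℕ.m≤m+n _ _)))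
          in large (case₁-arithmetic {n} {D} {κ} {def t}
               (ℕ.≤-trans (deficit s) (ℕ.+-monoʳ-≤ (d s) (def-max s ncs rs′)))
               (ℕ.≤-trans (deficit x) (ℕ.+-monoʳ-≤ (d x) (def-max x ncx rx)))
               (common-neighbours state θr αs αr leaf-core A B x≢r good) bA bB))
        cl₀ θr₀ x∉F₀ αx₀
        where
        x≢r : x ≢ r
        x≢r e = adj-irrefl rx (≡sym e)
        along : ∀ {φ θ τ v} (cl : Cls φ) (θr : m φ θ r ≡ nothing) → m φ τ s ≡ just v →
          bad-colour (Cls.state cl) θr (Cls.αs cl) (Cls.αr cl) leaf-core τ ≡ false →
          ∃ λ z → m φ τ s ≡ just v × m φ τ r ≡ just z × NC z
        along {φ} {θ} {τ} cl θr τs nb with just-or-nothing (m φ τ r)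
        ... | inj₂ h = ⊥-elim (true≢false (∨-intro₁ (==-refl (r-unique (Cls.state cl) h θr))) nb)
        ... | inj₁ (z , h) = z , τs , h , ≤-stable λ nc → true≢false
                (∨-intro₂ {τ == θ} (trans (cong core-along h) (core-intro nc))) nb

    -- As `x` is not adjacent to `r`, the choice of `t` says nothing about its degree. The
    -- hypothesis on `def x` takes over, and all non-core neighbours of `r` are start vertices.
    case₂ : (∀ {φ θ y c} → Cls φ → m φ θ r ≡ nothing → NC y × adj G r y ≡ true → F∌ φ y → m φ c y ≡ nothing →
        Wild s φ θ c → ⊥) →
      ∀ {φ θ x} → Cls φ → m φ θ r ≡ nothing → NC x → x ≢ r → adj G r x ≡ false → F∌ φ x → m φ α x ≡ nothing →
      def x ≤ 1 + (κ + ∑ (λ v → ⟦ not (adj G r v) ∧ (not (v == r) ∧ not (v == x)) ⟧)) → ⊥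
    case₂ none {x = x} cl₀ θr₀ ncx x≢r rx x∉F₀ αx₀ hδ = neighbour-sets core-r ncs rs′ big α β α≢β leaf
      (AllNeighbours.starts none) x≢r nct bt
      (λ {φ} {θ} A B cl θr x∉F αx fA fB bA bB →
        let open Cls cl
            good : ∀ {v} → adj G r v ≡ true → adj G x v ≡ true → NC v → 1 ≤ ⟦ A v ⟧ + ⟦ B v ⟧
            good {v} rv xv ncv = ≤-stable λ h →
              let (ρ , e) = edge-colour state (λ e → adj-irrefl rv (≡sym e)) x≢r (adj-sym xv) in
              by-cases (InF s φ v)
                (λ Fv → h (ℕ.≤-trans (ℕ.≤-reflexive (≡sym (⟦⟧-true (fB Fv ncv e)))) (ℕ.m≤n+m _ ⟦ A v ⟧)))
                (λ v∉F → h (ℕ.≤-trans (ℕ.≤-reflexive (≡sym (⟦⟧-true (fA (ncv , rv) v∉F e)))) (ℕ.m≤m+n _ _)))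
        in large (case₂-arithmetic {n} {D} {κ} (neighbours A B good) (deficit x) hδ outer-count
             (ℕ.m+n≤o⇒n≤o (def t) bA) (ℕ.m+n≤o⇒n≤o (def t) bB)))
      cl₀ θr₀ x∉F₀ αx₀
      where
      outer core′ : V → Bool
      outer v = not (adj G r v) ∧ (not (v == r) ∧ not (v == x))
      core′ v = adj G r v ∧ core? v
      outer-count : ∑ (λ v → ⟦ outer v ⟧) + D + 2 ≤ n
      outer-count = begin
        ∑ (λ v → ⟦ outer v ⟧) + D + 2 ≤⟨ ℕ.+-monoˡ-≤ 2 (ℕ.+-monoʳ-≤ (∑ (λ v → ⟦ outer v ⟧)) degree-r) ⟩
        ∑ (λ v → ⟦ outer v ⟧) + d r + 2 ≡⟨ cong₂ _+_ (≡sym (∑-+ (λ v → ⟦ outer v ⟧) (λ v → ⟦ adj G r v ⟧)))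
          (≡sym (trans (∑-+ (λ v → ⟦ v == r ⟧) (λ v → ⟦ v == x ⟧)) (cong₂ _+_ (∑-δ r) (∑-δ x)))) ⟩
        ∑ (λ v → ⟦ outer v ⟧ + ⟦ adj G r v ⟧) + ∑ (λ v → ⟦ v == r ⟧ + ⟦ v == x ⟧)
          ≡⟨ ≡sym (∑-+ (λ v → ⟦ outer v ⟧ + ⟦ adj G r v ⟧) (λ v → ⟦ v == r ⟧ + ⟦ v == x ⟧)) ⟩
        ∑ (λ v → ⟦ outer v ⟧ + ⟦ adj G r v ⟧ + (⟦ v == r ⟧ + ⟦ v == x ⟧)) ≤⟨ ∑-mono pointwise ⟩
        ∑ {n} (λ _ → 1) ≡⟨ trans (∑-const n 1) (ℕ.*-identityʳ n) ⟩
        n ∎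
        where
        open ℕ.≤-Reasoning
        pointwise : ∀ v → ⟦ outer v ⟧ + ⟦ adj G r v ⟧ + (⟦ v == r ⟧ + ⟦ v == x ⟧) ≤ 1
        pointwise v with v ≟ r | v ≟ x
        ... | yes refl | yes e = ⊥-elim (x≢r (≡sym e))
        ... | yes refl | no _ rewrite irref G r = ℕ.≤-refl
        ... | no _ | yes refl rewrite rx = ℕ.≤-refl
        ... | no _ | no _ with adj G r v
        ...   | true = ℕ.≤-refl
        ...   | false = ℕ.≤-refl
      neighbours : (A B : V → Bool) → (∀ {v} → adj G r v ≡ true → adj G x v ≡ true → NC v → 1 ≤ ⟦ A v ⟧ + ⟦ B v ⟧) →
        d x ≤ ∑ (λ v → ⟦ A v ⟧) + (∑ (λ v → ⟦ B v ⟧) + (κ + ∑ (λ v → ⟦ outer v ⟧)))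
      neighbours A B good = ℕ.≤-trans (∑-mono pointwise) (ℕ.≤-reflexive
        (trans (∑-+ (λ v → ⟦ A v ⟧) (λ v → ⟦ B v ⟧ + (⟦ core′ v ⟧ + ⟦ outer v ⟧))) (cong (∑ (λ v → ⟦ A v ⟧) +_)
          (trans (∑-+ (λ v → ⟦ B v ⟧) (λ v → ⟦ core′ v ⟧ + ⟦ outer v ⟧)) (cong (∑ (λ v → ⟦ B v ⟧) +_)
            (∑-+ (λ v → ⟦ core′ v ⟧) (λ v → ⟦ outer v ⟧)))))))
        where
        pointwise : ∀ v → ⟦ adj G x v ⟧ ≤ ⟦ A v ⟧ + (⟦ B v ⟧ + (⟦ core′ v ⟧ + ⟦ outer v ⟧))
        pointwise v = ⟦⟧-mono λ xv → one xv (true-or-false (adj G r v)) (true-or-false (core? v))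
          where
          one : adj G x v ≡ true → adj G r v ≡ true ⊎ adj G r v ≡ false → core? v ≡ true ⊎ core? v ≡ false →
            1 ≤ ⟦ A v ⟧ + (⟦ B v ⟧ + (⟦ core′ v ⟧ + ⟦ outer v ⟧))
          one xv (inj₂ a) _ = ℕ.≤-trans (ℕ.≤-reflexive (≡sym (⟦⟧-true (∧-intro (cong not a)
              (∧-intro (cong not (not-true λ h → true≢false (adj-sym (subst (λ w → adj G x w ≡ true) (==-true h) xv)) rx))
                       (cong not (not-true λ h → adj-irrefl xv (≡sym (==-true h)))))))))
              (ℕ.≤-trans (ℕ.m≤n+m _ ⟦ core′ v ⟧) (ℕ.≤-trans (ℕ.m≤n+m _ ⟦ B v ⟧) (ℕ.m≤n+m _ ⟦ A v ⟧)))
          one xv (inj₁ a) (inj₁ c) = ℕ.≤-trans (ℕ.≤-reflexive (≡sym (⟦⟧-true (∧-intro a c))))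
              (ℕ.≤-trans (ℕ.m≤m+n _ ⟦ outer v ⟧) (ℕ.≤-trans (ℕ.m≤n+m _ ⟦ B v ⟧) (ℕ.m≤n+m _ ⟦ A v ⟧)))
          one xv (inj₁ a) (inj₂ c) = ℕ.≤-trans (good a xv (≤-stable λ nc → true≢false (core-intro {v} nc) c))
              (ℕ.≤-trans (ℕ.m≤m+n _ _) (ℕ.≤-reflexive (ℕ.+-assoc ⟦ A v ⟧ ⟦ B v ⟧ _)))

-- Choice of a largest fan

module Extremal {n : ℕ} (G : Graph n) (D : ℕ) (r : Fin n) (no-total : ∀ φ → Centre.Total G D r φ → ⊥)
  (degrees : ∀ v → Degrees.d G D r v ≤ D) (core-r : Degrees.NC G D r r → ⊥)
  (large : 3 * D ≤ 2 * n + 4 * Cases.κ G D r no-total degrees core-r → ⊥)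
  (outer-bound : ∀ x → Degrees.NC G D r x → x ≢ r →
    (Degrees.def G D r x ≤ 1 + (Cases.κ G D r no-total degrees core-r +
      ∑ (λ v → ⟦ not (adj G r v) ∧ (not (v == r) ∧ not (v == x)) ⟧)) → ⊥) → ⊥)
  (t : Fin n) (nct : Degrees.NC G D r t)
  (def-max : ∀ v → Degrees.NC G D r v → adj G r v ≡ true → Degrees.def G D r v ≤ Degrees.def G D r t) where

  open Matchings G D
  open Centre G D r
  open Fan G D r no-total
  open Degrees G D r
  open Bounds G D r no-total degrees using (missing; two; fan-core-count)
  open Cases G D r no-total degrees core-r using (non-core; module AtRoot)

  record Conflict (s : V) (φ : Col) (θ : C) (x : V) : Set where
    field
      state : State s φ
      ncs : NC s
      θr : m φ θ r ≡ nothing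
      x≢r : x ≢ r
      θx : m φ θ x ≡ nothing
      t∈ : InF s φ t

    x∉F : InF s φ x → ⊥
    x∉F Fx = fan-disjoint-r s state θr Fx θx

  module Rooted {s : V} (ncs : NC s) (rs′ : adj G r s ≡ true) (big : V → Bool) (α β : C) (α≢β : α ≢ β) (leaf : V)
    (leaf-core : NC leaf → ⊥) (bt : big t ≡ true)
    (maximal : ∀ {s′ φ θ x} → Conflict s′ φ θ x → (S : V → Bool) → (∀ {v} → S v ≡ true → InF s′ φ v) →
      ∑ (λ v → ⟦ big v ⟧) < ∑ (λ v → ⟦ S v ⟧) → ⊥) where

    open Robust G D r no-total NC missing two s ncs big α β leaf
    open AtRoot ncs rs′ big α β α≢β leaf leaf-core t nct bt def-max large

    move-to-α : ∀ {φ θ y c} → Cls φ → m φ θ r ≡ nothing → y ≢ r → F∌ φ y → m φ c y ≡ nothing → Wild s φ θ c →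
      (∀ {ψ} → Cls ψ → m ψ θ r ≡ nothing → F∌ ψ y → m ψ α y ≡ nothing → ⊥) → ⊥
    move-to-α cl θr y≢r y∉F cy (inj₁ refl) k =
      wild-chain (Cls.state cl) θr (s , root∈ , Cls.αs cl) (inj₁ cy) y∉F y≢r λ T W Ty _ →
        let open Away W in k (cls-away cl W) (r-same θr) (y∉F ∘ fan⊃) (in-γ Ty cy)
    move-to-α cl θr y≢r y∉F cy (inj₂ H) k =
      wild-chain (Cls.state cl) θr H (inj₂ cy) y∉F y≢r λ T W Ty _ →
        let open Away W in
        move-to-α (cls-away cl W) (r-same θr) y≢r (y∉F ∘ fan⊃) (in-θ Ty cy) (inj₁ refl) k

    WildNeighbour : Set
    WildNeighbour = ∃ λ φ → ∃ λ θ → ∃ λ y → ∃ λ c →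
      Cls φ × m φ θ r ≡ nothing × (NC y × adj G r y ≡ true) × F∌ φ y × m φ c y ≡ nothing × Wild s φ θ c

    no-conflict : ∀ {φ θ x} → Cls φ → Conflict s φ θ x → ⊥
    no-conflict {x = x} cl cf = by-cases WildNeighbour
      (λ { (_ , _ , y , _ , cl′ , θr′ , (ncy , ry) , y∉F , cy , w) →
        move-to-α cl′ θr′ (λ e → adj-irrefl ry (≡sym e)) y∉F cy w λ cl₁ θr₁ y∉F₁ αy →
          case₁ (λ st ncs θr x≢r θx t∈ → maximal record
                   { state = st ; ncs = ncs ; θr = θr ; x≢r = x≢r ; θx = θx ; t∈ = t∈ })
            cl₁ θr₁ ncy ry y∉F₁ αy })
      (λ none → outer-bound x ncx x≢r λ le →
        move-to-α cl θr x≢r x∉F θx (inj₁ refl) λ cl₁ θr₁ x∉F₁ αx →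
          case₂ (λ cl θr p y∉F cy w → none (_ , _ , _ , _ , cl , θr , p , y∉F , cy , w)) cl₁ θr₁ ncx x≢r
            (not-true λ rx → none (_ , _ , _ , _ , cl , θr , (ncx , rx) , x∉F , θx , inj₁ refl)) x∉F₁ αx le)
      where
      open Conflict cf hiding (ncs)
      ncx : NC x
      ncx = non-core state ncs (_ , θx) x≢r

  other-missing : ∀ {φ v} c → Two φ v → ∃ λ b → c ≢ b × m φ b v ≡ nothing
  other-missing c (a , b , a≢b , av , bv) with same? c a
  ... | inj₁ refl = b , a≢b , bv
  ... | inj₂ c≢a = a , c≢a , av

  -- Every vertex of such a path misses a colour, and a core vertex other than `r` in the fan would
  -- miss none.
  avoid-core : ∀ {s φ w k q} → State s φ → NC s → (NC w → ⊥) → Path φ (λ z → z ≡ s) Any k q → Missing φ q →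
    Path φ (λ z → z ≡ s) (λ _ _ z → z ≢ w) k q
  avoid-core st ncs core-w (here e) _ = here e
  avoid-core st ncs core-w (arc t a b _) mq = arc (avoid-core st ncs core-w t (_ , a)) a b
    λ { refl → core-w (non-core st ncs mq (λ { refl → fan≢r st (_ , arc t a b tt) refl })) }

  -- As `s` is not a core vertex, its deficiency forces a core vertex `w` into the fan. If the last
  -- arc into `w` comes from `p` and has colour `c`, the uncoloured edge is moved to `rp` along a
  -- path that avoids `w`, so that `rw` keeps its colour; then `p`, `c` and `w` serve as root, α and
  -- leaf.
  maximal-conflict : ∀ {s φ θ x} → Conflict s φ θ x →
    (S : V → Bool) → (∀ {v} → S v ≡ true → InF s φ v) →
    (∀ {s′ φ θ x} → Conflict s′ φ θ x → (S′ : V → Bool) → (∀ {v} → S′ v ≡ true → InF s′ φ v) →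
      ∑ (λ v → ⟦ S v ⟧) < ∑ (λ v → ⟦ S′ v ⟧) → ⊥) → ⊥
  maximal-conflict {s} {φ} {θ} {x} cf S S⊂ maximal = as-bool (InF s φ) λ big big⊂ ⊂big →
    fan-core-count state ncs θr λ K K⊂ le →
      let (w , h) = ∑-find (λ v → K v ∧ core? v) (ℕ.≤-trans (ℕ.m<n⇒0<n∸m ncs) le) in
      through big big⊂ ⊂big (core-elim (∧-true₂ {K w} h)) (K⊂ (∧-true₁ h))
    where
    open Conflict cf
    through : (big : V → Bool) → (∀ {v} → big v ≡ true → InF s φ v) → (∀ {v} → InF s φ v → big v ≡ true) →
      ∀ {w} → (NC w → ⊥) → InF s φ w → ⊥
    through big big⊂ ⊂big core-w (_ , here refl) = core-w ncs
    through big big⊂ ⊂big {w} core-w (_ , arc {k} {p} {c} path cp cw _) =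
      let w≢r = λ e → adj-irrefl (edge φ cw) (≡sym e)
          (ψ , R , fixed) = reroot′ (suc k) (λ z → z ≡ w) ℕ.≤-refl state (two state ncs) (λ { refl → core-w ncs })
            (c , cp) (avoid-core state ncs core-w path (c , cp))
          open Rerooted R renaming (state to state′; two to two′)
          ncp = non-core state ncs (c , cp) (fan≢r state (k , path))
          (β , c≢β , βp) = other-missing {ψ} c two′
      in Rooted.no-conflict ncp (rs state′) big c β c≢β w core-w (⊂big t∈)
           (λ cf′ S′ S′⊂ lt → maximal cf′ S′ S′⊂
             (ℕ.≤-<-trans (∑-⊂ S big (λ e → ⊂big (S⊂ e))) lt))
           record { state = state′ ; big⊂ = fan⊂ ∘ big⊂ ; αs = keep cp ; βs = βp
                  ; αr = inv ψ (trans (fixed refl w≢r) (inv φ cw)) }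
           record { state = state′ ; ncs = ncp ; θr = r-keep θr ; x≢r = x≢r ; θx = trans (out x∉F x≢r) θx
                  ; t∈ = fan⊂ t∈ }

  -- `N` bounds how often the set can still be enlarged: at 0 the set would have more than `n`
  -- elements.
  grow : ∀ N {s φ θ x} → Conflict s φ θ x → (S : V → Bool) → (∀ {v} → S v ≡ true → InF s φ v) →
    n < ∑ (λ v → ⟦ S v ⟧) + N → ⊥
  grow zero cf S S⊂ lt = ℕ.<⇒≱ lt (ℕ.≤-trans (ℕ.≤-reflexive (ℕ.+-identityʳ _)) (∑-≤n S))
  grow (suc N) cf S S⊂ lt = maximal-conflict cf S S⊂ λ cf′ S′ S′⊂ lt′ →
    grow N cf′ S′ S′⊂ (ℕ.<-≤-trans lt (ℕ.≤-trans (ℕ.≤-reflexive (ℕ.+-suc _ N)) (ℕ.+-monoˡ-≤ N lt′)))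

  conflict-free : ∀ {s φ θ x} → Conflict s φ θ x → ⊥
  conflict-free cf = grow (suc n) cf (λ _ → false) (λ ()) (ℕ.m≤n+m (suc n) _)

-- Critical graphs and conclusion

⊔-lub : ∀ {k} {A : Set} (g : A → ℕ) (f : Fin k → A) {b} → (∀ i → g (f i) ≤ b) → foldr _⊔_ 0 (map g (tabulate f)) ≤ b
⊔-lub {zero} g f h = z≤n
⊔-lub {suc k} g f h = ℕ.⊔-lub (h zero) (⊔-lub g (f ∘ suc) (h ∘ suc))

module _ {n : ℕ} (G : Graph n) (critical : Critical G) (class2 : Class2 G) (k : ℕ) (1≤k : 1 ≤ k)
  (dense : 4 * n + 9 * k ≤ 6 * maxDeg G) where

  private
    D : ℕ
    D = maxDeg G

  open Matchings G D

  deg-∑ : ∀ v → deg G v ≡ ∑ (λ w → ⟦ adj G v w ⟧)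
  deg-∑ v = countFin-∑ n (adj G v)

  degree≤D : ∀ v → ∑ (λ w → ⟦ adj G v w ⟧) ≤ D
  degree≤D v = ℕ.≤-trans (ℕ.≤-reflexive (≡sym (deg-∑ v))) (⊔-upper (deg G) id v)

  D≤n : D ≤ n
  D≤n = ⊔-lub (deg G) id (λ v → ℕ.≤-trans (ℕ.≤-reflexive (deg-∑ v)) (∑-≤n (adj G v)))

  k<D : k < D
  k<D = ℕ.≰⇒> λ D≤k → ℕ.<-irrefl refl (begin-strict
    9 * k ≤⟨ ℕ.m≤n+m (9 * k) (4 * n) ⟩
    4 * n + 9 * k ≤⟨ dense ⟩
    6 * D ≤⟨ ℕ.*-monoʳ-≤ 6 D≤k ⟩
    6 * k <⟨ ℕ.m<n+m (6 * k) (ℕ.≤-trans 1≤k (ℕ.m≤m+n k _)) ⟩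
    3 * k + 6 * k ≡⟨ ≡sym (ℕ.*-distribʳ-+ k 3 6) ⟩
    9 * k ∎)
    where open ℕ.≤-Reasoning

  no-total : ∀ φ → (∀ {v w} → adj G v w ≡ true → ∃ λ c → m φ c v ≡ just w) → ⊥
  no-total φ total = proj₂ class2 D ℕ.≤-refl
    (Conversion.total-colourable G D (F.fromℕ< (ℕ.≤-trans (s≤s z≤n) k<D)) φ total)

  -- If deleting `rs` did not allow a colouring with Δ colours, the chromatic index would stay at Δ
  -- + 1, against criticality.
  state-exists : ∀ {r s} → adj G r s ≡ true → (∀ {φ} → Centre.State G D r s φ → ⊥) → ⊥
  state-exists {r} {s} ars none = ℕ.<-irrefl refl (critical deleted deleted-proper (suc D) (suc D)
    (restrict (proj₁ class2) , λ { j (s≤s j≤D) col →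
      none (proj₂ (colourable-state (Conversion.colourable-mono G D j≤D col))) }) class2)
    where
    open Conversion.Deleted G D r s ars
    restrict : ∀ {j} → Colourable (adj G) j → Colourable (es deleted) j
    restrict (c , symmetric , proper) = c , (λ v w e → symmetric v w (∧-true₁ e))
      , λ v w u e f → proper v w u (∧-true₁ e) (∧-true₁ f)

  -- Removing an isolated vertex gives a proper subgraph with the same edges and hence the same
  -- chromatic index.
  not-isolated : ∀ x → ∃ λ y → adj G x y ≡ true
  not-isolated x with F.any? (λ y → adj G x y B.≟ true)
  ... | yes h = h
  ... | no none = ⊥-elim (ℕ.<-irrefl refl (critical without-x (inj₁ (x , cong not (==-refl {i = x} refl)))
          (suc D) (suc D) class2 class2))
    where
    without-x : Subgraph G
    without-x = record
      { vs = λ v → not (v == x) ; es = adj G ; esSym = sym G ; esSub = λ _ _ → id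
      ; esEnd = λ v w a → cong not (not-true λ e → none (w , subst (λ u → adj G u w ≡ true) (==-true e) a)) }

  module AtCore (r : V) (in-core : inCore G r ≡ true) (few : coreDeg G r ≤ k) where

    open Centre G D r
    open Degrees G D r

    inCore-elim : ∀ {v} → inCore G v ≡ true → deg G v ≡ D
    inCore-elim {v} h with deg G v ℕ.≟ D
    ... | yes e = e
    ... | no _ = case h of λ ()

    inCore-intro : ∀ {v} → deg G v ≡ D → inCore G v ≡ true
    inCore-intro {v} e with deg G v ℕ.≟ D
    ... | yes _ = refl
    ... | no ne = ⊥-elim (ne e)

    core-r : NC r → ⊥
    core-r nc = ℕ.<-irrefl (trans (≡sym (deg-∑ r)) (inCore-elim in-core)) nc

    open Cases G D r no-total degree≤D core-r using (κ; ≤-stable)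

    κ≤k : κ ≤ k
    κ≤k = ℕ.≤-trans (∑-⊂ (λ v → adj G r v ∧ core? v) (λ v → adj G r v ∧ inCore G v) λ {v} h → ∧-intro (∧-true₁ h)
        (inCore-intro (trans (deg-∑ v) (ℕ.≤-antisym (degree≤D v) (ℕ.≮⇒≥ (core-elim (∧-true₂ {adj G r v} h)))))))
      (ℕ.≤-trans (ℕ.≤-reflexive (≡sym (countFin-∑ n (λ u → adj G r u ∧ inCore G u)))) few)

    nc-neighbour : V → Bool
    nc-neighbour v = adj G r v ∧ not (core? v)

    nc-elim : ∀ {v} → nc-neighbour v ≡ true → NC v
    nc-elim {v} h = ≤-stable λ nc → true≢false (∧-true₂ {adj G r v} h) (cong not (core-intro nc))

    some-nc : ∃ λ v → nc-neighbour v ≡ true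
    some-nc = ∑-find nc-neighbour (ℕ.≮⇒≥ λ lt → ℕ.<⇒≱ k<D (begin
      D ≤⟨ ℕ.≮⇒≥ core-r ⟩
      d r ≤⟨ ∑-mono split ⟩
      ∑ (λ v → ⟦ nc-neighbour v ⟧ + ⟦ adj G r v ∧ core? v ⟧) ≡⟨ ∑-+ (λ v → ⟦ nc-neighbour v ⟧) (λ v → ⟦ adj G r v ∧ core? v ⟧) ⟩
      ∑ (λ v → ⟦ nc-neighbour v ⟧) + κ ≤⟨ ℕ.+-mono-≤ (ℕ.≤-pred lt) κ≤k ⟩
      k ∎))
      where
      open ℕ.≤-Reasoning
      split : ∀ v → ⟦ adj G r v ⟧ ≤ ⟦ nc-neighbour v ⟧ + ⟦ adj G r v ∧ core? v ⟧
      split v with adj G r v | core? v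
      ... | false | _ = z≤n
      ... | true | true = ℕ.≤-refl
      ... | true | false = ℕ.≤-refl

    -- The fan at `x` around some neighbour `y` of `x` contains at least `def x` core vertices. Each
    -- of these is `r` itself, one of the κ core neighbours of `r`, or not adjacent to `r`.
    outer-bound : ∀ x → NC x → x ≢ r →
      (def x ≤ 1 + (κ + ∑ (λ v → ⟦ not (adj G r v) ∧ (not (v == r) ∧ not (v == x)) ⟧)) → ⊥) → ⊥
    outer-bound x ncx x≢r k =
      let (y , xy) = not-isolated x in
      state-exists {y} {x} (adj-sym xy) λ st →
        let (θ , θy) = Degrees.r-missing G D y st (degree≤D y) in
        Bounds.fan-core-count G D y no-total degree≤D st ncx θy λ K _ le → k (ℕ.≤-trans le (begin
          ∑ (λ v → ⟦ K v ∧ core? v ⟧) ≤⟨ ∑-mono (λ v → ⟦⟧-mono λ h → pointwise v (∧-true₂ {K v} h)) ⟩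
          ∑ (λ v → ⟦ v == r ⟧ + (⟦ adj G r v ∧ core? v ⟧ + ⟦ outer v ⟧))
            ≡⟨ trans (∑-+ (λ v → ⟦ v == r ⟧) (λ v → ⟦ adj G r v ∧ core? v ⟧ + ⟦ outer v ⟧))
                 (cong₂ _+_ (∑-δ r) (∑-+ (λ v → ⟦ adj G r v ∧ core? v ⟧) (λ v → ⟦ outer v ⟧))) ⟩
          1 + (κ + ∑ (λ v → ⟦ outer v ⟧)) ∎))
      where
      open ℕ.≤-Reasoning
      outer : V → Bool
      outer v = not (adj G r v) ∧ (not (v == r) ∧ not (v == x))
      pointwise : ∀ v → core? v ≡ true → 1 ≤ ⟦ v == r ⟧ + (⟦ adj G r v ∧ core? v ⟧ + ⟦ outer v ⟧)
      pointwise v h with v ≟ r | v ≟ x | true-or-false (adj G r v)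
      ... | yes _ | _ | _ = s≤s z≤n
      ... | no _ | yes refl | _ = ⊥-elim (core-elim {v} h ncx)
      ... | no _ | no _ | inj₁ a rewrite a | h = s≤s z≤n
      ... | no _ | no _ | inj₂ a rewrite a = s≤s z≤n

    overfull : Overfull G
    overfull with D * (n / 2) ℕ.<? numEdges G
    ... | yes h = h
    ... | no not-overfull =
      let (t , ht , max) = argmax nc-neighbour def some-nc
          rt = ∧-true₁ ht
          nct = nc-elim ht
      in ⊥-elim (state-exists rt λ st →
        let (θ , θr) = r-missing st (degree≤D r) in
        not-overfull (Overfullness.conflict-or-overfull G D r st θr (λ h → r-missing-unique st core-r h θr)
          λ st′ θr′ x≢r θx → Extremal.conflict-free G D r no-total degree≤D core-r
            (degree-bound-contradiction {n} {D} 1≤k κ≤k dense) outer-bound t nct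
            (λ v ncv rv → max v (∧-intro rv (cong not (not-true λ h → core-elim h ncv))))
            -- The first fan is rooted at `t` itself, which puts `t` into it; all later choices keep
            -- `t` in the fan.
            record { state = st′ ; ncs = nct ; θr = θr′ ; x≢r = x≢r ; θx = θx
                   ; t∈ = Fan.root∈ G D r no-total }))

theorem1p1 : (k : ℕ) → 2 ≤ k → (n : ℕ) → (G : Graph n) → DeltaCritical G →
    4 * n + 9 * k ≤ 6 * maxDeg G → minCoreDeg G ≤ k → Overfull G
theorem1p1 k 2≤k n G (critical , class2) dense few with ⊓-attained (coreDeg G) (inCore G) id n k few
... | inj₂ (r , in-core , le) = AtCore.overfull G critical class2 k (ℕ.≤-trans (s≤s z≤n) 2≤k) dense r in-core le
-- The seed `n` of the minimum cannot be at most `k`, because `k < D ≤ n`.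
... | inj₁ n≤k = ⊥-elim (ℕ.<⇒≱ (k<D G critical class2 k 1≤k dense) (ℕ.≤-trans (D≤n G critical class2 k 1≤k dense) n≤k))
  where
  1≤k : 1 ≤ k
  1≤k = ℕ.≤-trans (s≤s z≤n) 2≤k
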